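{- For all integers $n\geq 1$, $p\geq 1$, $q\geq 1$, the double starlike tree $H(p,n,q)$ is determined by its Laplacian spectrum; that is, every graph $L$-cospectral to $H(p,n,q)$ is isomorphic to $H(p,n,q)$.
   Context: All graphs are finite, simple and undirected. For a graph $G$, its Laplacian matrix is $L(G)=D(G)-A(G)$, where $A(G)$ is the $(0,1)$-adjacency matrix and $D(G)$ the diagonal matrix of vertex degrees; the Laplacian spectrum is the multiset of eigenvalues of $L(G)$. Two graphs are $L$-cospectral if they have the same Laplacian spectrum, and a graph is determined by its Laplacian spectrum if every graph $L$-cospectral to it is isomorphic to it. For integers $n,p,q\geq 1$, $H(p,n,q)$ is the tree obtained from a path $P_n$ with vertices $1,2,\ldots,n$ (in order) by attaching $p$ new pendant vertices to vertex $1$ and $q$ new pendant vertices to vertex $n$ (equivalently, identifying the centers of stars $K_{1,p}$ and $K_{1,q}$ with the two ends of $P_n$); it has $n+p+q$ vertices. (For $n=1$ this is the star $K_{1,p+q}$.) -}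

module Defs where

open import Data.Bool using (Bool; true; false; if_then_else_; _∧_; _∨_)
open import Data.Nat as ℕ using (ℕ; zero; suc; _<ᵇ_; _≡ᵇ_; _∸_)
open import Data.Integer as ℤ using (ℤ; +_; -_)
open import Data.List using (List; []; _∷_; [_]; map)
open import Data.Fin using (Fin; zero; suc; toℕ; punchIn; _≟_)
open import Data.Product using (Σ; _×_)
open import Function.Bundles using (_↔_; Inverse)
open import Relation.Binary.PropositionalEquality using (_≡_)
open import Relation.Nullary using (does)

Adj : ℕ → Set
Adj m = Fin m → Fin m → Bool

IsSimple : ∀ {m} → Adj m → Set
IsSimple {m} A = (∀ i j → A i j ≡ A j i) × (∀ i → A i i ≡ false)

Isomorphic : ∀ {m k} → Adj m → Adj k → Set
Isomorphic {m} {k} A B =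
  Σ (Fin m ↔ Fin k) λ f → ∀ i j → A i j ≡ B (Inverse.to f i) (Inverse.to f j)

-- Univariate polynomials over ℤ as coefficient lists (lowest degree first).

Poly : Set
Poly = List ℤ

_+ₚ_ : Poly → Poly → Poly
[] +ₚ q = q
(a ∷ p) +ₚ [] = a ∷ p
(a ∷ p) +ₚ (b ∷ q) = (a ℤ.+ b) ∷ (p +ₚ q)

negₚ : Poly → Poly
negₚ = map (-_)

_*ₚ_ : Poly → Poly → Poly
[] *ₚ q = []
(a ∷ p) *ₚ q = map (a ℤ.*_) q +ₚ (+ 0 ∷ (p *ₚ q))

coeff : Poly → ℕ → ℤ
coeff [] _ = + 0
coeff (a ∷ p) zero = a
coeff (a ∷ p) (suc k) = coeff p k

-- equality of polynomials (coefficientwise, ignoring trailing zeros)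
_≈ₚ_ : Poly → Poly → Set
p ≈ₚ q = ∀ k → coeff p k ≡ coeff q k

odd : ℕ → Bool
odd zero = false
odd (suc n) = if odd n then false else true

sumFinₚ : ∀ n → (Fin n → Poly) → Poly
sumFinₚ zero f = []
sumFinₚ (suc n) f = f zero +ₚ sumFinₚ n (λ i → f (suc i))

det : ∀ n → (Fin n → Fin n → Poly) → Poly
det zero M = [ + 1 ]
det (suc n) M = sumFinₚ (suc n) λ j →
  let t = M zero j *ₚ det n (λ i k → M (suc i) (punchIn j k))
  in if odd (toℕ j) then negₚ t else t

countFin : ∀ n → (Fin n → Bool) → ℕ
countFin zero f = 0
countFin (suc n) f = (if f zero then 1 else 0) ℕ.+ countFin n (λ i → f (suc i))

degree : ∀ {m} → Adj m → Fin m → ℕ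
degree {m} A i = countFin m (A i)

laplacian : ∀ {m} → Adj m → Fin m → Fin m → ℤ
laplacian A i j =
  if does (i ≟ j) then + degree A i
  else (if A i j then - (+ 1) else + 0)

lapCharPoly : ∀ {m} → Adj m → Poly
lapCharPoly {m} A =
  det m λ i j → if does (i ≟ j) then (- laplacian A i j) ∷ [ + 1 ]
                else [ - laplacian A i j ]

-- L-cospectral: same Laplacian spectrum (multiset of eigenvalues), i.e.
-- same characteristic polynomial of the Laplacian.
LCospectral : ∀ {m k} → Adj m → Adj k → Set
LCospectral A B = lapCharPoly A ≈ₚ lapCharPoly B

-- The double starlike tree H(p,n,q) on n + p + q vertices.
-- Vertex labels (via toℕ): 0 .. n-1 form the path P_n (path vertex t+1
-- is label t); labels n .. n+p-1 are the p pendants attached to label 0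
-- (path vertex 1); labels n+p .. n+p+q-1 are the q pendants attached to
-- label n-1 (path vertex n).

HEdgeℕ : (p n q : ℕ) → ℕ → ℕ → Bool
HEdgeℕ p n q a b = path a b ∨ path b a ∨ pend a b ∨ pend b a
  where
  path : ℕ → ℕ → Bool
  path x y = (suc x <ᵇ n) ∧ (y ≡ᵇ suc x)
  inP : ℕ → Bool
  inP x = (x <ᵇ n ℕ.+ p) ∧ (if x <ᵇ n then false else true)
  inQ : ℕ → Bool
  inQ x = (x <ᵇ n ℕ.+ p ℕ.+ q) ∧ (if x <ᵇ n ℕ.+ p then false else true)
  pend : ℕ → ℕ → Bool
  pend x y = (inP x ∧ (y ≡ᵇ 0)) ∨ (inQ x ∧ (y ≡ᵇ n ∸ 1))

H : (p n q : ℕ) → Adj (n ℕ.+ p ℕ.+ q)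
H p n q i j = HEdgeℕ p n q (toℕ i) (toℕ j)

{-# OPTIONS --safe #-}

-- The coefficient of x in the Laplacian characteristic polynomial detects connectedness, and by Newton's
-- identities the top coefficients give tr L, …, tr L⁴. Hence a graph G cospectral with H(p,n,q) is connected with
-- one edge fewer than vertices, i.e. a tree, and with x = degree − 1 the numbers ∑x, ∑x², ∑x³ and
-- ∑x⁴ + 4∑_{uv ∈ E} x_u x_v of G are those of H(p,n,q).
--
-- Let p ≥ q. A majorization argument on ∑x(x−1) and ∑x(x−1)(x−2) gives a vertex with x ≥ p, so that
-- ∑x(x−1)(x−q)² ≥ p(p−1)(p−q)². For n ≥ 3 this means that ∑x⁴ is at least its value for H(p,n,q). On the other hand,
-- with d′ the number of non-leaf neighbours and y = x − 1 on non-leaves, y = 0 on leaves, every tree that is not a star satisfies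
-- ∑_{uv ∈ E} x_u x_v = ∑x − 1 + ∑_{uv ∈ E} y_u y_v + ∑y(d′ − 1) ≥ ∑x − 1, with equality for H(p,n,q).
-- So equality holds throughout: every vertex of degree at least 3 has exactly one non-leaf neighbour, and the
-- non-leaves of G form a path that has further leaves only at its ends. For n ≤ 2 the moments up to the third suffice.
module Submission where

-- Eigenvalues never occur; the spectrum enters only through integer identities. Newton's identities
-- come from the coefficients of the adjugate of xI - L, and connectedness from the coefficient of
-- x, so determinants over formal power series suffice. The obstacle is that the fourth trace fixes
-- only a combination of ∑x⁴ and an edge sum. The two are separated by bounding both from below. The
-- weight x(x-1)(x-q)² vanishes at 0, 1 and q, the values of x in H(p,n,q) at all vertices but one,
-- and its leading coefficient is 1, so the lower moments turn a bound on its sum into one on ∑x⁴.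
-- The edge bound need not be attained for n = 2, where the edge joining the two centres contributes
-- pq. There x takes only the values 0, p and q, and the cubic weight x(x-q)² does the same work
-- with one moment fewer. A tree is given by parent pointers together with a rank that decreases
-- towards the root. Such a structure is obtained for every choice of root, because the suitable
-- root, an end of the path of non-leaves, is known only after the degrees are.

module Determinant where

  open import Algebra.Bundles using (CommutativeRing)
  open import Data.Fin as Fin using (Fin; zero; suc; punchIn; punchOut)
  open import Data.Fin.Permutation using (Permutation; _⟨$⟩ʳ_)
  open import Data.Fin.Properties using (punchIn-punchOut)
  open import Data.Nat using (zero; suc; z≤n; s≤s)
  open import Data.Product using (_×_; _,_)
  open import Data.Unit.Polymorphic using (⊤; tt)
  open import Data.Vec.Functional using (_∷_)
  open import Function using (_∘_)
  open import Relation.Binary.PropositionalEquality as ≡ using (_≡_; _≢_)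
  open import Relation.Nullary using (contradiction)

  -- Determinants by expansion along the first row, over any commutative ring.

  module Det {c ℓ} (R : CommutativeRing c ℓ) where

    open CommutativeRing R hiding (zero)
    open import Algebra.Properties.Ring ring
    open import Algebra.Properties.CommutativeSemigroup *-commutativeSemigroup using (x∙yz≈y∙xz)
    open import Algebra.Properties.CommutativeSemigroup +-commutativeSemigroup using (interchange)
    open import Relation.Binary.Reasoning.Setoid setoid

    open import Algebra.Properties.Semiring.Sum semiring using (sum; ∑-distrib-+; ∑-comm; sum-remove; *-distribˡ-sum; sum-cong-≋; sum-permute)

    opaque
      ∑ : ∀ {n} → (Fin n → Carrier) → Carrier
      ∑ = sum

      alt : ∀ {n} → (Fin n → Carrier) → Carrier
      alt {zero}  f = 0#
      alt {suc n} f = f zero + - alt (f ∘ suc)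

      det : ∀ {n} → (Fin n → Fin n → Carrier) → Carrier
      det {zero}  M = 1#
      det {suc n} M = alt λ j → M zero j * det λ i k → M (suc i) (punchIn j k)

    -- The factor (-1)^i as an operation, recursive in `i`, so that signs need neither parities nor
    -- powers of -1.
    sg : ∀ {n} → Fin n → Carrier → Carrier
    sg zero    x = x
    sg (suc i) x = - sg i x

    opaque
      unfolding ∑ alt det

      ∑-zero : (f : Fin 0 → Carrier) → ∑ f ≡ 0#
      ∑-zero f = ≡.refl

      ∑-suc : ∀ {n} (f : Fin (suc n) → Carrier) → ∑ f ≡ f zero + ∑ (f ∘ suc)
      ∑-suc f = ≡.refl

      alt-zero : (f : Fin 0 → Carrier) → alt f ≡ 0#
      alt-zero f = ≡.refl

      alt-suc : ∀ {n} (f : Fin (suc n) → Carrier) → alt f ≡ f zero + - alt (f ∘ suc)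
      alt-suc f = ≡.refl

      det-zero : (M : Fin 0 → Fin 0 → Carrier) → det M ≡ 1#
      det-zero M = ≡.refl

      det-suc : ∀ {n} (M : Fin (suc n) → Fin (suc n) → Carrier) →
        det M ≡ alt λ j → M zero j * det λ i k → M (suc i) (punchIn j k)
      det-suc M = ≡.refl

      ∑-cong : ∀ {n} {f g : Fin n → Carrier} → (∀ i → f i ≈ g i) → ∑ f ≈ ∑ g
      ∑-cong {n} {f} {g} h = sum-cong-≋ {n} {f} {g} h

      ∑-+ : ∀ {n} (f g : Fin n → Carrier) → ∑ (λ i → f i + g i) ≈ ∑ f + ∑ g
      ∑-+ f g = ∑-distrib-+ f g

      ∑-swap : ∀ {m n} (f : Fin m → Fin n → Carrier) → ∑ (λ i → ∑ λ j → f i j) ≈ ∑ (λ j → ∑ λ i → f i j)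
      ∑-swap f = ∑-comm f

      ∑-remove : ∀ {n} (i : Fin (suc n)) (f : Fin (suc n) → Carrier) → ∑ f ≈ f i + ∑ (f ∘ punchIn i)
      ∑-remove i f = sum-remove f

      ∑-* : ∀ {n} a (f : Fin n → Carrier) → ∑ (λ i → a * f i) ≈ a * ∑ f
      ∑-* a f = sym (*-distribˡ-sum a f)

      ∑-permute : ∀ {m n} (f : Fin n → Carrier) (π : Permutation m n) → ∑ f ≈ ∑ (λ i → f (π ⟨$⟩ʳ i))
      ∑-permute f π = sum-permute f π

      ∑-neg : ∀ {n} (f : Fin n → Carrier) → ∑ (λ i → - f i) ≈ - ∑ f
      ∑-neg {zero}  f = sym -0#≈0#
      ∑-neg {suc n} f = trans (+-congˡ (∑-neg (f ∘ suc))) (-‿+-comm _ _)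

      ∑-0 : ∀ {n} {f : Fin n → Carrier} → (∀ i → f i ≈ 0#) → ∑ f ≈ 0#
      ∑-0 {zero}  h = refl
      ∑-0 {suc n} {f} h = trans (+-cong (h zero) (∑-0 {n} {f ∘ suc} (h ∘ suc))) (+-identityˡ 0#)

      alt-cong : ∀ {n} {f g : Fin n → Carrier} → (∀ j → f j ≈ g j) → alt f ≈ alt g
      alt-cong {zero}  h = refl
      alt-cong {suc n} {f} {g} h = +-cong (h zero) (-‿cong (alt-cong {n} {f ∘ suc} {g ∘ suc} (h ∘ suc)))

      alt-0 : ∀ {n} {f : Fin n → Carrier} → (∀ j → f j ≈ 0#) → alt f ≈ 0#
      alt-0 {zero}  h = refl
      alt-0 {suc n} {f} h = trans (+-cong (h zero) (trans (-‿cong (alt-0 {n} {f ∘ suc} (h ∘ suc))) -0#≈0#)) (+-identityˡ 0#)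

      alt-+ : ∀ {n} (f g : Fin n → Carrier) → alt (λ j → f j + g j) ≈ alt f + alt g
      alt-+ {zero}  f g = sym (+-identityˡ 0#)
      alt-+ {suc n} f g = begin
        f zero + g zero + - alt (λ j → f (suc j) + g (suc j))
          ≈⟨ +-congˡ (trans (-‿cong (alt-+ (f ∘ suc) (g ∘ suc))) (sym (-‿+-comm _ _))) ⟩
        f zero + g zero + (- alt (f ∘ suc) + - alt (g ∘ suc))
          ≈⟨ interchange _ _ _ _ ⟩
        (f zero + - alt (f ∘ suc)) + (g zero + - alt (g ∘ suc)) ∎

      alt-neg : ∀ {n} (f : Fin n → Carrier) → alt (λ j → - f j) ≈ - alt f
      alt-neg {zero}  f = sym -0#≈0#
      alt-neg {suc n} f = trans (+-congˡ (-‿cong (alt-neg (f ∘ suc)))) (-‿+-comm _ _)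

      alt-* : ∀ {n} a (f : Fin n → Carrier) → alt (λ j → a * f j) ≈ a * alt f
      alt-* {zero}  a f = sym (zeroʳ a)
      alt-* {suc n} a f = begin
        a * f zero + - alt (λ j → a * f (suc j)) ≈⟨ +-congˡ (trans (-‿cong (alt-* a (f ∘ suc))) (-‿distribʳ-* a _)) ⟩
        a * f zero + a * - alt (f ∘ suc)         ≈⟨ distribˡ a _ _ ⟨
        a * (f zero + - alt (f ∘ suc))           ∎

      det-cong : ∀ {n} {M N : Fin n → Fin n → Carrier} → (∀ i j → M i j ≈ N i j) → det M ≈ det N
      det-cong {zero}  h = refl
      det-cong {suc n} {M} {N} h = alt-cong
        {f = λ j → M zero j * det λ i k → M (suc i) (punchIn j k)}
        {g = λ j → N zero j * det λ i k → N (suc i) (punchIn j k)}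
        λ j → *-cong (h zero j) (det-cong λ i k → h (suc i) (punchIn j k))

    sg-cong : ∀ {n} (i : Fin n) {x y} → x ≈ y → sg i x ≈ sg i y
    sg-cong zero    h = h
    sg-cong (suc i) h = -‿cong (sg-cong i h)

    sg-0 : ∀ {n} (i : Fin n) → sg i 0# ≈ 0#
    sg-0 zero    = refl
    sg-0 (suc i) = trans (-‿cong (sg-0 i)) -0#≈0#

    sg-neg : ∀ {n} (i : Fin n) x → sg i (- x) ≈ - sg i x
    sg-neg zero    x = refl
    sg-neg (suc i) x = -‿cong (sg-neg i x)

    sg-*ʳ : ∀ {n} (i : Fin n) a x → sg i (a * x) ≈ a * sg i x
    sg-*ʳ zero    a x = refl
    sg-*ʳ (suc i) a x = trans (-‿cong (sg-*ʳ i a x)) (-‿distribʳ-* a _)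

    sg-alt : ∀ {m n} (i : Fin m) (f : Fin n → Carrier) → alt (λ j → sg i (f j)) ≈ sg i (alt f)
    sg-alt zero    f = refl
    sg-alt (suc i) f = trans (alt-neg _) (-‿cong (sg-alt i f))

    sg-∑ : ∀ {m n} (i : Fin m) (f : Fin n → Carrier) → sg i (∑ f) ≈ ∑ (λ l → sg i (f l))
    sg-∑ zero    f = refl
    sg-∑ (suc i) f = trans (-‿cong (sg-∑ i f)) (sym (∑-neg _))

    alt-∑ : ∀ {n} (f : Fin n → Carrier) → alt f ≈ ∑ (λ l → sg l (f l))
    alt-∑ {zero}  f = reflexive (≡.trans (alt-zero f) (≡.sym (∑-zero _)))
    alt-∑ {suc n} f = begin
      alt f                                     ≡⟨ alt-suc f ⟩
      f zero + - alt (f ∘ suc)                  ≈⟨ +-congˡ (trans (-‿cong (alt-∑ (f ∘ suc))) (sym (∑-neg _))) ⟩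
      f zero + ∑ (λ l → - sg l (f (suc l)))     ≡⟨ ∑-suc (λ l → sg l (f l)) ⟨
      ∑ (λ l → sg l (f l))                      ∎

    alt-∑-comm : ∀ {m n} (f : Fin m → Fin n → Carrier) →
                 alt (λ j → ∑ λ i → f j i) ≈ ∑ (λ i → alt λ j → f j i)
    alt-∑-comm f = begin
      alt (λ j → ∑ λ i → f j i)              ≈⟨ alt-∑ _ ⟩
      ∑ (λ j → sg j (∑ λ i → f j i))         ≈⟨ ∑-cong (λ j → sg-∑ j _) ⟩
      ∑ (λ j → ∑ λ i → sg j (f j i))         ≈⟨ ∑-swap _ ⟩
      ∑ (λ i → ∑ λ j → sg j (f j i))         ≈⟨ ∑-cong (λ i → alt-∑ _) ⟨
      ∑ (λ i → alt λ j → f j i)              ∎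

    -- For rows r, s and F j k the minor of the remaining rows without the
    -- columns j and punchIn j k, this is det (r ∷ s ∷ _) expanded twice.
    alt² : ∀ {n} (r s : Fin (suc n) → Carrier) (F : Fin (suc n) → Fin n → Carrier) → Carrier
    alt² r s F = alt λ j → r j * alt λ k → s (punchIn j k) * F j k

    -- F j k depends only on the unordered pair {j , punchIn j k}.
    Unordered : ∀ {n} → (Fin (suc n) → Fin n → Carrier) → Set ℓ
    Unordered {zero}  F = ⊤
    Unordered {suc n} F = (∀ k → F zero k ≈ F (suc k) zero) × Unordered (λ j k → F (suc j) (suc k))

    alt²-zero : ∀ r s (F : Fin 1 → Fin 0 → Carrier) → alt² r s F ≈ 0#
    alt²-zero r s F = alt-0 λ j → trans (*-congˡ (reflexive (alt-zero _))) (zeroʳ _)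

    -- Pairs of columns are sorted by whether they contain column 0. A pair that does occurs twice,
    -- with column 0 used by `r` or by `s`, with opposite signs and, by `Unordered`, with the same
    -- minor. Pairs that do not contain it pick up two extra signs, which cancel, and form the
    -- recursive `alt²`.
    alt²-suc : ∀ {n} (r s : Fin (suc (suc n)) → Carrier) F → Unordered F →
      alt² r s F ≈ (r zero * alt (λ k → s (suc k) * F zero k) + - (s zero * alt (λ k → r (suc k) * F zero k)))
                   + alt² (r ∘ suc) (s ∘ suc) (λ j k → F (suc j) (suc k))
    alt²-suc r s F (h , _) = begin
      alt² r s F
        ≡⟨ alt-suc _ ⟩
      r zero * A s + - alt (λ j → r (suc j) * alt (λ k → s (punchIn (suc j) k) * F (suc j) k))
        ≈⟨ +-congˡ (-‿cong (alt-cong expand)) ⟩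
      r zero * A s + - alt (λ j → s zero * (r (suc j) * F zero j) + - (r (suc j) * X j))
        ≈⟨ +-congˡ (-‿cong (trans (alt-+ _ _) (+-cong (alt-* (s zero) _) (alt-neg _)))) ⟩
      r zero * A s + - (s zero * A r + - Y)
        ≈⟨ +-congˡ (trans (sym (-‿+-comm _ _)) (+-congˡ (-‿involutive Y))) ⟩
      r zero * A s + (- (s zero * A r) + Y)
        ≈⟨ +-assoc _ _ _ ⟨
      (r zero * A s + - (s zero * A r)) + Y ∎
      where
      A = λ t → alt (λ k → t (suc k) * F zero k)
      X = λ j → alt (λ k → s (suc (punchIn j k)) * F (suc j) (suc k))
      Y = alt² (r ∘ suc) (s ∘ suc) (λ j k → F (suc j) (suc k))
      expand : ∀ j → r (suc j) * alt (λ k → s (punchIn (suc j) k) * F (suc j) k)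
                     ≈ s zero * (r (suc j) * F zero j) + - (r (suc j) * X j)
      expand j = begin
        r (suc j) * alt (λ k → s (punchIn (suc j) k) * F (suc j) k) ≡⟨ ≡.cong (r (suc j) *_) (alt-suc _) ⟩
        r (suc j) * (s zero * F (suc j) zero + - X j)               ≈⟨ distribˡ _ _ _ ⟩
        r (suc j) * (s zero * F (suc j) zero) + r (suc j) * - X j
          ≈⟨ +-cong (trans (*-congˡ (*-congˡ (sym (h j)))) (x∙yz≈y∙xz _ _ _)) (sym (-‿distribʳ-* _ _)) ⟩
        s zero * (r (suc j) * F zero j) + - (r (suc j) * X j)       ∎

    alt²-antisym : ∀ {n} r s (F : Fin (suc n) → Fin n → Carrier) → Unordered F → alt² r s F ≈ - alt² s r F
    alt²-antisym {zero}  r s F h = trans (alt²-zero r s F) (sym (trans (-‿cong (alt²-zero s r F)) -0#≈0#))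
    alt²-antisym {suc n} r s F h@(_ , h′) = begin
      alt² r s F        ≈⟨ alt²-suc r s F h ⟩
      (a + - b) + Y     ≈⟨ +-cong (trans (+-congʳ (sym (-‿involutive a))) (trans (+-comm _ _) (-‿+-comm b (- a))))
                                  (alt²-antisym (r ∘ suc) (s ∘ suc) _ h′) ⟩
      - (b + - a) + - Z ≈⟨ -‿+-comm _ _ ⟩
      - ((b + - a) + Z) ≈⟨ -‿cong (alt²-suc s r F h) ⟨
      - alt² s r F      ∎
      where
      a = r zero * alt (λ k → s (suc k) * F zero k)
      b = s zero * alt (λ k → r (suc k) * F zero k)
      Y = alt² (r ∘ suc) (s ∘ suc) (λ j k → F (suc j) (suc k))
      Z = alt² (s ∘ suc) (r ∘ suc) (λ j k → F (suc j) (suc k))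

    -- Antisymmetry does not imply this, since 2 may be a zero divisor in `R`; the recursion of
    -- `alt²-suc` gives it directly.
    alt²-alternating : ∀ {n} r (F : Fin (suc n) → Fin n → Carrier) → Unordered F → alt² r r F ≈ 0#
    alt²-alternating {zero}  r F h = alt²-zero r r F
    alt²-alternating {suc n} r F h@(_ , h′) = trans (alt²-suc r r F h)
      (trans (+-cong (-‿inverseʳ _) (alt²-alternating (r ∘ suc) _ h′)) (+-identityˡ 0#))

    private
      lift : ∀ {n} → (Fin n → Fin (suc (suc n))) → Fin (suc n) → Fin (suc (suc (suc n)))
      lift h zero    = zero
      lift h (suc l) = suc (h l)

      Unordered-cong : ∀ {n} {F G : Fin (suc n) → Fin n → Carrier} → (∀ j k → F j k ≈ G j k) → Unordered F → Unordered G
      Unordered-cong {zero}  e u = tt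
      Unordered-cong {suc n} e (u , v) =
        (λ k → trans (sym (e zero k)) (trans (u k) (e (suc k) zero))) , Unordered-cong (λ j k → e (suc j) (suc k)) v

      -- The minor is abstracted to a function `Φ` of the embedding of the surviving columns. If
      -- neither deleted column is 0, then column 0 survives and the embedding is a `lift`, so the
      -- induction continues with `Φ` composed with `lift`. Embeddings agree only pointwise, hence
      -- the hypothesis `Φ-cong`.
      unordered : ∀ {n} (Φ : (Fin n → Fin (suc (suc n))) → Carrier) →
        (∀ g h → (∀ l → g l ≡ h l) → Φ g ≈ Φ h) → Unordered (λ j k → Φ (λ l → punchIn j (punchIn k l)))
      unordered {zero}  Φ Φ-cong = (λ { zero → Φ-cong _ _ λ () }) , tt
      unordered {suc n} Φ Φ-cong = (λ k → Φ-cong _ _ λ l → ≡.refl) , Unordered-cong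
        (λ j k → Φ-cong (lift λ l → punchIn j (punchIn k l)) (λ l → punchIn (suc j) (punchIn (suc k) l))
          λ { zero → ≡.refl ; (suc l) → ≡.refl })
        (unordered (λ h → Φ (lift h))
          (λ g h e → Φ-cong (lift g) (lift h) λ { zero → ≡.refl ; (suc l) → ≡.cong suc (e l) }))

      minors : ∀ {n} → (Fin n → Fin (suc (suc n)) → Carrier) → Fin (suc (suc n)) → Fin (suc n) → Carrier
      minors N j k = det λ i l → N i (punchIn j (punchIn k l))

      minors-unordered : ∀ {n} (N : Fin n → Fin (suc (suc n)) → Carrier) → Unordered (minors N)
      minors-unordered N = unordered (λ g → det (λ i l → N i (g l)))
        (λ g h e → det-cong λ i l → reflexive (≡.cong (N i) (e l)))

    det-∷ : ∀ {n} r (N : Fin n → Fin (suc n) → Carrier) → det (r ∷ N) ≡ alt λ j → r j * det λ i k → N i (punchIn j k)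
    det-∷ r N = det-suc (r ∷ N)

    det-∷∷ : ∀ {n} r s (N : Fin n → Fin (suc (suc n)) → Carrier) → det (r ∷ s ∷ N) ≈ alt² r s (minors N)
    det-∷∷ r s N = trans (reflexive (det-∷ r (s ∷ N))) (alt-cong λ j → *-congˡ (reflexive (det-suc _)))

    det-swap : ∀ {n} r s (N : Fin n → Fin (suc (suc n)) → Carrier) → det (r ∷ s ∷ N) ≈ - det (s ∷ r ∷ N)
    det-swap r s N = trans (det-∷∷ r s N)
      (trans (alt²-antisym r s (minors N) (minors-unordered N)) (-‿cong (sym (det-∷∷ s r N))))

    det-repeat : ∀ {n} r (N : Fin n → Fin (suc (suc n)) → Carrier) → det (r ∷ r ∷ N) ≈ 0#
    det-repeat r N = trans (det-∷∷ r r N) (alt²-alternating r (minors N) (minors-unordered N))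

    private
      ∷-cong : ∀ {n} {A : Set} (r : A → Carrier) {M N : Fin n → A → Carrier} → (∀ i j → M i j ≈ N i j) →
        ∀ i j → (r ∷ M) i j ≈ (r ∷ N) i j
      ∷-cong r h zero    j = refl
      ∷-cong r h (suc i) j = h i j

    -- Mutual recursion: `det-move₁` keeps the first row and moves row `i` of the rest up inside all
    -- the minors at once; `det-move` then needs a single exchange of the first two rows, which
    -- supplies the last factor -1.
    det-move₁ : ∀ {n} (r : Fin (suc (suc n)) → Carrier) (N : Fin (suc n) → Fin (suc (suc n)) → Carrier) (i : Fin (suc n)) →
      det (r ∷ N) ≈ sg i (det (r ∷ N i ∷ (N ∘ punchIn i)))

    det-move : ∀ {n} (M : Fin (suc n) → Fin (suc n) → Carrier) i → det M ≈ sg i (det (M i ∷ (M ∘ punchIn i)))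
    det-move M zero = det-cong {M = M} {N = M zero ∷ (M ∘ suc)} λ { zero j → refl ; (suc i) j → refl }
    det-move {suc n} M (suc i) = begin
      det M                                                           ≈⟨ det-cong {M = M} {N = M zero ∷ (M ∘ suc)} (λ { zero j → refl ; (suc i) j → refl }) ⟩
      det (M zero ∷ (M ∘ suc))                                        ≈⟨ det-move₁ (M zero) (M ∘ suc) i ⟩
      sg i (det (M zero ∷ M (suc i) ∷ (M ∘ suc ∘ punchIn i)))         ≈⟨ sg-cong i (det-swap (M zero) (M (suc i)) (M ∘ suc ∘ punchIn i)) ⟩
      sg i (- det (M (suc i) ∷ M zero ∷ (M ∘ suc ∘ punchIn i)))       ≈⟨ sg-neg i _ ⟩
      - sg i (det (M (suc i) ∷ M zero ∷ (M ∘ suc ∘ punchIn i)))       ≈⟨ -‿cong (sg-cong i (det-cong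
          {M = M (suc i) ∷ M zero ∷ (M ∘ suc ∘ punchIn i)} {N = M (suc i) ∷ (M ∘ punchIn (suc i))}
          (∷-cong (M (suc i)) {M zero ∷ (M ∘ suc ∘ punchIn i)} {M ∘ punchIn (suc i)} λ { zero j → refl ; (suc k) j → refl }))) ⟩
      - sg i (det (M (suc i) ∷ (M ∘ punchIn (suc i))))                ∎

    det-move₁ r N i = begin
      det (r ∷ N)
        ≡⟨ det-∷ r N ⟩
      alt (λ j → r j * det (λ a b → N a (punchIn j b)))
        ≈⟨ alt-cong (λ j → trans (*-congˡ (trans (det-move (λ a b → N a (punchIn j b)) i)
             (sg-cong i (det-cong {N = λ a b → (N i ∷ (N ∘ punchIn i)) a (punchIn j b)}
               λ { zero b → refl ; (suc a) b → refl })))) (sym (sg-*ʳ i (r j) _))) ⟩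
      alt (λ j → sg i (r j * det (λ a b → (N i ∷ (N ∘ punchIn i)) a (punchIn j b))))
        ≈⟨ sg-alt i _ ⟩
      sg i (alt (λ j → r j * det (λ a b → (N i ∷ (N ∘ punchIn i)) a (punchIn j b))))
        ≡⟨ ≡.cong (sg i) (det-∷ r (N i ∷ (N ∘ punchIn i))) ⟨
      sg i (det (r ∷ N i ∷ (N ∘ punchIn i))) ∎

    cof : ∀ {n} (M : Fin (suc n) → Fin (suc n) → Carrier) → Fin (suc n) → Fin (suc n) → Carrier
    cof M i l = sg i (sg l (det λ a b → M (punchIn i a) (punchIn l b)))

    -- The cofactors of row `i` do not involve row `i`, so they serve for any row `r` put in its
    -- place. Both Cramer identities and Jacobi's formula are instances.
    det-replace : ∀ {n} (M : Fin (suc n) → Fin (suc n) → Carrier) i (r : Fin (suc n) → Carrier) →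
      sg i (det (r ∷ (M ∘ punchIn i))) ≈ ∑ (λ l → r l * cof M i l)
    det-replace M i r = begin
      sg i (det (r ∷ (M ∘ punchIn i)))         ≡⟨ ≡.cong (sg i) (det-∷ r (M ∘ punchIn i)) ⟩
      sg i (alt λ l → r l * minor l)           ≈⟨ sg-cong i (alt-∑ _) ⟩
      sg i (∑ λ l → sg l (r l * minor l))      ≈⟨ sg-∑ i _ ⟩
      ∑ (λ l → sg i (sg l (r l * minor l)))    ≈⟨ ∑-cong (λ l → trans (sg-cong i (sg-*ʳ l (r l) (minor l))) (sg-*ʳ i (r l) _)) ⟩
      ∑ (λ l → r l * cof M i l)                ∎
      where minor = λ l → det λ a b → M (punchIn i a) (punchIn l b)

    cramer-≡ : ∀ {n} (M : Fin (suc n) → Fin (suc n) → Carrier) i → ∑ (λ l → M i l * cof M i l) ≈ det M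
    cramer-≡ M i = trans (sym (det-replace M i (M i))) (sym (det-move M i))

    -- Replacing row `i` by a copy of row `k` produces a determinant with two equal rows.
    cramer-≢ : ∀ {n} (M : Fin (suc n) → Fin (suc n) → Carrier) {i k} → i ≢ k → ∑ (λ l → M k l * cof M i l) ≈ 0#
    cramer-≢ {zero}  M {zero} {zero} i≢k = contradiction ≡.refl i≢k
    cramer-≢ {suc n} M {i} {k} i≢k = begin
      ∑ (λ l → M k l * cof M i l)                        ≈⟨ det-replace M i (M k) ⟨
      sg i (det (M k ∷ N))                               ≈⟨ sg-cong i (det-move₁ (M k) N k′) ⟩
      sg i (sg k′ (det (M k ∷ N k′ ∷ (N ∘ punchIn k′)))) ≡⟨ ≡.cong (λ z → sg i (sg k′ (det (M k ∷ M z ∷ (N ∘ punchIn k′))))) (punchIn-punchOut i≢k) ⟩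
      sg i (sg k′ (det (M k ∷ M k ∷ (N ∘ punchIn k′))))  ≈⟨ sg-cong i (sg-cong k′ (det-repeat (M k) (N ∘ punchIn k′))) ⟩
      sg i (sg k′ 0#)                                    ≈⟨ trans (sg-cong i (sg-0 k′)) (sg-0 i) ⟩
      0#                                                 ∎
      where
      N  = M ∘ punchIn i
      k′ = punchOut i≢k

    -- Additivity and the product rule already force `D` to kill 0 and 1 and to commute with signs.
    -- The instance needed is the formal derivative of power series.
    module Derivation
      (D : Carrier → Carrier)
      (D-cong : ∀ {x y} → x ≈ y → D x ≈ D y)
      (D-+ : ∀ x y → D (x + y) ≈ D x + D y)
      (D-* : ∀ x y → D (x * y) ≈ D x * y + x * D y) where

      private
        D-0 : D 0# ≈ 0#
        D-0 = +-cancelˡ (D 0#) _ _ (trans (sym (D-+ 0# 0#)) (trans (D-cong (+-identityˡ 0#)) (sym (+-identityʳ _))))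

        D-neg : ∀ x → D (- x) ≈ - D x
        D-neg x = +-inverseʳ-unique (D x) (D (- x)) (trans (sym (D-+ x (- x))) (trans (D-cong (-‿inverseʳ x)) D-0))

        D-alt : ∀ {n} (f : Fin n → Carrier) → D (alt f) ≈ alt (λ j → D (f j))
        D-alt {zero}  f = trans (D-cong (reflexive (alt-zero f))) (trans D-0 (sym (reflexive (alt-zero _))))
        D-alt {suc n} f = begin
          D (alt f)                            ≡⟨ ≡.cong D (alt-suc f) ⟩
          D (f zero + - alt (f ∘ suc))         ≈⟨ trans (D-+ _ _) (+-congˡ (trans (D-neg _) (-‿cong (D-alt (f ∘ suc))))) ⟩
          D (f zero) + - alt (λ j → D (f (suc j))) ≡⟨ alt-suc (λ j → D (f j)) ⟨
          alt (λ j → D (f j))                  ∎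

        D-det′ : ∀ {n} (M : Fin (suc n) → Fin (suc n) → Carrier) →
          D (det M) ≈ ∑ (λ i → sg i (det ((λ l → D (M i l)) ∷ (M ∘ punchIn i))))

        -- The terms in which `D` meets a row other than the first. By induction `D` meets one row
        -- of each minor, which stands in front there; a swap with the undifferentiated first row
        -- brings it to the front of the whole matrix and costs the sign.
        D-tail : ∀ {n} (M : Fin (suc n) → Fin (suc n) → Carrier) →
          alt (λ j → M zero j * D (det λ a b → M (suc a) (punchIn j b)))
            ≈ ∑ (λ i → - sg i (det ((λ l → D (M (suc i) l)) ∷ (M ∘ punchIn (suc i)))))
        D-tail {zero} M = trans (alt-0 λ j → trans (*-congˡ (D-1 _)) (zeroʳ _)) (sym (reflexive (∑-zero _)))
          where
          D-1 : (N : Fin 0 → Fin 0 → Carrier) → D (det N) ≈ 0#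
          D-1 N = begin
            D (det N)                        ≡⟨ ≡.cong D (det-zero N) ⟩
            D 1#                             ≈⟨ +-cancelˡ (D 1#) _ _ (trans (sym (trans (D-cong (sym (*-identityˡ 1#))) (trans (D-* 1# 1#)
                                                  (+-cong (*-identityʳ _) (*-identityˡ _))))) (sym (+-identityʳ _))) ⟩
            0#                               ∎
        D-tail {suc n} M = begin
          alt (λ j → M zero j * D (minor j))
            ≈⟨ alt-cong (λ j → trans (*-congˡ (D-det′ _)) (sym (∑-* _ _))) ⟩
          alt (λ j → ∑ λ i → M zero j * sg i (det (row j i)))
            ≈⟨ alt-∑-comm _ ⟩
          ∑ (λ i → alt λ j → M zero j * sg i (det (row j i)))
            ≈⟨ ∑-cong term ⟩
          ∑ (λ i → - sg i (det ((λ l → D (M (suc i) l)) ∷ (M ∘ punchIn (suc i))))) ∎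
          where
          minor = λ j → det λ a b → M (suc a) (punchIn j b)
          row = λ j i → (λ l → D (M (suc i) (punchIn j l))) ∷ ((λ a b → M (suc a) (punchIn j b)) ∘ punchIn i)
          term : ∀ i → alt (λ j → M zero j * sg i (det (row j i)))
            ≈ - sg i (det ((λ l → D (M (suc i) l)) ∷ (M ∘ punchIn (suc i))))
          term i = begin
            alt (λ j → M zero j * sg i (det (row j i)))
              ≈⟨ alt-cong (λ j → trans (*-congˡ (sg-cong i (det-cong {M = row j i} {N = λ a b → N a (punchIn j b)}
                   λ { zero b → refl ; (suc a) b → refl }))) (sym (sg-*ʳ i _ _))) ⟩
            alt (λ j → sg i (M zero j * det (λ a b → N a (punchIn j b))))
              ≈⟨ sg-alt i _ ⟩
            sg i (alt λ j → M zero j * det (λ a b → N a (punchIn j b)))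
              ≡⟨ ≡.cong (sg i) (det-∷ (M zero) N) ⟨
            sg i (det (M zero ∷ N))
              ≈⟨ sg-cong i (det-swap (M zero) (λ l → D (M (suc i) l)) (M ∘ suc ∘ punchIn i)) ⟩
            sg i (- det ((λ l → D (M (suc i) l)) ∷ M zero ∷ (M ∘ suc ∘ punchIn i)))
              ≈⟨ sg-neg i _ ⟩
            - sg i (det ((λ l → D (M (suc i) l)) ∷ M zero ∷ (M ∘ suc ∘ punchIn i)))
              ≈⟨ -‿cong (sg-cong i (det-cong
                   {M = (λ l → D (M (suc i) l)) ∷ M zero ∷ (M ∘ suc ∘ punchIn i)} {N = (λ l → D (M (suc i) l)) ∷ (M ∘ punchIn (suc i))}
                   (∷-cong _ {M zero ∷ (M ∘ suc ∘ punchIn i)} {M ∘ punchIn (suc i)} λ { zero j → refl ; (suc k) j → refl }))) ⟩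
            - sg i (det ((λ l → D (M (suc i) l)) ∷ (M ∘ punchIn (suc i)))) ∎
            where N = (λ l → D (M (suc i) l)) ∷ (M ∘ suc ∘ punchIn i)

        D-det′ M = begin
          D (det M)
            ≡⟨ ≡.cong D (det-suc M) ⟩
          D (alt λ j → M zero j * minor j)
            ≈⟨ D-alt _ ⟩
          alt (λ j → D (M zero j * minor j))
            ≈⟨ trans (alt-cong λ j → D-* _ _) (alt-+ _ _) ⟩
          alt (λ j → D (M zero j) * minor j) + alt (λ j → M zero j * D (minor j))
            ≈⟨ +-cong (reflexive (≡.sym (det-∷ (λ l → D (M zero l)) (M ∘ suc)))) (D-tail M) ⟩
          det ((λ l → D (M zero l)) ∷ (M ∘ suc)) + ∑ (λ i → - sg i (det ((λ l → D (M (suc i) l)) ∷ (M ∘ punchIn (suc i)))))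
            ≡⟨ ∑-suc (λ i → sg i (det ((λ l → D (M i l)) ∷ (M ∘ punchIn i)))) ⟨
          ∑ (λ i → sg i (det ((λ l → D (M i l)) ∷ (M ∘ punchIn i)))) ∎
          where minor = λ j → det λ a b → M (suc a) (punchIn j b)

      jacobi : ∀ {n} (M : Fin (suc n) → Fin (suc n) → Carrier) →
        D (det M) ≈ ∑ (λ i → ∑ λ l → D (M i l) * cof M i l)
      jacobi M = trans (D-det′ M) (∑-cong λ i → det-replace M i _)

    det-lower : ∀ {n} (M : Fin (suc n) → Fin (suc n) → Carrier) → (∀ j → M zero (suc j) ≈ 0#) →
      det M ≈ M zero zero * det (λ i j → M (suc i) (suc j))
    det-lower M h = begin
      det M                                                            ≡⟨ ≡.trans (det-suc M) (alt-suc _) ⟩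
      M zero zero * det (λ i j → M (suc i) (suc j)) + - alt _          ≈⟨ +-congˡ (trans (-‿cong (alt-0 λ j → trans (*-congʳ (h j)) (zeroˡ _))) -0#≈0#) ⟩
      M zero zero * det (λ i j → M (suc i) (suc j)) + 0#               ≈⟨ +-identityʳ _ ⟩
      M zero zero * det (λ i j → M (suc i) (suc j))                    ∎

    -- N = (I + T)M with T strictly upper triangular, handled without a product formula for
    -- determinants. Column 0 of T vanishes, so the rows below the first are combinations among
    -- themselves and the induction removes T from every minor of the first row. What T adds to the
    -- first row are lower rows, which vanish against its cofactors by `cramer-≢`.
    det-unitriangular : ∀ {n} (M N : Fin n → Fin n → Carrier) (T : Fin n → Fin n → Carrier) →
      (∀ i c → c Fin.≤ i → T i c ≈ 0#) → (∀ i l → N i l ≈ M i l + ∑ (λ c → T i c * M c l)) → det N ≈ det M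
    det-unitriangular {zero}  M N T up e = det-cong λ ()
    det-unitriangular {suc n} M N T up e = begin
      det N
        ≡⟨ det-suc N ⟩
      alt (λ j → N zero j * det (λ a b → N (suc a) (punchIn j b)))
        ≈⟨ alt-cong (λ j → *-congˡ (det-unitriangular (λ a b → M (suc a) (punchIn j b)) (λ a b → N (suc a) (punchIn j b))
             (λ i c → T (suc i) (suc c)) (λ i c c≤i → up (suc i) (suc c) (s≤s c≤i)) λ i l → trans (e (suc i) (punchIn j l))
               (+-congˡ (trans (reflexive (∑-suc _)) (trans (+-congʳ (trans (*-congʳ (up (suc i) zero z≤n)) (zeroˡ _))) (+-identityˡ _)))))) ⟩
      alt (λ j → N zero j * det (λ a b → M (suc a) (punchIn j b)))
        ≡⟨ det-∷ (N zero) (M ∘ suc) ⟨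
      det (N zero ∷ (M ∘ suc))
        ≈⟨ det-replace M zero (N zero) ⟩
      ∑ (λ l → N zero l * cof M zero l)
        ≈⟨ ∑-cong (λ l → trans (*-congʳ (e zero l)) (trans (distribʳ _ _ _) (+-congˡ (trans (*-comm _ _) (trans (sym (∑-* _ _))
             (∑-cong λ c → trans (x∙yz≈y∙xz _ _ _) (*-congˡ (*-comm _ _)))))))) ⟩
      ∑ (λ l → M zero l * cof M zero l + ∑ (λ c → T zero c * (M c l * cof M zero l)))
        ≈⟨ trans (∑-+ _ _) (+-cong (cramer-≡ M zero) (∑-swap _)) ⟩
      det M + ∑ (λ c → ∑ λ l → T zero c * (M c l * cof M zero l))
        ≈⟨ +-congˡ (∑-0 λ { zero → trans (∑-cong λ l → trans (*-congʳ (up zero zero z≤n)) (zeroˡ _)) (∑-0 λ _ → refl)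
                          ; (suc c) → trans (∑-* _ _) (trans (*-congˡ (cramer-≢ M {zero} {suc c} λ ())) (zeroʳ _)) }) ⟩
      det M + 0#
        ≈⟨ +-identityʳ _ ⟩
      det M ∎

-- Formal power series over ℤ and determinants of matrices of polynomials.

module Series where

  open import Algebra.Bundles using (CommutativeRing)
  open import Data.Bool using (true; false; if_then_else_)
  open import Data.Fin using (Fin; zero; suc; toℕ; punchIn)
  open import Data.Integer using (ℤ; +_; -_; _+_; _*_)
  open import Data.Integer.Properties
  open import Data.Integer.Tactic.RingSolver using (solve-∀)
  open import Data.List using ([]; _∷_; map)
  open import Data.Nat as ℕ using (ℕ; zero; suc)
  import Data.Nat.Properties as ℕₚ
  open import Data.Product using (_,_)
  open import Function using (_∘_)
  open import Level using (0ℓ)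
  open import Relation.Binary.PropositionalEquality

  open import Defs
  open Determinant

  -- Polynomials enter through their coefficient sequences inside the ring of formal power series,
  -- where neither degrees nor trailing zeros need care. Finiteness is recovered by `det-degree`.
  Series : Set
  Series = ℕ → ℤ

  infixl 7 _⊛_

  _⊛_ : Series → Series → Series
  (f ⊛ g) zero    = f 0 * g 0
  (f ⊛ g) (suc k) = f 0 * g (suc k) + ((f ∘ suc) ⊛ g) k

  ⊛-cong : ∀ {f f′ g g′} → f ≗ f′ → g ≗ g′ → f ⊛ g ≗ f′ ⊛ g′
  ⊛-cong e h zero    = cong₂ _*_ (e 0) (h 0)
  ⊛-cong e h (suc k) = cong₂ _+_ (cong₂ _*_ (e 0) (h (suc k))) (⊛-cong (e ∘ suc) h k)

  ⊛-zeroˡ : ∀ g → (λ _ → + 0) ⊛ g ≗ (λ _ → + 0)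
  ⊛-zeroˡ g zero    = refl
  ⊛-zeroˡ g (suc k) = trans (+-identityˡ _) (⊛-zeroˡ g k)

  ⊛-scale : ∀ a f g → (λ k → a * f k) ⊛ g ≗ (λ k → a * (f ⊛ g) k)
  ⊛-scale a f g zero    = *-assoc a (f 0) (g 0)
  ⊛-scale a f g (suc k) = trans (cong₂ _+_ (*-assoc a (f 0) (g (suc k))) (⊛-scale a (f ∘ suc) g k)) (sym (*-distribˡ-+ a _ _))

  ⊛-distribʳ : ∀ h f g → (λ k → f k + g k) ⊛ h ≗ (λ k → (f ⊛ h) k + (g ⊛ h) k)
  ⊛-distribʳ h f g zero    = *-distribʳ-+ (h 0) (f 0) (g 0)
  ⊛-distribʳ h f g (suc k) = trans (cong₂ _+_ (*-distribʳ-+ (h (suc k)) (f 0) (g 0)) (⊛-distribʳ h (f ∘ suc) (g ∘ suc) k))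
    (interchange (f 0 * h (suc k)) (g 0 * h (suc k)) _ _)
    where
    interchange : ∀ a b c d → (a + b) + (c + d) ≡ (a + c) + (b + d)
    interchange = solve-∀

  -- The defining recursion read from the other end; commutativity is the comparison of the two.
  ⊛-sucʳ : ∀ f g k → (f ⊛ g) (suc k) ≡ f (suc k) * g 0 + (f ⊛ (g ∘ suc)) k
  ⊛-sucʳ f g zero    = +-comm (f 0 * g 1) (f 1 * g 0)
  ⊛-sucʳ f g (suc k) = trans (cong (λ z → f 0 * g (suc (suc k)) + z) (⊛-sucʳ (f ∘ suc) g k)) (swap (f 0 * g (suc (suc k))) (f (suc (suc k)) * g 0) _)
    where
    swap : ∀ a b c → a + (b + c) ≡ b + (a + c)
    swap = solve-∀

  ⊛-comm : ∀ f g → f ⊛ g ≗ g ⊛ f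
  ⊛-comm f g zero    = *-comm (f 0) (g 0)
  ⊛-comm f g (suc k) = trans (cong₂ _+_ (*-comm (f 0) (g (suc k))) (⊛-comm (f ∘ suc) g k)) (sym (⊛-sucʳ g f k))

  ⊛-assoc : ∀ f g h → (f ⊛ g) ⊛ h ≗ f ⊛ (g ⊛ h)
  ⊛-assoc f g h zero    = *-assoc (f 0) (g 0) (h 0)
  ⊛-assoc f g h (suc k) = begin
    f 0 * g 0 * h (suc k) + ((λ j → f 0 * g (suc j) + ((f ∘ suc) ⊛ g) j) ⊛ h) k
      ≡⟨ cong (λ z → f 0 * g 0 * h (suc k) + z) (⊛-distribʳ h (λ j → f 0 * g (suc j)) ((f ∘ suc) ⊛ g) k) ⟩
    f 0 * g 0 * h (suc k) + (((λ j → f 0 * g (suc j)) ⊛ h) k + (((f ∘ suc) ⊛ g) ⊛ h) k)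
      ≡⟨ cong₂ (λ y z → f 0 * g 0 * h (suc k) + (y + z)) (⊛-scale (f 0) (g ∘ suc) h k) (⊛-assoc (f ∘ suc) g h k) ⟩
    f 0 * g 0 * h (suc k) + (f 0 * ((g ∘ suc) ⊛ h) k + ((f ∘ suc) ⊛ (g ⊛ h)) k)
      ≡⟨ regroup (f 0) (g 0) _ _ _ ⟩
    f 0 * (g 0 * h (suc k) + ((g ∘ suc) ⊛ h) k) + ((f ∘ suc) ⊛ (g ⊛ h)) k ∎
    where
    open ≡-Reasoning
    regroup : ∀ a b c d e → a * b * c + (a * d + e) ≡ a * (b * c + d) + e
    regroup = solve-∀

  constant : ℤ → Series
  constant a zero    = a
  constant a (suc k) = + 0

  ⊛-identityˡ : ∀ f → constant (+ 1) ⊛ f ≗ f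
  ⊛-identityˡ f zero    = *-identityˡ (f 0)
  ⊛-identityˡ f (suc k) = trans (cong₂ _+_ (*-identityˡ (f (suc k))) (⊛-zeroˡ f k)) (+-identityʳ _)

  Series-ring : CommutativeRing 0ℓ 0ℓ
  Series-ring = record
    { Carrier = Series ; _≈_ = _≗_ ; _+_ = λ f g k → f k + g k ; _*_ = _⊛_ ; -_ = λ f k → - f k
    ; 0# = λ _ → + 0 ; 1# = constant (+ 1)
    ; isCommutativeRing = record
      { isRing = record
        { +-isAbelianGroup = record
          { isGroup = record
            { isMonoid = record
              { isSemigroup = record
                { isMagma = record
                  { isEquivalence = record { refl = λ _ → refl ; sym = λ e k → sym (e k) ; trans = λ e h k → trans (e k) (h k) }
                  ; ∙-cong = λ e h k → cong₂ _+_ (e k) (h k) }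
                ; assoc = λ f g h k → +-assoc (f k) (g k) (h k) }
              ; identity = (λ f k → +-identityˡ (f k)) , (λ f k → +-identityʳ (f k)) }
            ; inverse = (λ f k → +-inverseˡ (f k)) , (λ f k → +-inverseʳ (f k))
            ; ⁻¹-cong = λ e k → cong -_ (e k) }
          ; comm = λ f g k → +-comm (f k) (g k) }
        ; *-cong = ⊛-cong
        ; *-assoc = ⊛-assoc
        ; *-identity = ⊛-identityˡ , (λ f k → trans (⊛-comm f _ k) (⊛-identityˡ f k))
        ; distrib = (λ h f g k → trans (⊛-comm h _ k) (trans (⊛-distribʳ h f g k) (cong₂ _+_ (⊛-comm f h k) (⊛-comm g h k))))
                  , ⊛-distribʳ }
      ; *-comm = ⊛-comm } }

  module 𝔻 = Det Series-ring
  module ℤ-Det = Det +-*-commutativeRing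
  open ℤ-Det using (∑) public

  -- Degree at most one, as for the entries of xI - L. Products with such series have two terms per
  -- coefficient, which turns identities between matrices of series into recurrences for their
  -- coefficients.
  Linear : Series → Set
  Linear f = ∀ k → f (suc (suc k)) ≡ + 0

  ⊛-linear : ∀ {f} → Linear f → ∀ g k → (f ⊛ g) (suc k) ≡ f 0 * g (suc k) + f 1 * g k
  ⊛-linear {f} lin g zero    = refl
  ⊛-linear {f} lin g (suc k) = cong (λ z → f 0 * g (suc (suc k)) + z)
    (trans (cong (λ z → f 1 * g (suc k) + z) (trans (⊛-cong {λ j → f (suc (suc j))} {g = g} lin (λ _ → refl) k) (⊛-zeroˡ g k))) (+-identityʳ _))

  derivative : Series → Series
  derivative f k = + suc k * f (suc k)

  derivative-⊛ : ∀ f g → derivative (f ⊛ g) ≗ (λ k → (derivative f ⊛ g) k + (f ⊛ derivative g) k)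
  derivative-⊛ f g zero    = regroup (f 0) (f 1) (g 0) (g 1)
    where
    regroup : ∀ a b c d → + 1 * (a * d + b * c) ≡ + 1 * b * c + a * (+ 1 * d)
    regroup = solve-∀
  -- With f = f₀ + x·h one has (x·h·g)′ = h·g + x·(h·g)′: the factor k + 2 is split as 1 + (k + 1),
  -- and the induction hypothesis is applied to h·g. The local `shift` is f′ = h + x·h′.
  derivative-⊛ f g (suc k) = begin
    + suc (suc k) * (f 0 * g (suc (suc k)) + ((f ∘ suc) ⊛ g) (suc k))
      ≡⟨ cong (_* (f 0 * g (suc (suc k)) + ((f ∘ suc) ⊛ g) (suc k))) (pos-+ 1 (suc k)) ⟩
    (+ 1 + + suc k) * (f 0 * g (suc (suc k)) + ((f ∘ suc) ⊛ g) (suc k))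
      ≡⟨ regroup₁ (+ suc k) (f 0) (g (suc (suc k))) _ ⟩
    (((f ∘ suc) ⊛ g) (suc k) + f 0 * ((+ 1 + + suc k) * g (suc (suc k)))) + + suc k * ((f ∘ suc) ⊛ g) (suc k)
      ≡⟨ cong (λ z → (((f ∘ suc) ⊛ g) (suc k) + f 0 * ((+ 1 + + suc k) * g (suc (suc k)))) + z) (derivative-⊛ (f ∘ suc) g k) ⟩
    ((f 1 * g (suc k) + ((λ j → f (suc (suc j))) ⊛ g) k) + f 0 * ((+ 1 + + suc k) * g (suc (suc k))))
      + ((derivative (f ∘ suc) ⊛ g) k + ((f ∘ suc) ⊛ derivative g) k)
      ≡⟨ cong (λ z → ((f 1 * g (suc k) + ((λ j → f (suc (suc j))) ⊛ g) k) + f 0 * (z * g (suc (suc k))))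
           + ((derivative (f ∘ suc) ⊛ g) k + ((f ∘ suc) ⊛ derivative g) k)) (sym (pos-+ 1 (suc k))) ⟩
    ((f 1 * g (suc k) + ((λ j → f (suc (suc j))) ⊛ g) k) + f 0 * (+ suc (suc k) * g (suc (suc k))))
      + ((derivative (f ∘ suc) ⊛ g) k + ((f ∘ suc) ⊛ derivative g) k)
      ≡⟨ regroup₂ (f 1) (g (suc k)) (((λ j → f (suc (suc j))) ⊛ g) k) (f 0 * (+ suc (suc k) * g (suc (suc k)))) _ _ ⟩
    (+ 1 * f 1 * g (suc k) + (((λ j → f (suc (suc j))) ⊛ g) k + (derivative (f ∘ suc) ⊛ g) k))
      + (f 0 * (+ suc (suc k) * g (suc (suc k))) + ((f ∘ suc) ⊛ derivative g) k)
      ≡⟨ cong (λ z → (+ 1 * f 1 * g (suc k) + z) + (f 0 * (+ suc (suc k) * g (suc (suc k))) + ((f ∘ suc) ⊛ derivative g) k))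
           (trans (sym (⊛-distribʳ g (λ j → f (suc (suc j))) (derivative (f ∘ suc)) k)) (⊛-cong {g = g} shift (λ _ → refl) k)) ⟩
    (+ 1 * f 1 * g (suc k) + ((derivative f ∘ suc) ⊛ g) k)
      + (f 0 * (+ suc (suc k) * g (suc (suc k))) + ((f ∘ suc) ⊛ derivative g) k) ∎
    where
    open ≡-Reasoning
    regroup₁ : ∀ k a b c → (+ 1 + k) * (a * b + c) ≡ (c + a * ((+ 1 + k) * b)) + k * c
    regroup₁ = solve-∀
    regroup₂ : ∀ a b c d e h → ((a * b + c) + d) + (e + h) ≡ (+ 1 * a * b + (c + e)) + (d + h)
    regroup₂ = solve-∀
    shift : ∀ j → f (suc (suc j)) + derivative (f ∘ suc) j ≡ derivative f (suc j)
    shift j = trans (collect (f (suc (suc j))) (+ suc j)) (cong (_* f (suc (suc j))) (sym (pos-+ 1 (suc j))))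
      where
      collect : ∀ a b → a + b * a ≡ (+ 1 + b) * a
      collect = solve-∀

  jacobi : ∀ {n} (M : Fin (suc n) → Fin (suc n) → Series) →
    derivative (𝔻.det M) ≗ 𝔻.∑ (λ i → 𝔻.∑ λ l → derivative (M i l) ⊛ 𝔻.cof M i l)
  jacobi = 𝔻.Derivation.jacobi derivative (λ e k → cong (+ suc k *_) (e (suc k)))
    (λ f g k → *-distribˡ-+ (+ suc k) (f (suc k)) (g (suc k))) derivative-⊛

  ∑-at : ∀ {n} (f : Fin n → Series) k → 𝔻.∑ f k ≡ ∑ (λ i → f i k)
  ∑-at {zero}  f k = trans (cong (λ s → s k) (𝔻.∑-zero f)) (sym (ℤ-Det.∑-zero _))
  ∑-at {suc n} f k = trans (cong (λ s → s k) (𝔻.∑-suc f)) (trans (cong (λ z → f zero k + z) (∑-at (f ∘ suc) k)) (sym (ℤ-Det.∑-suc _)))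

  alt-at : ∀ {n} (f : Fin n → Series) k → 𝔻.alt f k ≡ ℤ-Det.alt (λ i → f i k)
  alt-at {zero}  f k = trans (cong (λ s → s k) (𝔻.alt-zero f)) (sym (ℤ-Det.alt-zero _))
  alt-at {suc n} f k = trans (cong (λ s → s k) (𝔻.alt-suc f))
    (trans (cong (λ z → f zero k + - z) (alt-at (f ∘ suc) k)) (sym (ℤ-Det.alt-suc _)))

  sg-at : ∀ {n} (i : Fin n) f k → 𝔻.sg i f k ≡ ℤ-Det.sg i (f k)
  sg-at zero    f k = refl
  sg-at (suc i) f k = cong -_ (sg-at i f k)

  det-at-0 : ∀ {n} (M : Fin n → Fin n → Series) → 𝔻.det M 0 ≡ ℤ-Det.det (λ i j → M i j 0)
  det-at-0 {zero}  M = trans (cong (λ s → s 0) (𝔻.det-zero M)) (sym (ℤ-Det.det-zero _))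
  det-at-0 {suc n} M = trans (cong (λ s → s 0) (𝔻.det-suc M)) (trans (alt-at _ 0)
    (trans (ℤ-Det.alt-cong λ j → cong (M zero j 0 *_) (det-at-0 _)) (sym (ℤ-Det.det-suc _))))

  minor₀ : ∀ {A : Set} {n} → (Fin (suc n) → Fin (suc n) → A) → Fin (suc n) → Fin n → Fin n → A
  minor₀ M j a b = M (suc a) (punchIn j b)

  det-degree : ∀ {n} (M : Fin n → Fin n → Series) → (∀ i j → Linear (M i j)) → ∀ k → n ℕ.< k → 𝔻.det M k ≡ + 0
  det-degree {zero}  M lin (suc k) _ = cong (λ s → s (suc k)) (𝔻.det-zero M)
  det-degree {suc n} M lin (suc k) (ℕ.s≤s n<k) = trans (cong (λ s → s (suc k)) (𝔻.det-suc M)) (trans (alt-at _ (suc k))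
    (ℤ-Det.alt-0 λ j → trans (⊛-linear {M zero j} (lin zero j) (𝔻.det (minor₀ M j)) k) (cong₂ _+_
      (trans (cong (M zero j 0 *_) (det-degree (minor₀ M j) (λ a b → lin _ _) (suc k) (ℕₚ.m≤n⇒m≤1+n n<k))) (*-zeroʳ (M zero j 0)))
      (trans (cong (M zero j 1 *_) (det-degree (minor₀ M j) (λ a b → lin _ _) k n<k)) (*-zeroʳ (M zero j 1))))))

  -- Only the coefficient of x in an entry of the first row contributes: its constant term would
  -- meet a coefficient beyond the degree of the minor, which `det-degree` makes 0.
  det-leading : ∀ {n} (M : Fin n → Fin n → Series) → (∀ i j → Linear (M i j)) → 𝔻.det M n ≡ ℤ-Det.det (λ i j → M i j 1)
  det-leading {zero}  M lin = trans (cong (λ s → s 0) (𝔻.det-zero M)) (sym (ℤ-Det.det-zero _))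
  det-leading {suc n} M lin = trans (cong (λ s → s (suc n)) (𝔻.det-suc M)) (trans (alt-at _ (suc n))
    (trans (ℤ-Det.alt-cong λ j → trans (⊛-linear {M zero j} (lin zero j) (𝔻.det (minor₀ M j)) n) (trans (cong₂ _+_
      (trans (cong (M zero j 0 *_) (det-degree (minor₀ M j) (λ a b → lin _ _) (suc n) ℕₚ.≤-refl)) (*-zeroʳ (M zero j 0)))
      (cong (M zero j 1 *_) (det-leading (minor₀ M j) λ a b → lin _ _))) (+-identityˡ _))) (sym (ℤ-Det.det-suc _))))

  coeff-+ : ∀ p q k → coeff (p +ₚ q) k ≡ coeff p k + coeff q k
  coeff-+ []      q       k       = sym (+-identityˡ _)
  coeff-+ (a ∷ p) []      k       = sym (+-identityʳ _)
  coeff-+ (a ∷ p) (b ∷ q) zero    = refl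
  coeff-+ (a ∷ p) (b ∷ q) (suc k) = coeff-+ p q k

  coeff-map : ∀ (f : ℤ → ℤ) → f (+ 0) ≡ + 0 → ∀ p k → coeff (map f p) k ≡ f (coeff p k)
  coeff-map f e []      k       = sym e
  coeff-map f e (a ∷ p) zero    = refl
  coeff-map f e (a ∷ p) (suc k) = coeff-map f e p k

  coeff-* : ∀ p q → coeff (p *ₚ q) ≗ coeff p ⊛ coeff q
  coeff-* []      q k       = sym (⊛-zeroˡ (coeff q) k)
  coeff-* (a ∷ p) q zero    = trans (coeff-+ (map (a *_) q) _ 0)
    (trans (+-identityʳ _) (coeff-map (a *_) (*-zeroʳ a) q 0))
  coeff-* (a ∷ p) q (suc k) = trans (coeff-+ (map (a *_) q) _ (suc k))
    (cong₂ _+_ (coeff-map (a *_) (*-zeroʳ a) q (suc k)) (coeff-* p q k))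

  private
    -- The parity test of the given determinant is matched with the recursion of `alt`. Shifting the
    -- index flips the parity, so the statement and its negated form are proved together.
    coeff-alt : ∀ n (t : Fin n → Poly) k →
      coeff (sumFinₚ n λ j → if odd (toℕ j) then negₚ (t j) else t j) k ≡ ℤ-Det.alt (λ j → coeff (t j) k)
    coeff-alt′ : ∀ n (t : Fin n → Poly) k →
      coeff (sumFinₚ n λ j → if odd (suc (toℕ j)) then negₚ (t j) else t j) k ≡ - ℤ-Det.alt (λ j → coeff (t j) k)

    coeff-alt zero    t k = sym (ℤ-Det.alt-zero _)
    coeff-alt (suc n) t k = trans (coeff-+ (t zero) _ k)
      (trans (cong (λ z → coeff (t zero) k + z) (coeff-alt′ n (t ∘ suc) k)) (sym (ℤ-Det.alt-suc _)))

    not-not : ∀ b → (if (if b then false else true) then false else true) ≡ b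
    not-not true  = refl
    not-not false = refl

    sumFinₚ-cong : ∀ n {f g : Fin n → Poly} → (∀ j → f j ≡ g j) → sumFinₚ n f ≡ sumFinₚ n g
    sumFinₚ-cong zero    e = refl
    sumFinₚ-cong (suc n) e = cong₂ _+ₚ_ (e zero) (sumFinₚ-cong n (e ∘ suc))

    coeff-alt′ zero    t k = sym (cong -_ (ℤ-Det.alt-zero _))
    coeff-alt′ (suc n) t k = begin
      coeff (negₚ (t zero) +ₚ sumFinₚ n (λ j → if odd (suc (suc (toℕ j))) then negₚ (t (suc j)) else t (suc j))) k
        ≡⟨ coeff-+ (negₚ (t zero)) _ k ⟩
      coeff (negₚ (t zero)) k + coeff (sumFinₚ n (λ j → if odd (suc (suc (toℕ j))) then negₚ (t (suc j)) else t (suc j))) k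
        ≡⟨ cong₂ _+_ (coeff-map -_ refl (t zero) k) (trans (cong (λ z → coeff z k)
             (sumFinₚ-cong n λ j → cong (λ b → if b then negₚ (t (suc j)) else t (suc j)) (not-not (odd (toℕ j)))))
             (coeff-alt n (t ∘ suc) k)) ⟩
      - coeff (t zero) k + ℤ-Det.alt (λ j → coeff (t (suc j)) k)
        ≡⟨ flip (coeff (t zero) k) _ ⟩
      - (coeff (t zero) k + - ℤ-Det.alt (λ j → coeff (t (suc j)) k))
        ≡⟨ cong -_ (ℤ-Det.alt-suc _) ⟨
      - ℤ-Det.alt (λ j → coeff (t j) k) ∎
      where
      open ≡-Reasoning
      flip : ∀ a b → - a + b ≡ - (a + - b)
      flip = solve-∀

  coeff-det : ∀ n (M : Fin n → Fin n → Poly) → coeff (det n M) ≗ 𝔻.det (λ i j → coeff (M i j))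
  coeff-det zero    M zero    = sym (cong (λ s → s 0) (𝔻.det-zero _))
  coeff-det zero    M (suc k) = sym (cong (λ s → s (suc k)) (𝔻.det-zero _))
  coeff-det (suc n) M k = trans (coeff-alt (suc n) (λ j → M zero j *ₚ det n (λ i l → M (suc i) (punchIn j l))) k)
    (trans (ℤ-Det.alt-cong λ j → trans (coeff-* (M zero j) _ k)
      (⊛-cong {f = coeff (M zero j)} (λ _ → refl) (coeff-det n _) k))
    (sym (trans (cong (λ s → s k) (𝔻.det-suc _)) (alt-at _ k))))

-- The characteristic polynomial, the coefficients of the adjugate, and Newton's identities.

module CharPoly where

  open import Data.Bool using (true; false; if_then_else_)
  open import Data.Fin using (Fin; zero; suc; punchIn; _≟_)
  open import Data.Integer using (ℤ; +_; -_; _+_; _*_; _-_)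
  open import Data.Integer.Properties hiding (_≟_; <-cmp)
  open import Data.Integer.Tactic.RingSolver using (solve-∀)
  open import Data.List using (_∷_; [_])
  open import Data.Nat as ℕ using (ℕ; zero; suc)
  open import Data.Nat.Induction using (<-rec)
  import Data.Nat.Properties as ℕₚ
  open import Function using (_∘_)
  open import Relation.Binary.Definitions using (tri<; tri≈; tri>)
  open import Relation.Binary.PropositionalEquality hiding ([_])
  open import Relation.Nullary using (does; yes; no; contradiction)

  open import Defs using (Adj; lapCharPoly; laplacian; coeff)
  open Determinant
  open Series
  open ℤ-Det using (∑-cong; ∑-+; ∑-*; ∑-0; ∑-swap; ∑-neg; ∑-suc)

  Matrix : ℕ → Set
  Matrix n = Fin n → Fin n → ℤ

  δ : ∀ {n} → Matrix n
  δ i j = if does (i ≟ j) then + 1 else + 0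

  δ-refl : ∀ {n} (i : Fin n) → δ i i ≡ + 1
  δ-refl i with i ≟ i
  ... | yes _   = refl
  ... | no  i≢i = contradiction refl i≢i

  δ-≢ : ∀ {n} {i j : Fin n} → i ≢ j → δ i j ≡ + 0
  δ-≢ {i = i} {j} i≢j with i ≟ j
  ... | yes i≡j = contradiction i≡j i≢j
  ... | no  _   = refl

  δ-sym : ∀ {n} (i j : Fin n) → δ i j ≡ δ j i
  δ-sym i j with i ≟ j
  ... | yes refl = sym (δ-refl i)
  ... | no  i≢j  = sym (δ-≢ (i≢j ∘ sym))

  ∑-δ : ∀ {n} (i : Fin n) (f : Fin n → ℤ) → ∑ (λ j → δ i j * f j) ≡ f i
  ∑-δ {suc n} zero    f = trans (∑-suc _) (trans (cong₂ _+_ (*-identityˡ (f zero)) (∑-0 λ _ → refl)) (+-identityʳ _))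
  ∑-δ {suc n} (suc i) f = trans (∑-suc _) (trans (+-identityˡ _) (∑-δ i (f ∘ suc)))

  det-δ : ∀ n → ℤ-Det.det (δ {n}) ≡ + 1
  det-δ zero    = ℤ-Det.det-zero _
  det-δ (suc n) = trans (ℤ-Det.det-lower δ λ _ → refl) (trans (*-identityˡ _) (det-δ n))

  xI- : ∀ {n} → Matrix n → Fin n → Fin n → Series
  xI- L i j zero          = - L i j
  xI- L i j (suc zero)    = δ i j
  xI- L i j (suc (suc k)) = + 0

  χ : ∀ {n} → Matrix n → Series
  χ L = 𝔻.det (xI- L)

  lapCharPoly-χ : ∀ {m} (A : Adj m) → coeff (lapCharPoly A) ≗ χ (laplacian A)
  lapCharPoly-χ {m} A k = trans (coeff-det m _ k) (𝔻.det-cong (λ i j → entry i j) k)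
    where
    entry : ∀ i j → coeff (if does (i ≟ j) then (- laplacian A i j) ∷ [ + 1 ] else [ - laplacian A i j ]) ≗ xI- (laplacian A) i j
    entry i j zero = at-0 (does (i ≟ j)) (- laplacian A i j)
      where
      at-0 : ∀ b a → coeff (if b then a ∷ [ + 1 ] else [ a ]) 0 ≡ a
      at-0 true  a = refl
      at-0 false a = refl
    entry i j (suc zero) = at-1 (does (i ≟ j)) (- laplacian A i j)
      where
      at-1 : ∀ b a → coeff (if b then a ∷ [ + 1 ] else [ a ]) 1 ≡ (if b then + 1 else + 0)
      at-1 true  a = refl
      at-1 false a = refl
    entry i j (suc (suc k)) = at-2 (does (i ≟ j)) (- laplacian A i j)
      where
      at-2 : ∀ b a → coeff (if b then a ∷ [ + 1 ] else [ a ]) (suc (suc k)) ≡ + 0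
      at-2 true  a = refl
      at-2 false a = refl

  χ-monic : ∀ {n} (L : Matrix n) → χ L n ≡ + 1
  χ-monic {n} L = trans (det-leading (xI- L) (λ _ _ _ → refl)) (det-δ n)

  χ-degree : ∀ {n} (L : Matrix n) {k} → n ℕ.< k → χ L k ≡ + 0
  χ-degree L n<k = det-degree (xI- L) (λ _ _ _ → refl) _ n<k

  -- The order is the position of the last nonzero coefficient, as χ is monic.
  χ-size : ∀ {m n} (L : Matrix m) (L′ : Matrix n) → χ L ≗ χ L′ → m ≡ n
  χ-size {m} {n} L L′ e with ℕₚ.<-cmp m n
  ... | tri< m<n _ _ = contradiction (trans (sym (χ-monic L′)) (trans (sym (e n)) (χ-degree L m<n))) λ ()

  ... | tri≈ _ m≡n _ = m≡n
  ... | tri> _ _ n<m = contradiction (trans (sym (χ-monic L)) (trans (e m) (χ-degree L′ n<m))) λ ()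

  ∑-const : ∀ n a → ∑ {n} (λ _ → a) ≡ + n * a
  ∑-const zero    a = ℤ-Det.∑-zero _
  ∑-const (suc n) a = trans (∑-suc _) (trans (cong (λ z → a + z) (∑-const n a)) (sym (suc-* (+ n) a)))

  ∑-linear : ∀ {n} c (f g : Fin n → ℤ) → ∑ (λ i → f i + c * g i) ≡ ∑ f + c * ∑ g
  ∑-linear c f g = trans (∑-+ f (λ i → c * g i)) (cong (λ z → ∑ f + z) (∑-* c g))

  tr : ∀ {n} → Matrix n → ℤ
  tr B = ∑ λ i → B i i

  infixr 7 _·_

  _·_ : ∀ {n} → Matrix n → Matrix n → Matrix n
  (L · B) k i = ∑ λ l → L k l * B l i

  -- This is L^j B. Multiplying onto `B` first keeps the power outermost, so that a recurrence for
  -- `B` can be substituted by `^·-cong`.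
  _^·_ : ∀ {n} → Matrix n → ℕ → Matrix n → Matrix n
  (L ^· zero)  B = B
  (L ^· suc j) B = (L ^· j) (L · B)

  ^·-cong : ∀ {n} (L : Matrix n) j {B C : Matrix n} → (∀ k i → B k i ≡ C k i) → ∀ k i → (L ^· j) B k i ≡ (L ^· j) C k i
  ^·-cong L zero    e k i = e k i
  ^·-cong L (suc j) e k i = ^·-cong L j (λ k i → ∑-cong λ l → cong (L k l *_) (e l i)) k i

  ^·-linear : ∀ {n} (L : Matrix n) j (B C : Matrix n) c k i →
    (L ^· j) (λ k i → B k i + c * C k i) k i ≡ (L ^· j) B k i + c * (L ^· j) C k i
  ^·-linear L zero    B C c k i = refl
  ^·-linear L (suc j) B C c k i = trans (^·-cong L j step k i) (^·-linear L j (L · B) (L · C) c k i)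
    where
    expand : ∀ l b c d → l * (b + c * d) ≡ l * b + c * (l * d)
    expand = solve-∀
    step : ∀ k i → (L · (λ k i → B k i + c * C k i)) k i ≡ (L · B) k i + c * (L · C) k i
    step k i = trans (∑-cong λ l → expand (L k l) (B l i) c (C l i)) (∑-linear c (λ l → L k l * B l i) (λ l → L k l * C l i))

  power-trace : ∀ {n} → Matrix n → ℕ → ℤ
  power-trace L j = tr ((L ^· j) δ)

  module _ {n} (L : Matrix (suc n)) where

    private
      M = xI- L

      K : Fin (suc n) → Fin (suc n) → Series
      K = 𝔻.cof M

    -- The coefficient of x^t in the adjugate of xI - L, whence the transposed indices.
    adj : ℕ → Matrix (suc n)
    adj t k i = K i k t

    adj-degree : ∀ {t} → n ℕ.< t → ∀ k i → adj t k i ≡ + 0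
    adj-degree {t} n<t k i = begin
      𝔻.sg i (𝔻.sg k D) t            ≡⟨ trans (sg-at i _ t) (cong (ℤ-Det.sg i) (sg-at k D t)) ⟩
      ℤ-Det.sg i (ℤ-Det.sg k (D t))  ≡⟨ cong (λ z → ℤ-Det.sg i (ℤ-Det.sg k z)) (det-degree _ (λ _ _ _ → refl) t n<t) ⟩
      ℤ-Det.sg i (ℤ-Det.sg k (+ 0))  ≡⟨ trans (cong (ℤ-Det.sg i) (ℤ-Det.sg-0 k)) (ℤ-Det.sg-0 i) ⟩
      + 0                            ∎
      where
      open ≡-Reasoning
      D = 𝔻.det λ a b → M (punchIn i a) (punchIn k b)

    -- Compare the coefficients of x^(t+1) in (xI - L)·adj(xI - L) = χ·I, which is the pair of
    -- Cramer identities.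
    adj-step : ∀ t k i → adj t k i ≡ (L · adj (suc t)) k i + χ L (suc t) * δ k i
    adj-step t k i = begin
      adj t k i
        ≡⟨ collect (adj t k i) ((L · adj (suc t)) k i) ⟩
      (L · adj (suc t)) k i + (- (L · adj (suc t)) k i + adj t k i)
        ≡⟨ cong (λ z → (L · adj (suc t)) k i + z) (begin
          - (L · adj (suc t)) k i + adj t k i
            ≡⟨ cong₂ _+_ (sym (∑-neg _)) (sym (∑-δ k (λ l → adj t l i))) ⟩
          ∑ (λ l → - (L k l * adj (suc t) l i)) + ∑ (λ l → δ k l * adj t l i)
            ≡⟨ ∑-+ _ _ ⟨
          ∑ (λ l → - (L k l * adj (suc t) l i) + δ k l * adj t l i)
            ≡⟨ ∑-cong (λ l → trans (cong (λ z → z + δ k l * adj t l i) (neg-distribˡ-* (L k l) (adj (suc t) l i)))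
                 (sym (⊛-linear {M k l} (λ _ → refl) (K i l) t))) ⟩
          ∑ (λ l → (M k l ⊛ K i l) (suc t))
            ≡⟨ ∑-at (λ l → M k l ⊛ K i l) (suc t) ⟨
          𝔻.∑ (λ l → M k l ⊛ K i l) (suc t)
            ≡⟨ cramer ⟩
          χ L (suc t) * δ k i ∎) ⟩
      (L · adj (suc t)) k i + χ L (suc t) * δ k i ∎
      where
      open ≡-Reasoning
      collect : ∀ a b → a ≡ b + (- b + a)
      collect = solve-∀
      cramer : 𝔻.∑ (λ l → M k l ⊛ K i l) (suc t) ≡ χ L (suc t) * δ k i
      cramer with k ≟ i
      ... | yes refl = trans (𝔻.cramer-≡ M i (suc t)) (sym (*-identityʳ _))
      ... | no  k≢i  = trans (𝔻.cramer-≢ M (k≢i ∘ sym) (suc t)) (sym (*-zeroʳ (χ L (suc t))))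

    -- Jacobi's formula gives χ′ = tr adj(xI - L), because the entrywise derivative of xI - L is I.
    tr-adj : ∀ t → tr (adj t) ≡ + suc t * χ L (suc t)
    tr-adj t = sym (begin
      derivative (χ L) t
        ≡⟨ jacobi M t ⟩
      𝔻.∑ (λ i → 𝔻.∑ λ l → derivative (M i l) ⊛ K i l) t
        ≡⟨ trans (∑-at _ t) (∑-cong λ i → ∑-at _ t) ⟩
      ∑ (λ i → ∑ λ l → (derivative (M i l) ⊛ K i l) t)
        ≡⟨ ∑-cong (λ i → ∑-cong λ l → term i l t) ⟩
      ∑ (λ i → ∑ λ l → δ i l * K i l t)
        ≡⟨ ∑-cong (λ i → ∑-δ i (λ l → K i l t)) ⟩
      ∑ (λ i → K i i t) ∎)
      where
      open ≡-Reasoning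
      term : ∀ i l t → (derivative (M i l) ⊛ K i l) t ≡ δ i l * K i l t
      term i l zero    = cong (_* K i l 0) (*-identityˡ (δ i l))
      term i l (suc t) = trans (⊛-linear {derivative (M i l)} (λ k → *-zeroʳ (+ suc (suc (suc k)))) (K i l) t)
        (trans (cong₂ _+_ (cong (_* K i l (suc t)) (*-identityˡ (δ i l))) refl) (+-identityʳ _))

    power-adj : ∀ j t → tr ((L ^· j) (adj t)) ≡ tr ((L ^· suc j) (adj (suc t))) + χ L (suc t) * power-trace L j
    power-adj j t = trans (∑-cong λ i → trans (^·-cong L j (adj-step t) i i) (^·-linear L j (L · adj (suc t)) δ (χ L (suc t)) i i))
      (∑-linear (χ L (suc t)) (λ i → (L ^· suc j) (adj (suc t)) i i) (λ i → (L ^· j) δ i i))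

    -- The top coefficient of the adjugate is the identity matrix, χ being monic; this ends the
    -- recursion of `power-adj`.
    power-adj-top : ∀ j → tr ((L ^· j) (adj n)) ≡ power-trace L j
    power-adj-top j = ∑-cong λ i → ^·-cong L j top i i
      where
      top : ∀ k i → adj n k i ≡ δ k i
      top k i = trans (adj-step n k i) (trans (cong₂ _+_
        (∑-0 λ l → trans (cong (L k l *_) (adj-degree ℕₚ.≤-refl l i)) (*-zeroʳ (L k l)))
        (trans (cong (_* δ k i) (χ-monic L)) (*-identityˡ (δ k i)))) (+-identityˡ _))

  -- Newton's identities: tr (adj t) is a monic polynomial in L with coefficients from χ.
  cospectral-traces : ∀ {n} (L L′ : Matrix (suc n)) → χ L ≗ χ L′ → ∀ s → s ℕ.≤ n → power-trace L s ≡ power-trace L′ s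
  cospectral-traces {n} L L′ e = <-rec _ step
    where
    rearrange : ∀ a b c d x y → a - b ≡ c - d → x ≡ y → (a + x) - (b + y) ≡ c - d
    rearrange a b c d x _ h refl = trans (cancel a b x) h
      where
      cancel : ∀ a b x → (a + x) - (b + x) ≡ a - b
      cancel = solve-∀
    P  = power-trace L
    P′ = power-trace L′
    T  = λ j t → tr ((L ^· j) (adj L t))
    T′ = λ j t → tr ((L′ ^· j) (adj L′ t))
    -- After `s` applications of `power-adj` the trace of L^j adj_t is the trace of L^(s+j) plus
    -- lower power traces with coefficients from χ. The lower terms agree for the two matrices, so
    -- only the difference of the highest traces survives.
    difference : ∀ s j t → t ℕ.+ s ≡ n → (∀ i → i ℕ.< s ℕ.+ j → P i ≡ P′ i) →
      T j t - T′ j t ≡ P (s ℕ.+ j) - P′ (s ℕ.+ j)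
    difference zero    j t t+0≡n h rewrite trans (sym (ℕₚ.+-identityʳ t)) t+0≡n =
      cong₂ _-_ (power-adj-top L j) (power-adj-top L′ j)
    difference (suc s) j t t+s≡n h = trans (cong₂ _-_ (power-adj L j t) (power-adj L′ j t))
      (rearrange (T (suc j) (suc t)) (T′ (suc j) (suc t)) (P (suc s ℕ.+ j)) (P′ (suc s ℕ.+ j)) _ _
        (trans (difference s (suc j) (suc t) (trans (sym (ℕₚ.+-suc t s)) t+s≡n) (λ i i< → h i (subst (i ℕ.<_) (ℕₚ.+-suc s j) i<)))
          (cong (λ z → P z - P′ z) (ℕₚ.+-suc s j)))
        (cong₂ _*_ (e (suc t)) (h j (ℕ.s≤s (ℕₚ.m≤n+m j s)))))
    step : ∀ s → (∀ {i} → i ℕ.< s → i ℕ.≤ n → P i ≡ P′ i) → s ℕ.≤ n → P s ≡ P′ s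
    -- For j = 0 and t = n - s the left side of `difference` is a difference of traces of adjugate
    -- coefficients, and these are determined by χ through `tr-adj`.
    step s ih s≤n = i-j≡0⇒i≡j (P s) (P′ s) (begin
      P s - P′ s                      ≡⟨ cong (λ z → P z - P′ z) (ℕₚ.+-identityʳ s) ⟨
      P (s ℕ.+ 0) - P′ (s ℕ.+ 0)      ≡⟨ difference s 0 t (ℕₚ.m∸n+n≡m s≤n) below ⟨
      T 0 t - T′ 0 t                  ≡⟨ cong₂ _-_ (tr-adj L t) (tr-adj L′ t) ⟩
      + suc t * χ L (suc t) - + suc t * χ L′ (suc t) ≡⟨ cong (λ z → + suc t * z - + suc t * χ L′ (suc t)) (e (suc t)) ⟩
      + suc t * χ L′ (suc t) - + suc t * χ L′ (suc t) ≡⟨ +-inverseʳ (+ suc t * χ L′ (suc t)) ⟩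
      + 0                             ∎)
      where
      open ≡-Reasoning
      t = n ℕ.∸ s
      below : ∀ i → i ℕ.< s ℕ.+ 0 → P i ≡ P′ i
      below i i< = let i<s = subst (i ℕ.<_) (ℕₚ.+-identityʳ s) i< in ih i<s (ℕₚ.≤-trans (ℕₚ.<⇒≤ i<s) s≤n)

-- The coefficient of x in the characteristic polynomial as a bordered determinant.

module Connectivity where

  open import Data.Fin as Fin using (Fin; zero; suc; _≟_; toℕ)
  open import Data.Integer using (ℤ; +_; -_; _+_; _*_; _-_)
  open import Data.Integer.Properties hiding (_≟_)
  open import Data.Integer.Tactic.RingSolver using (solve-∀)
  open import Data.Nat as ℕ using (ℕ; zero; suc)
  open import Data.Nat.Induction using (<-rec)
  import Data.Nat.Properties as ℕₚ
  open import Data.Sum using (inj₁; inj₂)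
  open import Data.Vec.Functional using (_∷_)
  open import Function using (_∘_)
  open import Relation.Binary.PropositionalEquality
  open import Relation.Nullary using (yes; no; contradiction)

  open Series
  open CharPoly
  open ℤ-Det using (∑-cong; ∑-+; ∑-*; ∑-0; ∑-swap; ∑-neg; ∑-suc; det; cof; sg)

  neg : ∀ {n} → Matrix n → Matrix n
  neg L i j = - L i j

  bordered : ∀ {n} → Matrix (suc n) → Matrix (suc n)
  bordered L = (λ _ → + 1) ∷ (neg L ∘ suc)

  det-row-of-ones : ∀ {n} (L : Matrix (suc n)) → det ((λ _ → + 1) ∷ (L ∘ suc)) ≡ ∑ (cof L zero)
  det-row-of-ones L = trans (ℤ-Det.det-replace L zero (λ _ → + 1)) (∑-cong λ l → *-identityˡ _)

  -- Adding all rows of xI - L to the first makes that row x·(1, ..., 1), as the columns of L sum to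
  -- 0. After taking out x, the constant coefficient is the determinant of -L with a first row of
  -- ones.
  χ-at-1 : ∀ {n} (L : Matrix (suc n)) → (∀ l → ∑ (λ k → L k l) ≡ + 0) → χ L 1 ≡ det (bordered L)
  χ-at-1 {n} L columns = begin
    χ L 1
      ≡⟨ 𝔻.cramer-≡ M zero 1 ⟨
    row zero
      ≡⟨ +-identityʳ (row zero) ⟨
    row zero + + 0
      -- The zeros put in are the products of the other rows with the cofactors of row 0. With them
      -- the sum runs over all rows and can be evaluated by columns, where L cancels.
      ≡⟨ cong (λ z → row zero + z) (∑-0 λ k → 𝔻.cramer-≢ M {zero} {suc k} (λ ()) 1) ⟨
    row zero + ∑ (row ∘ suc)
      ≡⟨ ∑-suc row ⟨
    ∑ row
      ≡⟨ ∑-cong (λ k → ∑-at (λ l → M k l ⊛ c l) 1) ⟩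
    ∑ (λ k → ∑ λ l → - L k l * c l 1 + δ k l * c l 0)
      ≡⟨ ∑-swap _ ⟩
    ∑ (λ l → ∑ λ k → - L k l * c l 1 + δ k l * c l 0)
      ≡⟨ ∑-cong column ⟩
    ∑ (λ l → c l 0)
      ≡⟨ ∑-cong (λ l → trans (sg-at l _ 0) (cong (sg l) (det-at-0 _))) ⟩
    ∑ (cof (neg L) zero)
      ≡⟨ det-row-of-ones (neg L) ⟨
    det (bordered L) ∎
    where
    open ≡-Reasoning
    M = xI- L
    c = 𝔻.cof M zero
    row = λ k → 𝔻.∑ (λ l → M k l ⊛ c l) 1
    regroup : ∀ a b c d → - a * b + c * d ≡ c * d + - b * a
    regroup = solve-∀
    column : ∀ l → ∑ (λ k → - L k l * c l 1 + δ k l * c l 0) ≡ c l 0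
    column l = begin
      ∑ (λ k → - L k l * c l 1 + δ k l * c l 0)
        ≡⟨ ∑-cong (λ k → trans (regroup (L k l) (c l 1) (δ k l) (c l 0)) (cong (λ z → z * c l 0 + - c l 1 * L k l) (δ-sym k l))) ⟩
      ∑ (λ k → δ l k * c l 0 + - c l 1 * L k l)
        ≡⟨ ∑-linear (- c l 1) (λ k → δ l k * c l 0) (λ k → L k l) ⟩
      ∑ (λ k → δ l k * c l 0) + - c l 1 * ∑ (λ k → L k l)
        ≡⟨ cong₂ (λ y z → y + - c l 1 * z) (∑-δ l (λ _ → c l 0)) (columns l) ⟩
      c l 0 + - c l 1 * + 0
        ≡⟨ trans (cong (λ z → c l 0 + z) (*-zeroʳ (- c l 1))) (+-identityʳ _) ⟩
      c l 0 ∎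

  -- Multiply vN = 0 on the right by the adjugate of N. The conclusion keeps the factor `v i`, so
  -- nothing has to be inverted over ℤ.
  left-kernel : ∀ {n} (N : Matrix (suc n)) (v : Fin (suc n) → ℤ) → (∀ l → ∑ (λ k → v k * N k l) ≡ + 0) → ∀ i → v i * det N ≡ + 0
  left-kernel N v h i = begin
    v i * det N
      ≡⟨ ∑-δ i (λ k → v k * det N) ⟨
    ∑ (λ k → δ i k * (v k * det N))
      ≡⟨ ∑-cong term ⟩
    ∑ (λ k → ∑ λ l → v k * N k l * cof N i l)
      ≡⟨ ∑-swap _ ⟩
    ∑ (λ l → ∑ λ k → v k * N k l * cof N i l)
      ≡⟨ ∑-0 (λ l → trans (∑-cong λ k → *-comm (v k * N k l) (cof N i l))
           (trans (∑-* (cof N i l) (λ k → v k * N k l)) (trans (cong (cof N i l *_) (h l)) (*-zeroʳ (cof N i l))))) ⟩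
    + 0 ∎
    where
    open ≡-Reasoning
    inner : ∀ k → ∑ (λ l → v k * N k l * cof N i l) ≡ v k * ∑ (λ l → N k l * cof N i l)
    inner k = trans (∑-cong λ l → *-assoc (v k) (N k l) (cof N i l)) (∑-* (v k) (λ l → N k l * cof N i l))
    term : ∀ k → δ i k * (v k * det N) ≡ ∑ (λ l → v k * N k l * cof N i l)
    term k with i ≟ k
    ... | yes refl = trans (*-identityˡ (v i * det N)) (sym (trans (inner i) (cong (v i *_) (ℤ-Det.cramer-≡ N i))))
    ... | no  i≢k  = sym (trans (inner k) (trans (cong (v k *_) (ℤ-Det.cramer-≢ N i≢k)) (*-zeroʳ (v k))))

  det-lower-triangular : ∀ {n} (M : Matrix n) → (∀ i j → i Fin.< j → M i j ≡ + 0) → (∀ i → M i i ≢ + 0) → det M ≢ + 0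
  det-lower-triangular {zero}  M lower diag e = contradiction (trans (sym (ℤ-Det.det-zero M)) e) λ ()
  det-lower-triangular {suc n} M lower diag e
    with i*j≡0⇒i≡0∨j≡0 (M zero zero) (trans (sym (ℤ-Det.det-lower M λ j → lower zero (suc j) (ℕ.s≤s ℕ.z≤n))) e)
  ... | inj₁ h = diag zero h
  ... | inj₂ h = det-lower-triangular (λ i j → M (suc i) (suc j)) (λ i j i<j → lower (suc i) (suc j) (ℕ.s≤s i<j)) (diag ∘ suc) h

  -- The rows b of the edge-vertex incidence matrix of a tree whose labels
  -- increase away from the root; the Laplacian rows are unitriangular
  -- combinations of them.
  module _ {n} (par : Fin (suc n) → Fin (suc n)) (par< : ∀ w → toℕ (par (suc w)) ℕ.< toℕ (suc w)) where

    b : Matrix (suc n)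
    b c l = δ c l - δ (par c) l

    -- Indicator that `c` is a child of `w`. The root gets a zero row because its `par` is
    -- arbitrary.
    child : Matrix (suc n)
    child zero    w = + 0
    child (suc c) w = δ (par (suc c)) w

    -- The cofactors of the row of ones are orthogonal to every row e_w - e_par(w), hence all equal,
    -- so the determinant is n + 1 times the first of them. That one is a triangular minor with
    -- diagonal -1, since parents have smaller labels.
    det-incidence : det (bordered b) ≢ + 0
    det-incidence e with i*j≡0⇒i≡0∨j≡0 (+ suc n) (trans (sym all-equal) e)
      where
      open ≡-Reasoning
      k : Fin (suc n) → ℤ
      k = cof (bordered b) zero
      k-par : ∀ w → k (suc w) ≡ k (par (suc w))
      k-par w = begin
        k (suc w)
          ≡⟨ cancel (k (suc w)) (k (par (suc w))) ⟩
        k (par (suc w)) - (- + 1 * k (suc w) + k (par (suc w)))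
          ≡⟨ cong (λ z → k (par (suc w)) - z) (begin
            - + 1 * k (suc w) + k (par (suc w))
              ≡⟨ cong₂ (λ y z → - + 1 * y + z) (sym (∑-δ (suc w) k)) (sym (∑-δ (par (suc w)) k)) ⟩
            - + 1 * ∑ (λ l → δ (suc w) l * k l) + ∑ (λ l → δ (par (suc w)) l * k l)
              ≡⟨ +-comm (- + 1 * ∑ (λ l → δ (suc w) l * k l)) _ ⟩
            ∑ (λ l → δ (par (suc w)) l * k l) + - + 1 * ∑ (λ l → δ (suc w) l * k l)
              ≡⟨ ∑-linear (- + 1) (λ l → δ (par (suc w)) l * k l) (λ l → δ (suc w) l * k l) ⟨
            ∑ (λ l → δ (par (suc w)) l * k l + - + 1 * (δ (suc w) l * k l))
              ≡⟨ ∑-cong (λ l → regroup (δ (par (suc w)) l) (δ (suc w) l) (k l)) ⟩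
            ∑ (λ l → - b (suc w) l * k l)
              ≡⟨ ℤ-Det.cramer-≢ (bordered b) {zero} {suc w} (λ ()) ⟩
            + 0 ∎) ⟩
        k (par (suc w)) - + 0
          ≡⟨ +-identityʳ _ ⟩
        k (par (suc w)) ∎
        where
        cancel : ∀ x y → x ≡ y - (- + 1 * x + y)
        cancel = solve-∀
        regroup : ∀ x y z → x * z + - + 1 * (y * z) ≡ - (y - x) * z
        regroup = solve-∀
      k-root : ∀ t w → toℕ w ≡ t → k w ≡ k zero
      k-root = <-rec _ λ { t ih zero e → refl
                         ; t ih (suc w) refl → trans (k-par w) (ih (par< w) (par (suc w)) refl) }
      all-equal : det (bordered b) ≡ + suc n * k zero
      all-equal = trans (ℤ-Det.det-replace (bordered b) zero (λ _ → + 1))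
        (trans (∑-cong λ l → trans (*-identityˡ (k l)) (k-root _ l refl)) (∑-const (suc n) (k zero)))
    ... | inj₂ h = det-lower-triangular (λ i j → - b (suc i) (suc j))
        (λ i j i<j → cong -_ (cong₂ _-_ (δ-≢ {i = suc i} {suc j} λ p → ℕₚ.<⇒≢ (ℕ.s≤s i<j) (cong toℕ p))
          (δ-≢ {i = par (suc i)} {suc j} λ p → ℕₚ.<⇒≢ (ℕₚ.<-trans (par< i) (ℕ.s≤s i<j)) (cong toℕ p))))
        (λ i → subst (_≢ + 0) (sym (cong -_ (cong₂ _-_ (δ-refl (suc i))
          (δ-≢ {i = par (suc i)} {suc i} λ p → ℕₚ.<⇒≢ (par< i) (cong toℕ p))))) λ ()) h

    tree-χ-at-1 : (L : Matrix (suc n)) → (∀ l → ∑ (λ k → L k l) ≡ + 0) →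
      (∀ w l → L (suc w) l ≡ b (suc w) l - ∑ (λ c → child c (suc w) * b c l)) → χ L 1 ≢ + 0
    tree-χ-at-1 L columns rows e = det-incidence (trans (sym (ℤ-Det.det-unitriangular (bordered b) (bordered L) T upper combination))
      (trans (sym (χ-at-1 L columns)) e))
      where
      open ≡-Reasoning
      -- Children carry larger labels than their parent, so `T` is strictly upper triangular; its
      -- zero first row leaves the row of ones untouched.
      T : Matrix (suc n)
      T zero    c = + 0
      T (suc w) c = - child c (suc w)
      upper : ∀ i c → c Fin.≤ i → T i c ≡ + 0
      upper zero    c       _   = refl
      upper (suc w) zero    _   = refl
      upper (suc w) (suc c) c≤w = cong -_ (δ-≢ {i = par (suc c)} {suc w} λ p → ℕₚ.<⇒≱ (par< c) (subst (suc (toℕ c) ℕ.≤_) (sym (cong toℕ p)) c≤w))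
      combination : ∀ i l → bordered L i l ≡ bordered b i l + ∑ (λ c → T i c * bordered b c l)
      combination zero    l = sym (trans (cong (λ z → + 1 + z) (∑-0 λ _ → refl)) refl)
      combination (suc w) l = begin
        - L (suc w) l
          ≡⟨ cong -_ (rows w l) ⟩
        - (b (suc w) l - ∑ (λ c → child c (suc w) * b c l))
          ≡⟨ flip (b (suc w) l) _ ⟩
        - b (suc w) l + ∑ (λ c → child c (suc w) * b c l)
          ≡⟨ cong (λ z → - b (suc w) l + z) (∑-cong λ { zero → refl ; (suc c) → double (child (suc c) (suc w)) (b (suc c) l) }) ⟩
        - b (suc w) l + ∑ (λ c → T (suc w) c * bordered b c l) ∎
        where
        flip : ∀ x y → - (x - y) ≡ - x + y
        flip = solve-∀
        double : ∀ x y → x * y ≡ - x * - y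
        double = solve-∀

-- Connected graphs, spanning trees and rooted trees.

module Graph where

  open import Data.Bool using (Bool; true; false; if_then_else_; not)
  open import Data.Bool.Properties using () renaming (_≟_ to _≟ᵇ_)
  open import Data.Fin as Fin using (Fin; zero; suc; punchIn; _≟_; toℕ)
  open import Data.Fin.Properties using (any?)
  open import Data.Integer using (ℤ; +_; -_; _+_; _*_; _-_; +≤+)
  import Data.Integer as ℤ
  open import Data.Integer.Properties hiding (_≟_)
  open import Data.Integer.Tactic.RingSolver using (solve-∀)
  open import Data.Nat as ℕ using (ℕ; zero; suc)
  open import Data.Nat.Induction using (<-rec)
  import Data.Nat.Properties as ℕₚ
  open import Data.Product using (_×_; _,_; proj₁; proj₂)
  open import Data.Sum using (_⊎_; inj₁; inj₂)
  open import Function using (_∘_)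
  open import Relation.Binary.PropositionalEquality
  open import Relation.Nullary using (¬_; does; yes; no; contradiction; _×-dec_)

  open import Defs using (Adj; IsSimple; laplacian; degree; countFin)
  open Series
  open CharPoly
  open Connectivity
  open ℤ-Det using (∑-cong; ∑-+; ∑-*; ∑-0; ∑-swap; ∑-neg; ∑-suc; ∑-remove; det)

  ∑-- : ∀ {n} (f g : Fin n → ℤ) → ∑ (λ i → f i - g i) ≡ ∑ f - ∑ g
  ∑-- f g = trans (∑-+ f (λ i → - g i)) (cong (λ z → ∑ f + z) (∑-neg g))

  ∑-nonneg : ∀ {n} (f : Fin n → ℤ) → (∀ i → + 0 ℤ.≤ f i) → + 0 ℤ.≤ ∑ f
  ∑-nonneg {zero}  f h = ≤-reflexive (sym (ℤ-Det.∑-zero f))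
  ∑-nonneg {suc n} f h = subst (+ 0 ℤ.≤_) (sym (∑-suc f)) (+-mono-≤ (h zero) (∑-nonneg (f ∘ suc) (h ∘ suc)))

  ∑-term-≤ : ∀ {n} (f : Fin n → ℤ) → (∀ i → + 0 ℤ.≤ f i) → ∀ i → f i ℤ.≤ ∑ f
  ∑-term-≤ {suc n} f h i = subst (f i ℤ.≤_) (sym (∑-remove i f))
    (subst (ℤ._≤ f i + ∑ (f ∘ punchIn i)) (+-identityʳ (f i)) (+-monoʳ-≤ (f i) (∑-nonneg (f ∘ punchIn i) (h ∘ punchIn i))))

  ∑-vanish : ∀ {n} (f : Fin n → ℤ) → (∀ i → + 0 ℤ.≤ f i) → ∑ f ℤ.≤ + 0 → ∀ i → f i ≡ + 0
  ∑-vanish f h s i = ≤-antisym (≤-trans (∑-term-≤ f h i) s) (h i)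

  ⟦_⟧ : Bool → ℤ
  ⟦ b ⟧ = if b then + 1 else + 0

  ⟦⟧-nonneg : ∀ b → + 0 ℤ.≤ ⟦ b ⟧
  ⟦⟧-nonneg true  = +≤+ ℕ.z≤n
  ⟦⟧-nonneg false = +≤+ ℕ.z≤n

  count-∑ : ∀ m (f : Fin m → Bool) → + countFin m f ≡ ∑ (λ i → ⟦ f i ⟧)
  count-∑ zero    f = sym (ℤ-Det.∑-zero _)
  count-∑ (suc m) f with f zero in e
  ... | true  = trans (pos-+ 1 _) (trans (cong (λ z → + 1 + z) (count-∑ m (f ∘ suc))) (sym (trans (∑-suc _) (cong (λ b → ⟦ b ⟧ + ∑ (λ i → ⟦ f (suc i) ⟧)) e))))
  ... | false = trans (count-∑ m (f ∘ suc)) (sym (trans (∑-suc _) (trans (cong (λ b → ⟦ b ⟧ + ∑ (λ i → ⟦ f (suc i) ⟧)) e) (+-identityˡ _))))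

  indicator-mono : ∀ b c → (b ≡ true → c ≡ true) → (if b then 1 else 0) ℕ.≤ (if c then 1 else 0)
  indicator-mono true  true  _ = ℕₚ.≤-refl
  indicator-mono true  false h = contradiction (h refl) λ ()
  indicator-mono false _     _ = ℕ.z≤n

  count-mono : ∀ m (f g : Fin m → Bool) → (∀ u → f u ≡ true → g u ≡ true) → countFin m f ℕ.≤ countFin m g
  count-mono zero    f g h = ℕ.z≤n
  count-mono (suc m) f g h = ℕₚ.+-mono-≤ (indicator-mono (f zero) (g zero) (h zero)) (count-mono m (f ∘ suc) (g ∘ suc) (h ∘ suc))

  count-strict : ∀ m (f g : Fin m → Bool) → (∀ u → f u ≡ true → g u ≡ true) → ∀ v → f v ≡ false → g v ≡ true →
    countFin m f ℕ.< countFin m g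
  count-strict (suc m) f g h zero    fv gv rewrite fv | gv = ℕ.s≤s (count-mono m (f ∘ suc) (g ∘ suc) (h ∘ suc))
  count-strict (suc m) f g h (suc v) fv gv =
    ℕₚ.+-mono-≤-< (indicator-mono (f zero) (g zero) (h zero)) (count-strict m (f ∘ suc) (g ∘ suc) (h ∘ suc) v fv gv)

  module _ {m} (A : Adj m) where

    a : Matrix m
    a i j = ⟦ A i j ⟧

    deg : Fin m → ℤ
    deg i = + degree A i

    deg-∑ : ∀ i → deg i ≡ ∑ (a i)
    deg-∑ i = count-∑ m (A i)

    laplacian-δ : IsSimple A → ∀ i j → laplacian A i j ≡ δ i j * deg i - a i j
    laplacian-δ (_ , irr) i j with i ≟ j
    ... | yes refl rewrite irr i = sym (trans (+-identityʳ _) (*-identityˡ (deg i)))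
    ... | no _ with A i j
    ...   | true  = refl
    ...   | false = refl

    a-sym : IsSimple A → ∀ i j → a i j ≡ a j i
    a-sym (s , _) i j = cong ⟦_⟧ (s i j)

    laplacian-columns : IsSimple A → ∀ l → ∑ (λ k → laplacian A k l) ≡ + 0
    laplacian-columns simple l = begin
      ∑ (λ k → laplacian A k l)
        ≡⟨ ∑-cong (λ k → trans (laplacian-δ simple k l) (cong₂ (λ y z → y * deg k - z) (δ-sym k l) (a-sym simple k l))) ⟩
      ∑ (λ k → δ l k * deg k - a l k)
        ≡⟨ ∑-- (λ k → δ l k * deg k) (a l) ⟩
      ∑ (λ k → δ l k * deg k) - ∑ (a l)
        ≡⟨ cong₂ _-_ (∑-δ l deg) (sym (deg-∑ l)) ⟩
      deg l - deg l
        ≡⟨ +-inverseʳ (deg l) ⟩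
      + 0 ∎
      where open ≡-Reasoning

    Closed : (Fin m → Bool) → Set
    Closed S = ∀ u v → S u ≡ true → A u v ≡ true → S v ≡ true

    -- Connectedness through closed vertex sets fits both uses: the indicator of a closed set is a
    -- kernel vector of L, and a growing partial tree is complete once its vertex set is closed.
    Connected : Set
    Connected = ∀ S → Closed S → ∀ u v → S u ≡ true → S v ≡ true

    -- The rank excludes cycles and carries every induction along the tree; it need not be the
    -- distance from the root. Nothing is said about `par r`.
    record SpanningTree (r : Fin m) : Set where
      field
        par    : Fin m → Fin m
        rk     : Fin m → ℕ
        rk-par : ∀ {v} → v ≢ r → rk (par v) ℕ.< rk v
        edge   : ∀ {v} → v ≢ r → A v (par v) ≡ true

    record RootedTree (r : Fin m) : Set where
      field
        spanning : SpanningTree r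
      open SpanningTree spanning public
      field
        edge⁻¹ : ∀ {i j} → A i j ≡ true → (i ≢ r × par i ≡ j) ⊎ (j ≢ r × par j ≡ i)

    module _ (simple : IsSimple A) (connected : Connected) (r : Fin m) where

      private
        record Partial (S : Fin m → Bool) : Set where
          field
            root   : S r ≡ true
            par    : Fin m → Fin m
            rk     : Fin m → ℕ
            within : ∀ {v} → S v ≡ true → v ≢ r → S (par v) ≡ true × A v (par v) ≡ true × rk (par v) ℕ.< rk v

        add : Fin m → (Fin m → Bool) → Fin m → Bool
        add v S u = if does (u ≟ v) then true else S u

        add-⊇ : ∀ v S {u} → S u ≡ true → add v S u ≡ true
        add-⊇ v S {u} Su with u ≟ v
        ... | yes _ = refl
        ... | no  _ = Su

        add-v : ∀ v S → add v S v ≡ true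
        add-v v S with v ≟ v
        ... | yes _   = refl
        ... | no  v≢v = contradiction refl v≢v

        extend : ∀ {S} → Partial S → ∀ u v → S u ≡ true → S v ≡ false → A u v ≡ true → Partial (add v S)
        extend {S} P u v Su Sv Auv = record
          { root = add-⊇ v S root ; par = par′ ; rk = rk′ ; within = λ {w} → within′ w }
          where
          open Partial P
          par′ : Fin m → Fin m
          par′ w = if does (w ≟ v) then u else par w
          rk′ : Fin m → ℕ
          rk′ w = if does (w ≟ v) then suc (rk u) else rk w
          rk-old : ∀ {w} → S w ≡ true → rk′ w ≡ rk w
          rk-old {w} Sw with w ≟ v
          ... | yes refl = contradiction (trans (sym Sw) Sv) λ ()
          ... | no  _    = refl
          within′ : ∀ w → add v S w ≡ true → w ≢ r → add v S (par′ w) ≡ true × A w (par′ w) ≡ true × rk′ (par′ w) ℕ.< rk′ w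
          within′ w Sw w≢r with w ≟ v
          ... | yes refl = add-⊇ v S Su , trans (proj₁ simple v u) Auv , ℕ.s≤s (ℕₚ.≤-reflexive (rk-old Su))
          ... | no  _ with within Sw w≢r
          ...   | Sp , e , lt = add-⊇ v S Sp , e , subst (ℕ._< rk w) (sym (rk-old Sp)) lt

        -- Induction on the number of vertices not yet reached. If an edge leaves `S`, its far end
        -- is hung below the near one; if none does, `S` is closed and, as it contains the root,
        -- connectedness makes it everything.
        grow : ∀ k S → countFin m (not ∘ S) ≡ k → Partial S → SpanningTree r
        grow = <-rec _ λ k rec S e P → step k rec S e P
          where
          step : ∀ k → (∀ {j} → j ℕ.< k → ∀ S → countFin m (not ∘ S) ≡ j → Partial S → SpanningTree r) →
            ∀ S → countFin m (not ∘ S) ≡ k → Partial S → SpanningTree r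
          step k rec S refl P
            with any? (λ u → any? (λ v → (S u ≟ᵇ true) ×-dec (S v ≟ᵇ false) ×-dec (A u v ≟ᵇ true)))
          ... | yes (u , v , Su , Sv , Auv) = rec
                (count-strict m _ _ (λ w → smaller w) v (cong not (add-v v S)) (cong not Sv)) (add v S) refl (extend P u v Su Sv Auv)
            where
            smaller : ∀ w → not (add v S w) ≡ true → not (S w) ≡ true
            smaller w h with w ≟ v | S w
            ... | yes _ | _     = contradiction h λ ()
            ... | no  _ | false = refl
          ... | no  none = record { par = par ; rk = rk ; rk-par = λ v≢r → proj₂ (proj₂ (within (all _) v≢r)) ; edge = λ v≢r → proj₁ (proj₂ (within (all _) v≢r)) }
            where
            open Partial P
            closed : Closed S
            closed u v Su Auv with S v in Sv
            ... | true  = refl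
            ... | false = contradiction (u , v , Su , Sv , Auv) none
            all : ∀ v → S v ≡ true
            all v = connected S closed r v root

      connected⇒spanning : SpanningTree r
      connected⇒spanning = grow _ (λ v → does (v ≟ r)) refl record
        { root = root ; par = λ v → v ; rk = λ _ → 0 ; within = λ {v} → within v }
        where
        root : does (r ≟ r) ≡ true
        root with r ≟ r
        ... | yes _   = refl
        ... | no  r≢r = contradiction refl r≢r
        within : ∀ v → does (v ≟ r) ≡ true → v ≢ r → _
        within v e v≢r with v ≟ r
        ... | yes v≡r = contradiction v≡r v≢r
        within v () v≢r | no _

    module _ (r : Fin m) (par : Fin m → Fin m) where

      arc : Matrix m
      arc i j = if does (i ≟ r) then + 0 else δ (par i) j

      arc-cases : ∀ i j → (i ≢ r × par i ≡ j × arc i j ≡ + 1) ⊎ (¬ (i ≢ r × par i ≡ j) × arc i j ≡ + 0)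
      arc-cases i j with i ≟ r
      ... | yes i≡r = inj₂ ((λ { (i≢r , _) → i≢r i≡r }) , refl)
      ... | no  i≢r with par i ≟ j
      ...   | yes e = inj₁ (i≢r , e , refl)
      ...   | no ≢j = inj₂ ((λ { (_ , e) → ≢j e }) , refl)

      arc-row : ∀ i → ∑ (arc i) ≡ + 1 - δ r i
      arc-row i with i ≟ r
      ... | yes refl = trans (∑-0 λ _ → refl) (sym (cong (λ z → + 1 - z) (δ-refl r)))
      ... | no  i≢r  = trans (∑-cong λ j → sym (*-identityʳ (δ (par i) j))) (trans (∑-δ (par i) (λ _ → + 1)) (sym (cong (λ z → + 1 - z) (δ-≢ (i≢r ∘ sym)))))

      arc-total : ∑ (λ i → ∑ (arc i)) ≡ + m - + 1
      arc-total = trans (∑-cong arc-row) (trans (∑-- (λ _ → + 1) (δ r)) (cong₂ _-_ (trans (∑-const m (+ 1)) (*-identityʳ (+ m)))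
        (trans (∑-cong λ j → sym (*-identityʳ (δ r j))) (∑-δ r (λ _ → + 1)))))

    edge-total : ℤ
    edge-total = ∑ λ i → ∑ (a i)

    module _ {r : Fin m} (T : SpanningTree r) where

      open SpanningTree T

      arcs-disjoint : ∀ {i j} → i ≢ r → par i ≡ j → j ≢ r → par j ≢ i
      arcs-disjoint {i} i≢r refl j≢r e = ℕₚ.<-asym (rk-par i≢r) (subst (λ z → rk z ℕ.< rk (par i)) e (rk-par j≢r))

      -- The adjacency matrix minus the child-parent arcs in both directions is entrywise
      -- nonnegative, because these arcs are edges and no two of them are opposite. Its entries sum
      -- to 0 by the edge count, so it vanishes and every edge is an arc.
      spanning⇒tree : IsSimple A → edge-total ≡ + 2 * (+ m - + 1) → RootedTree r
      spanning⇒tree simple total = record { spanning = T ; edge⁻¹ = λ {i} {j} → edge⁻¹ i j }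
        where
        open ≡-Reasoning
        excess : Fin m → Fin m → ℤ
        excess i j = a i j - (arc r par i j + arc r par j i)
        nonneg : ∀ i j → + 0 ℤ.≤ excess i j
        nonneg i j with arc-cases r par i j | arc-cases r par j i
        ... | inj₁ (i≢r , e , h) | inj₁ (j≢r , e′ , h′) = contradiction e′ (arcs-disjoint i≢r e j≢r)
        ... | inj₁ (i≢r , refl , h) | inj₂ (_ , h′) rewrite h | h′ | edge i≢r = ≤-refl
        ... | inj₂ (_ , h) | inj₁ (j≢r , refl , h′) rewrite h | h′ | trans (proj₁ simple i j) (edge j≢r) = ≤-refl
        ... | inj₂ (_ , h) | inj₂ (_ , h′) rewrite h | h′ = ≤-trans (⟦⟧-nonneg (A i j)) (≤-reflexive (sym (+-identityʳ _)))
        row-excess : ∀ i → ∑ (excess i) ≡ ∑ (a i) - (∑ (arc r par i) + ∑ (λ j → arc r par j i))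
        row-excess i = trans (∑-- (a i) _) (cong (λ z → ∑ (a i) - z) (∑-+ (arc r par i) (λ j → arc r par j i)))
        total-excess : ∑ (λ i → ∑ (excess i)) ≡ + 0
        total-excess = begin
          ∑ (λ i → ∑ (excess i))
            ≡⟨ ∑-cong row-excess ⟩
          ∑ (λ i → ∑ (a i) - (∑ (arc r par i) + ∑ (λ j → arc r par j i)))
            ≡⟨ ∑-- (λ i → ∑ (a i)) _ ⟩
          edge-total - ∑ (λ i → ∑ (arc r par i) + ∑ (λ j → arc r par j i))
            ≡⟨ cong (λ z → edge-total - z) (trans (∑-+ (λ i → ∑ (arc r par i)) (λ i → ∑ (λ j → arc r par j i)))
                 (cong (λ z → ∑ (λ i → ∑ (arc r par i)) + z) (∑-swap (λ i j → arc r par j i)))) ⟩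
          edge-total - (∑ (λ i → ∑ (arc r par i)) + ∑ (λ i → ∑ (arc r par i)))
            ≡⟨ cong₂ (λ y z → y - (z + z)) total (arc-total r par) ⟩
          + 2 * (+ m - + 1) - ((+ m - + 1) + (+ m - + 1))
            ≡⟨ cancel (+ m - + 1) ⟩
          + 0 ∎
          where
          cancel : ∀ x → + 2 * x - (x + x) ≡ + 0
          cancel = solve-∀
        excess-0 : ∀ i j → excess i j ≡ + 0
        excess-0 i j = ∑-vanish (excess i) (nonneg i)
          (≤-reflexive (∑-vanish (λ i → ∑ (excess i)) (λ i → ∑-nonneg (excess i) (nonneg i)) (≤-reflexive total-excess) i)) j
        edge⁻¹ : ∀ i j → A i j ≡ true → (i ≢ r × par i ≡ j) ⊎ (j ≢ r × par j ≡ i)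
        edge⁻¹ i j Aij with arc-cases r par i j | arc-cases r par j i | excess-0 i j
        ... | inj₁ (i≢r , e , _) | _ | _ = inj₁ (i≢r , e)
        ... | inj₂ _ | inj₁ (j≢r , e , _) | _ = inj₂ (j≢r , e)
        ... | inj₂ (_ , h) | inj₂ (_ , h′) | z rewrite Aij | h | h′ = contradiction z λ ()

    module _ (simple : IsSimple A) {r : Fin m} (T : RootedTree r) where

      open RootedTree T

      a-arcs : ∀ i j → a i j ≡ arc r par i j + arc r par j i
      a-arcs i j with arc-cases r par i j | arc-cases r par j i
      ... | inj₁ (i≢r , e , h) | inj₁ (j≢r , e′ , h′) = contradiction e′ (arcs-disjoint spanning i≢r e j≢r)
      ... | inj₁ (i≢r , refl , h) | inj₂ (_ , h′) rewrite h | h′ | edge i≢r = refl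
      ... | inj₂ (_ , h) | inj₁ (j≢r , refl , h′) rewrite h | h′ | trans (proj₁ simple i j) (edge j≢r) = refl
      ... | inj₂ (n , h) | inj₂ (n′ , h′) rewrite h | h′ with A i j in Aij
      ...   | false = refl
      ...   | true with edge⁻¹ Aij
      ...     | inj₁ k = contradiction k n
      ...     | inj₂ k = contradiction k n′

      deg-arcs : ∀ i → deg i ≡ (+ 1 - δ r i) + ∑ (λ j → arc r par j i)
      deg-arcs i = trans (deg-∑ i) (trans (∑-cong (a-arcs i)) (trans (∑-+ (arc r par i) (λ j → arc r par j i))
        (cong (λ z → z + ∑ (λ j → arc r par j i)) (arc-row r par i))))

      tree-edge-total : edge-total ≡ + 2 * (+ m - + 1)
      tree-edge-total = begin
        ∑ (λ i → ∑ (a i))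
          ≡⟨ ∑-cong (λ i → trans (∑-cong (a-arcs i)) (∑-+ (arc r par i) (λ j → arc r par j i))) ⟩
        ∑ (λ i → ∑ (arc r par i) + ∑ (λ j → arc r par j i))
          ≡⟨ trans (∑-+ (λ i → ∑ (arc r par i)) (λ i → ∑ (λ j → arc r par j i)))
               (cong (λ z → ∑ (λ i → ∑ (arc r par i)) + z) (∑-swap (λ i j → arc r par j i))) ⟩
        ∑ (λ i → ∑ (arc r par i)) + ∑ (λ i → ∑ (arc r par i))
          ≡⟨ cong (λ z → z + z) (arc-total r par) ⟩
        (+ m - + 1) + (+ m - + 1)
          ≡⟨ double (+ m - + 1) ⟩
        + 2 * (+ m - + 1) ∎
        where
        open ≡-Reasoning
        double : ∀ x → x + x ≡ + 2 * x
        double = solve-∀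

  module _ {n} (A : Adj (suc n)) (simple : IsSimple A) where

    private
      L = laplacian A

      -- The indicator vector of a closed set is in the left kernel of L. Since `S` misses vertex 0,
      -- the border row has coefficient 0 and the vector is in the left kernel of the bordered
      -- matrix as well.
      closed⇒χ-at-1≡0 : ∀ S → Closed A S → S zero ≡ false → ∀ i → S i ≡ true → χ L 1 ≡ + 0
      closed⇒χ-at-1≡0 S closed S0 i Si = begin
        χ L 1                       ≡⟨ χ-at-1 L (laplacian-columns A simple) ⟩
        det (bordered L)            ≡⟨ *-identityˡ _ ⟨
        + 1 * det (bordered L)      ≡⟨ cong (λ b → ⟦ b ⟧ * det (bordered L)) Si ⟨
        ⟦ S i ⟧ * det (bordered L)  ≡⟨ left-kernel (bordered L) (λ k → ⟦ S k ⟧) kernel i ⟩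
        + 0                         ∎
        where
        open ≡-Reasoning
        same : ∀ k l → ⟦ S k ⟧ * a A l k ≡ ⟦ S l ⟧ * a A l k
        same k l with A l k in Alk
        ... | false = trans (*-zeroʳ ⟦ S k ⟧) (sym (*-zeroʳ ⟦ S l ⟧))
        ... | true  with S k in Sk | S l in Sl
        ...   | true  | true  = refl
        ...   | false | false = refl
        ...   | true  | false = contradiction (trans (sym Sl) (closed k l Sk (trans (proj₁ simple k l) Alk))) λ ()
        ...   | false | true  = contradiction (trans (sym Sk) (closed l k Sl Alk)) λ ()
        row : ∀ k l → ⟦ S k ⟧ * bordered L k l ≡ ⟦ S l ⟧ * a A l k - δ l k * (⟦ S k ⟧ * deg A k)
        row k l = begin
          ⟦ S k ⟧ * bordered L k l
            ≡⟨ not-bordered k ⟩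
          ⟦ S k ⟧ * - L k l
            ≡⟨ cong (λ z → ⟦ S k ⟧ * - z) (trans (laplacian-δ A simple k l) (cong₂ (λ y z → y * deg A k - z) (δ-sym k l) (a-sym A simple k l))) ⟩
          ⟦ S k ⟧ * - (δ l k * deg A k - a A l k)
            ≡⟨ regroup ⟦ S k ⟧ (δ l k) (deg A k) (a A l k) ⟩
          ⟦ S k ⟧ * a A l k - δ l k * (⟦ S k ⟧ * deg A k)
            ≡⟨ cong (λ z → z - δ l k * (⟦ S k ⟧ * deg A k)) (same k l) ⟩
          ⟦ S l ⟧ * a A l k - δ l k * (⟦ S k ⟧ * deg A k) ∎
          where
          regroup : ∀ s d e x → s * - (d * e - x) ≡ s * x - d * (s * e)
          regroup = solve-∀
          not-bordered : ∀ k → ⟦ S k ⟧ * bordered L k l ≡ ⟦ S k ⟧ * - L k l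
          not-bordered zero    rewrite S0 = refl
          not-bordered (suc k) = refl
        kernel : ∀ l → ∑ (λ k → ⟦ S k ⟧ * bordered L k l) ≡ + 0
        kernel l = begin
          ∑ (λ k → ⟦ S k ⟧ * bordered L k l)
            ≡⟨ ∑-cong (λ k → row k l) ⟩
          ∑ (λ k → ⟦ S l ⟧ * a A l k - δ l k * (⟦ S k ⟧ * deg A k))
            ≡⟨ ∑-- (λ k → ⟦ S l ⟧ * a A l k) (λ k → δ l k * (⟦ S k ⟧ * deg A k)) ⟩
          ∑ (λ k → ⟦ S l ⟧ * a A l k) - ∑ (λ k → δ l k * (⟦ S k ⟧ * deg A k))
            ≡⟨ cong₂ _-_ (trans (∑-* ⟦ S l ⟧ (a A l)) (cong (⟦ S l ⟧ *_) (sym (deg-∑ A l)))) (∑-δ l (λ k → ⟦ S k ⟧ * deg A k)) ⟩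
          ⟦ S l ⟧ * deg A l - ⟦ S l ⟧ * deg A l
            ≡⟨ +-inverseʳ (⟦ S l ⟧ * deg A l) ⟩
          + 0 ∎

    χ-at-1≢0⇒connected : χ (laplacian A) 1 ≢ + 0 → Connected A
    χ-at-1≢0⇒connected χ≢0 S closed u v Su with S v in Sv
    ... | true  = refl
    -- One of `S` and its complement misses vertex 0, and both are closed; `u` or `v` witnesses that
    -- it is not empty.
    ... | false with S zero in S0
    ...   | false = contradiction (closed⇒χ-at-1≡0 S closed S0 u Su) χ≢0
    ...   | true  = contradiction (closed⇒χ-at-1≡0 (not ∘ S) closed′ (cong not S0) v (cong not Sv)) χ≢0
      where
      closed′ : Closed A (not ∘ S)
      closed′ x y Sx Axy with S y in Sy
      ... | false = refl
      ... | true  = contradiction (trans (sym Sx) (cong not (closed y x Sy (trans (proj₁ simple y x) Axy)))) λ ()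

    -- A vertex w other than the root has degree 1 plus its number of children, so its Laplacian row
    -- is (e_w - e_par(w)) - ∑ (e_c - e_w) over the children c.
    increasing-tree-χ-at-1 : (T : RootedTree A zero) → (∀ w → toℕ (RootedTree.par T (suc w)) ℕ.< toℕ (suc w)) → χ L 1 ≢ + 0
    increasing-tree-χ-at-1 T par< = tree-χ-at-1 par par< L (laplacian-columns A simple) rows
      where
      open RootedTree T
      open ≡-Reasoning
      e = arc A zero par
      child≡arc : ∀ c w → child par par< c w ≡ e c w
      child≡arc zero    w = refl
      child≡arc (suc c) w = refl
      glue : ∀ c w l → e c w * δ (par c) l ≡ e c w * δ w l
      glue c w l with arc-cases A zero par c w
      ... | inj₁ (_ , refl , _) = refl
      ... | inj₂ (_ , h) rewrite h = refl
      rows : ∀ w l → L (suc w) l ≡ b par par< (suc w) l - ∑ (λ c → child par par< c (suc w) * b par par< c l)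
      rows w l = begin
        L (suc w) l
          ≡⟨ laplacian-δ A simple (suc w) l ⟩
        δ (suc w) l * deg A (suc w) - a A (suc w) l
          ≡⟨ cong₂ (λ y z → δ (suc w) l * y - z) (deg-arcs A simple T (suc w)) (a-arcs A simple T (suc w) l) ⟩
        δ (suc w) l * (+ 1 + ∑ (λ c → e c (suc w))) - (δ (par (suc w)) l + e l (suc w))
          ≡⟨ regroup (δ (suc w) l) (∑ (λ c → e c (suc w))) (δ (par (suc w)) l) (e l (suc w)) ⟩
        (δ (suc w) l - δ (par (suc w)) l) - (e l (suc w) - δ (suc w) l * ∑ (λ c → e c (suc w)))
          ≡⟨ cong₂ (λ y z → (δ (suc w) l - δ (par (suc w)) l) - (y - z)) (sym (∑-δ l (λ c → e c (suc w)))) (sym (∑-* (δ (suc w) l) (λ c → e c (suc w)))) ⟩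
        (δ (suc w) l - δ (par (suc w)) l) - (∑ (λ c → δ l c * e c (suc w)) - ∑ (λ c → δ (suc w) l * e c (suc w)))
          ≡⟨ cong (λ z → (δ (suc w) l - δ (par (suc w)) l) - z) (sym (∑-- (λ c → δ l c * e c (suc w)) (λ c → δ (suc w) l * e c (suc w)))) ⟩
        (δ (suc w) l - δ (par (suc w)) l) - ∑ (λ c → δ l c * e c (suc w) - δ (suc w) l * e c (suc w))
          ≡⟨ cong (λ z → (δ (suc w) l - δ (par (suc w)) l) - z) (∑-cong term) ⟩
        b par par< (suc w) l - ∑ (λ c → child par par< c (suc w) * b par par< c l) ∎
        where
        regroup : ∀ d s x y → d * (+ 1 + s) - (x + y) ≡ (d - x) - (y - d * s)
        regroup = solve-∀
        term : ∀ c → δ l c * e c (suc w) - δ (suc w) l * e c (suc w) ≡ child par par< c (suc w) * b par par< c l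
        term c = begin
          δ l c * e c (suc w) - δ (suc w) l * e c (suc w)
            ≡⟨ cong₂ _-_ (trans (*-comm (δ l c) (e c (suc w))) (cong (e c (suc w) *_) (δ-sym l c))) (trans (*-comm (δ (suc w) l) (e c (suc w))) (sym (glue c (suc w) l))) ⟩
          e c (suc w) * δ c l - e c (suc w) * δ (par c) l
            ≡⟨ factor (e c (suc w)) (δ c l) (δ (par c) l) ⟩
          e c (suc w) * (δ c l - δ (par c) l)
            ≡⟨ cong (_* (δ c l - δ (par c) l)) (sym (child≡arc c (suc w))) ⟩
          child par par< c (suc w) * b par par< c l ∎
          where
          factor : ∀ x y z → x * y - x * z ≡ x * (y - z)
          factor = solve-∀

-- Traces of the first four powers of the Laplacian of a tree.

module Traces where

  open import Data.Bool using (true; false)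
  open import Data.Bool.Properties using () renaming (_≟_ to _≟ᵇ_)
  open import Data.Fin as Fin using (Fin; _≟_)
  open import Data.Fin.Properties using (any?)
  open import Data.Integer using (ℤ; +_; -_; _+_; _*_; _-_)
  open import Data.Integer.Properties hiding (_≟_)
  open import Data.Integer.Tactic.RingSolver using (solve-∀)
  open import Data.Nat as ℕ using (ℕ)
  import Data.Nat.Properties as ℕₚ
  open import Data.Product using (_,_; proj₂)
  open import Data.Sum using (inj₁; inj₂)
  open import Function using (_∘_)
  open import Relation.Binary.PropositionalEquality
  open import Relation.Nullary using (yes; no; contradiction; _×-dec_)

  open import Defs using (Adj; IsSimple; laplacian)
  open Series
  open CharPoly
  open Graph
  open ℤ-Det using (∑-cong; ∑-+; ∑-*; ∑-0; ∑-swap; ∑-neg)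

  ·-δ : ∀ {n} (L : Matrix n) k i → (L · δ) k i ≡ L k i
  ·-δ L k i = trans (∑-cong λ l → trans (*-comm (L k l) (δ l i)) (cong (_* L k l) (δ-sym l i))) (∑-δ i (L k))

  ·-cong : ∀ {n} (L : Matrix n) {B C : Matrix n} → (∀ k i → B k i ≡ C k i) → ∀ k i → (L · B) k i ≡ (L · C) k i
  ·-cong L e k i = ∑-cong λ l → cong (L k l *_) (e l i)

  ·-assoc : ∀ {n} (K L B : Matrix n) k i → (K · L · B) k i ≡ ((K · L) · B) k i
  ·-assoc K L B k i = begin
    ∑ (λ l → K k l * ∑ (λ j → L l j * B j i))     ≡⟨ ∑-cong (λ l → sym (∑-* (K k l) (λ j → L l j * B j i))) ⟩
    ∑ (λ l → ∑ λ j → K k l * (L l j * B j i))     ≡⟨ ∑-swap (λ l j → K k l * (L l j * B j i)) ⟩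
    ∑ (λ j → ∑ λ l → K k l * (L l j * B j i))     ≡⟨ ∑-cong (λ j → trans (∑-cong λ l → regroup (K k l) (L l j) (B j i)) (trans (∑-* (B j i) (λ l → K k l * L l j)) (*-comm (B j i) _))) ⟩
    ∑ (λ j → ∑ (λ l → K k l * L l j) * B j i)     ∎
    where
    open ≡-Reasoning
    regroup : ∀ x y z → x * (y * z) ≡ z * (x * y)
    regroup = solve-∀

  trace-1 : ∀ {m} (A : Adj m) → IsSimple A → power-trace (laplacian A) 1 ≡ ∑ (deg A)
  trace-1 A simple = ∑-cong λ k → trans (·-δ (laplacian A) k k) (trans (laplacian-δ A simple k k)
    (trans (cong₂ (λ y z → y * deg A k - z) (δ-refl k) (cong ⟦_⟧ (proj₂ simple k))) (trans (+-identityʳ _) (*-identityˡ (deg A k)))))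

  module _ {m} (A : Adj m) (simple : IsSimple A) {r : Fin m} (T : RootedTree A r) where

    open RootedTree T

    private
      L = laplacian A
      d = deg A
      e = a A

      par-unique : ∀ {v u w : Fin m} → par v ≡ u → par v ≡ w → u ≡ w
      par-unique p q = trans (sym p) q

      up : ∀ {u v} → u ≢ r → par u ≡ v → rk v ℕ.< rk u
      up u≢r refl = rk-par u≢r

    irreflexive : ∀ {i j} → A i j ≡ true → i ≢ j
    irreflexive {i} Aij refl = contradiction (trans (sym Aij) (proj₂ simple i)) λ ()

    -- Orient every edge towards the parent. Either one vertex of the triangle has two parents,
    -- which would be equal, or the ranks decrease around a cycle.
    no-triangle : ∀ {k l j} → A k l ≡ true → A l j ≡ true → A k j ≢ true
    no-triangle Akl Alj Akj with edge⁻¹ Akl | edge⁻¹ Alj | edge⁻¹ Akj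
    ... | inj₁ (_ , p)  | _             | inj₁ (_ , q) = irreflexive Alj (par-unique p q)
    ... | inj₂ (_ , p)  | inj₁ (_ , q)  | _            = irreflexive Akj (par-unique p q)
    ... | _             | inj₂ (_ , p)  | inj₂ (_ , q) = irreflexive Akl (par-unique q p)
    ... | inj₁ (n₁ , p) | inj₁ (n₂ , q) | inj₂ (n₃ , s) = ℕₚ.<-asym (up n₁ p) (ℕₚ.<-trans (up n₃ s) (up n₂ q))
    ... | inj₂ (n₁ , p) | inj₂ (n₂ , q) | inj₁ (n₃ , s) = ℕₚ.<-asym (up n₁ p) (ℕₚ.<-trans (up n₂ q) (up n₃ s))

    -- Trees have no 4-cycle, by the same orientation argument: two parents of one vertex coincide,
    -- and the two cyclic orientations contradict the ranks.
    common-neighbour : ∀ {k j l l′} → k ≢ j → A k l ≡ true → A l j ≡ true → A k l′ ≡ true → A l′ j ≡ true → l ≡ l′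
    common-neighbour k≢j Akl Alj Akl′ Al′j with edge⁻¹ Akl | edge⁻¹ Alj | edge⁻¹ Akl′ | edge⁻¹ Al′j
    ... | inj₁ (_ , p)  | _             | inj₁ (_ , q)  | _             = par-unique p q
    ... | _             | inj₂ (_ , p)  | _             | inj₂ (_ , q)  = par-unique p q
    ... | inj₂ (_ , p)  | inj₁ (_ , q)  | _             | _             = contradiction (par-unique p q) k≢j
    ... | _             | _             | inj₂ (_ , p)  | inj₁ (_ , q)  = contradiction (par-unique p q) k≢j
    ... | inj₁ (n₁ , p) | inj₁ (n₂ , q) | inj₂ (n₃ , s) | inj₂ (n₄ , t) =
      contradiction (ℕₚ.<-trans (up n₃ s) (up n₄ t)) (ℕₚ.<-asym (ℕₚ.<-trans (up n₂ q) (up n₁ p)))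
    ... | inj₂ (n₁ , p) | inj₂ (n₂ , q) | inj₁ (n₃ , s) | inj₁ (n₄ , t) =
      contradiction (ℕₚ.<-trans (up n₁ p) (up n₂ q)) (ℕₚ.<-asym (ℕₚ.<-trans (up n₄ t) (up n₃ s)))

    private
      walks : Matrix m
      walks = e · e

      a-idem : ∀ i j → e i j * e i j ≡ e i j
      a-idem i j with A i j
      ... | true  = refl
      ... | false = refl

      a-diag : ∀ i → e i i ≡ + 0
      a-diag i rewrite proj₂ simple i = refl

      walks-diag : ∀ k → walks k k ≡ d k
      walks-diag k = trans (∑-cong λ l → trans (cong (e k l *_) (a-sym A simple l k)) (a-idem k l)) (sym (deg-∑ A k))

      walks-a : ∀ k j → walks k j * e k j ≡ + 0
      walks-a k j = trans (*-comm (walks k j) (e k j)) (trans (sym (∑-* (e k j) (λ l → e k l * e l j))) (∑-0 term))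
        where
        term : ∀ l → e k j * (e k l * e l j) ≡ + 0
        term l with A k j in Akj | A k l in Akl | A l j in Alj
        ... | false | _     | _     = refl
        ... | true  | false | _     = refl
        ... | true  | true  | false = refl
        ... | true  | true  | true  = contradiction Akj (no-triangle Akl Alj)

      -- Off the diagonal A² counts common neighbours, of which there is at most one.
      walks-0-1 : ∀ {k j} → k ≢ j → walks k j * walks k j ≡ walks k j
      walks-0-1 {k} {j} k≢j with any? (λ l → (A k l ≟ᵇ true) ×-dec (A l j ≟ᵇ true))
      ... | yes (l , Akl , Alj) = trans (cong (λ z → z * z) one) (sym one)
        where
        term : ∀ l′ → e k l′ * e l′ j ≡ δ l l′ * + 1
        term l′ with l ≟ l′
        ... | yes refl rewrite Akl | Alj = refl
        ... | no  l≢l′ with A k l′ in Akl′ | A l′ j in Al′j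
        ...   | false | _     = refl
        ...   | true  | false = refl
        ...   | true  | true  = contradiction (common-neighbour k≢j Akl Alj Akl′ Al′j) l≢l′
        one : walks k j ≡ + 1
        one = trans (∑-cong term) (∑-δ l (λ _ → + 1))
      ... | no none = trans (cong (λ z → z * z) zer) (sym zer)
        where
        term : ∀ l → e k l * e l j ≡ + 0
        term l with A k l in Akl | A l j in Alj
        ... | false | _     = refl
        ... | true  | false = refl
        ... | true  | true  = contradiction (l , Akl , Alj) none
        zer : walks k j ≡ + 0
        zer = ∑-0 term

      L² : ∀ k j → (L · L) k j ≡ (δ k j * (d k * d k) - (d k + d j) * e k j) + walks k j
      L² k j = begin
        ∑ (λ l → L k l * L l j)
          ≡⟨ ∑-cong (λ l → trans (cong₂ _*_ (laplacian-δ A simple k l) (laplacian-δ A simple l j)) (expand (δ k l) (d k) (e k l) (δ l j) (d l) (e l j))) ⟩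
        ∑ (λ l → (δ k l * (d k * (δ l j * d l - e l j)) - δ l j * (e k l * d l)) + e k l * e l j)
          ≡⟨ ∑-+ (λ l → δ k l * (d k * (δ l j * d l - e l j)) - δ l j * (e k l * d l)) (λ l → e k l * e l j) ⟩
        ∑ (λ l → δ k l * (d k * (δ l j * d l - e l j)) - δ l j * (e k l * d l)) + walks k j
          ≡⟨ cong (λ z → z + walks k j) (∑-- (λ l → δ k l * (d k * (δ l j * d l - e l j))) (λ l → δ l j * (e k l * d l))) ⟩
        (∑ (λ l → δ k l * (d k * (δ l j * d l - e l j))) - ∑ (λ l → δ l j * (e k l * d l))) + walks k j
          ≡⟨ cong₂ (λ y z → (y - z) + walks k j) (∑-δ k (λ l → d k * (δ l j * d l - e l j)))
               (trans (∑-cong λ l → cong (_* (e k l * d l)) (δ-sym l j)) (∑-δ j (λ l → e k l * d l))) ⟩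
        (d k * (δ k j * d k - e k j) - e k j * d j) + walks k j
          ≡⟨ cong (λ z → z + walks k j) (regroup (d k) (δ k j) (e k j) (d j)) ⟩
        (δ k j * (d k * d k) - (d k + d j) * e k j) + walks k j ∎
        where
        open ≡-Reasoning
        expand : ∀ p d e q c f → (p * d - e) * (q * c - f) ≡ (p * (d * (q * c - f)) - q * (e * c)) + e * f
        expand = solve-∀
        regroup : ∀ d p e c → d * (p * d - e) - e * c ≡ p * (d * d) - (d + c) * e
        regroup = solve-∀

      L²-diag : ∀ k → (L · L) k k ≡ d k * d k + d k
      L²-diag k = trans (L² k k) (trans (cong₂ (λ y z → (y * (d k * d k) - (d k + d k) * z) + walks k k) (δ-refl k) (a-diag k))
        (trans (cong (λ z → (+ 1 * (d k * d k) - (d k + d k) * + 0) + z) (walks-diag k)) (regroup (d k))))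
        where
        regroup : ∀ x → (+ 1 * (x * x) - (x + x) * + 0) + x ≡ x * x + x
        regroup = solve-∀

      L-sym : ∀ i j → L i j ≡ L j i
      L-sym i j = trans (laplacian-δ A simple i j) (trans same (sym (laplacian-δ A simple j i)))
        where
        same : δ i j * d i - e i j ≡ δ j i * d j - e j i
        same with i ≟ j
        ... | yes refl = cong (λ z → z * d i - e i i) (sym (δ-refl i))
        ... | no  i≢j  = cong₂ _-_ (sym (cong (_* d j) (δ-≢ (i≢j ∘ sym)))) (a-sym A simple i j)

      L²-sym : ∀ k j → (L · L) k j ≡ (L · L) j k
      L²-sym k j = ∑-cong λ l → trans (*-comm (L k l) (L l j)) (cong₂ _*_ (L-sym l j) (L-sym k l))

    ∑-edges-left : (f : Fin m → ℤ) → ∑ (λ k → ∑ λ j → f k * e k j) ≡ ∑ (λ k → f k * d k)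
    ∑-edges-left f = ∑-cong λ k → trans (∑-* (f k) (e k)) (cong (f k *_) (sym (deg-∑ A k)))

    ∑-edges-right : (f : Fin m → ℤ) → ∑ (λ k → ∑ λ j → f j * e k j) ≡ ∑ (λ k → f k * d k)
    ∑-edges-right f = trans (∑-swap (λ k j → f j * e k j)) (trans (∑-cong λ j → ∑-cong λ k → cong (f j *_) (a-sym A simple k j)) (∑-edges-left f))

    trace-2 : power-trace L 2 ≡ ∑ (λ k → d k * d k + d k)
    trace-2 = ∑-cong λ k → trans (·-cong L (·-δ L) k k) (L²-diag k)

    -- Entrywise pairing of L with L². In a general graph six times the number of triangles would be
    -- subtracted; here `walks-a` makes the products of A with A² vanish.
    trace-3 : power-trace L 3 ≡ ∑ (λ k → d k * d k * d k + + 3 * (d k * d k))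
    trace-3 = begin
      ∑ (λ k → (L · (L · (L · δ))) k k)
        ≡⟨ ∑-cong (λ k → ·-cong L (·-cong L (·-δ L)) k k) ⟩
      ∑ (λ k → ∑ λ l → L k l * (L · L) l k)
        ≡⟨ ∑-cong (λ k → ∑-cong λ l → trans (cong₂ _*_ (laplacian-δ A simple k l) (L²-sym l k)) (term k l)) ⟩
      ∑ (λ k → ∑ λ l → (δ k l * (d k * (L · L) k l) + d k * e k l) + d l * e k l)
        ≡⟨ ∑-cong (λ k → ∑-+ (λ l → δ k l * (d k * (L · L) k l) + d k * e k l) (λ l → d l * e k l)) ⟩
      ∑ (λ k → ∑ (λ l → δ k l * (d k * (L · L) k l) + d k * e k l) + ∑ (λ l → d l * e k l))
        ≡⟨ ∑-+ (λ k → ∑ (λ l → δ k l * (d k * (L · L) k l) + d k * e k l)) (λ k → ∑ (λ l → d l * e k l)) ⟩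
      ∑ (λ k → ∑ (λ l → δ k l * (d k * (L · L) k l) + d k * e k l)) + ∑ (λ k → ∑ (λ l → d l * e k l))
        ≡⟨ cong₂ _+_ (∑-cong λ k → trans (∑-+ (λ l → δ k l * (d k * (L · L) k l)) (λ l → d k * e k l))
             (cong (λ z → z + ∑ (λ l → d k * e k l)) (trans (∑-δ k (λ l → d k * (L · L) k l)) (cong (d k *_) (L²-diag k))))) (∑-edges-right d) ⟩
      ∑ (λ k → d k * (d k * d k + d k) + ∑ (λ l → d k * e k l)) + ∑ (λ k → d k * d k)
        ≡⟨ cong (λ z → z + ∑ (λ k → d k * d k)) (trans (∑-+ (λ k → d k * (d k * d k + d k)) (λ k → ∑ (λ l → d k * e k l)))
             (cong (λ z → ∑ (λ k → d k * (d k * d k + d k)) + z) (∑-edges-left d))) ⟩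
      (∑ (λ k → d k * (d k * d k + d k)) + ∑ (λ k → d k * d k)) + ∑ (λ k → d k * d k)
        ≡⟨ cong (λ z → z + ∑ (λ k → d k * d k)) (sym (∑-+ (λ k → d k * (d k * d k + d k)) (λ k → d k * d k))) ⟩
      ∑ (λ k → d k * (d k * d k + d k) + d k * d k) + ∑ (λ k → d k * d k)
        ≡⟨ ∑-+ (λ k → d k * (d k * d k + d k) + d k * d k) (λ k → d k * d k) ⟨
      ∑ (λ k → (d k * (d k * d k + d k) + d k * d k) + d k * d k)
        ≡⟨ ∑-cong (λ k → regroup (d k)) ⟩
      ∑ (λ k → d k * d k * d k + + 3 * (d k * d k)) ∎
      where
      open ≡-Reasoning
      regroup : ∀ x → (x * (x * x + x) + x * x) + x * x ≡ x * x * x + + 3 * (x * x)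
      regroup = solve-∀
      term : ∀ k l → (δ k l * d k - e k l) * (L · L) k l ≡ (δ k l * (d k * (L · L) k l) + d k * e k l) + d l * e k l
      term k l = begin
        (δ k l * d k - e k l) * (L · L) k l
          ≡⟨ expand (δ k l) (d k) (e k l) ((L · L) k l) ⟩
        δ k l * (d k * (L · L) k l) - e k l * (L · L) k l
          ≡⟨ cong (λ z → δ k l * (d k * (L · L) k l) - z) (begin
            e k l * (L · L) k l
              ≡⟨ cong (e k l *_) (L² k l) ⟩
            e k l * ((δ k l * (d k * d k) - (d k + d l) * e k l) + walks k l)
              ≡⟨ expand₂ (e k l) (δ k l) (d k) (d l) (walks k l) ⟩
            (δ k l * e k l * (d k * d k) - (d k + d l) * (e k l * e k l)) + walks k l * e k l
              ≡⟨ cong₂ (λ y z → (y * (d k * d k) - (d k + d l) * (e k l * e k l)) + z) (δ-a k l) (walks-a k l) ⟩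
            (+ 0 * (d k * d k) - (d k + d l) * (e k l * e k l)) + + 0
              ≡⟨ cong (λ z → (+ 0 * (d k * d k) - (d k + d l) * z) + + 0) (a-idem k l) ⟩
            (+ 0 * (d k * d k) - (d k + d l) * e k l) + + 0 ∎) ⟩
        δ k l * (d k * (L · L) k l) - ((+ 0 * (d k * d k) - (d k + d l) * e k l) + + 0)
          ≡⟨ collect (δ k l * (d k * (L · L) k l)) (d k) (d l) (e k l) ⟩
        (δ k l * (d k * (L · L) k l) + d k * e k l) + d l * e k l ∎
        where
        expand : ∀ p d e s → (p * d - e) * s ≡ p * (d * s) - e * s
        expand = solve-∀
        expand₂ : ∀ e p d c w → e * ((p * (d * d) - (d + c) * e) + w) ≡ (p * e * (d * d) - (d + c) * (e * e)) + w * e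
        expand₂ = solve-∀
        collect : ∀ s d c e → s - ((+ 0 * (d * d) - (d + c) * e) + + 0) ≡ (s + d * e) + c * e
        collect = solve-∀
        δ-a : ∀ k l → δ k l * e k l ≡ + 0
        δ-a k l with k ≟ l
        ... | yes refl = trans (*-identityˡ (e k k)) (a-diag k)
        ... | no  _    = refl

    -- By symmetry this is the sum of the squared entries of L². Off the diagonal the mixed term
    -- vanishes as there are no triangles, and A² equals its entrywise square as there are no
    -- 4-cycles. The double sum runs over ordered pairs, so each edge occurs twice.
    trace-4 : power-trace L 4 ≡ ∑ (λ k → d k * d k * d k * d k + + 4 * (d k * d k * d k) + + 2 * (d k * d k) - d k)
                                + + 2 * ∑ (λ k → ∑ λ j → d k * d j * e k j)
    trace-4 = begin
      ∑ (λ k → (L · (L · (L · (L · δ)))) k k)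
        ≡⟨ ∑-cong (λ k → trans (·-cong L (·-cong L (·-cong L (·-δ L))) k k) (·-assoc L L (L · L) k k)) ⟩
      ∑ (λ k → ∑ λ j → (L · L) k j * (L · L) j k)
        ≡⟨ ∑-cong (λ k → ∑-cong λ j → trans (cong ((L · L) k j *_) (L²-sym j k)) (square k j)) ⟩
      ∑ (λ k → ∑ λ j → δ k j * f k + (g k j + walks k j))
        ≡⟨ ∑-cong (λ k → trans (∑-+ (λ j → δ k j * f k) (λ j → g k j + walks k j)) (cong₂ _+_ (∑-δ k (λ _ → f k)) (∑-+ (g k) (walks k)))) ⟩
      ∑ (λ k → f k + (∑ (g k) + ∑ (walks k)))
        ≡⟨ trans (∑-+ f (λ k → ∑ (g k) + ∑ (walks k))) (cong (λ z → ∑ f + z) (∑-+ (λ k → ∑ (g k)) (λ k → ∑ (walks k)))) ⟩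
      ∑ f + (∑ (λ k → ∑ (g k)) + ∑ (λ k → ∑ (walks k)))
        ≡⟨ cong₂ (λ y z → ∑ f + (y + z)) ∑g ∑walks ⟩
      ∑ f + ((∑ (λ k → d k * d k * d k) + ∑ (λ k → d k * d k * d k) + + 2 * X) + ∑ (λ k → d k * d k))
        ≡⟨ collect (∑ f) (∑ (λ k → d k * d k * d k)) X (∑ (λ k → d k * d k)) ⟩
      (∑ f + + 2 * ∑ (λ k → d k * d k * d k) + + 1 * ∑ (λ k → d k * d k)) + + 2 * X
        ≡⟨ cong (λ z → z + + 2 * X) (begin
          ∑ f + + 2 * ∑ (λ k → d k * d k * d k) + + 1 * ∑ (λ k → d k * d k)
            ≡⟨ cong (λ z → z + + 1 * ∑ (λ k → d k * d k)) (sym (∑-linear (+ 2) f (λ k → d k * d k * d k))) ⟩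
          ∑ (λ k → f k + + 2 * (d k * d k * d k)) + + 1 * ∑ (λ k → d k * d k)
            ≡⟨ sym (∑-linear (+ 1) (λ k → f k + + 2 * (d k * d k * d k)) (λ k → d k * d k)) ⟩
          ∑ (λ k → f k + + 2 * (d k * d k * d k) + + 1 * (d k * d k))
            ≡⟨ ∑-cong (λ k → regroup (d k)) ⟩
          ∑ (λ k → d k * d k * d k * d k + + 4 * (d k * d k * d k) + + 2 * (d k * d k) - d k) ∎) ⟩
      ∑ (λ k → d k * d k * d k * d k + + 4 * (d k * d k * d k) + + 2 * (d k * d k) - d k) + + 2 * X ∎
      where
      open ≡-Reasoning
      -- The diagonal entry of L² is d² + d. The summand -d compensates for the diagonal of `walks`,
      -- which lets `walks` be summed over all pairs at once.
      f : Fin m → ℤ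
      f k = d k * d k * d k * d k + + 2 * (d k * d k * d k) + d k * d k - d k
      g : Fin m → Fin m → ℤ
      g k j = (d k + d j) * (d k + d j) * e k j
      X = ∑ (λ k → ∑ λ j → d k * d j * e k j)
      regroup : ∀ x → (x * x * x * x + + 2 * (x * x * x) + x * x - x) + + 2 * (x * x * x) + + 1 * (x * x)
                      ≡ x * x * x * x + + 4 * (x * x * x) + + 2 * (x * x) - x
      regroup = solve-∀
      collect : ∀ f c x s → f + ((c + c + + 2 * x) + s) ≡ (f + + 2 * c + + 1 * s) + + 2 * x
      collect = solve-∀
      square : ∀ k j → (L · L) k j * (L · L) k j ≡ δ k j * f k + (g k j + walks k j)
      square k j with k ≟ j
      ... | yes refl = trans (cong (λ z → z * z) (L²-diag k)) (trans (expand (d k))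
            (cong₂ (λ y z → + 1 * f k + ((d k + d k) * (d k + d k) * y + z)) (sym (a-diag k)) (sym (walks-diag k))))
        where
        expand : ∀ x → (x * x + x) * (x * x + x) ≡ + 1 * (x * x * x * x + + 2 * (x * x * x) + x * x - x) + ((x + x) * (x + x) * + 0 + x)
        expand = solve-∀
      ... | no  k≢j  = begin
        (L · L) k j * (L · L) k j
          ≡⟨ cong (λ z → z * z) (trans (L² k j) (cong (λ z → (z * (d k * d k) - (d k + d j) * e k j) + walks k j) (δ-≢ k≢j))) ⟩
        ((+ 0 * (d k * d k) - s * e k j) + walks k j) * ((+ 0 * (d k * d k) - s * e k j) + walks k j)
          ≡⟨ expand (d k * d k) s (e k j) (walks k j) ⟩
        (s * s * (e k j * e k j) - + 2 * s * (walks k j * e k j)) + walks k j * walks k j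
          ≡⟨ cong₂ (λ y z → (s * s * y - + 2 * s * z) + walks k j * walks k j) (a-idem k j) (walks-a k j) ⟩
        (s * s * e k j - + 2 * s * + 0) + walks k j * walks k j
          ≡⟨ cong (λ z → (s * s * e k j - + 2 * s * + 0) + z) (walks-0-1 k≢j) ⟩
        (s * s * e k j - + 2 * s * + 0) + walks k j
          ≡⟨ tidy s (e k j) (f k) (walks k j) ⟩
        + 0 * f k + (g k j + walks k j) ∎
        where
        s = d k + d j
        expand : ∀ q s e w → ((+ 0 * q - s * e) + w) * ((+ 0 * q - s * e) + w) ≡ (s * s * (e * e) - + 2 * s * (w * e)) + w * w
        expand = solve-∀
        tidy : ∀ s e f w → (s * s * e - + 2 * s * + 0) + w ≡ + 0 * f + (s * s * e + w)
        tidy = solve-∀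
      ∑g : ∑ (λ k → ∑ (g k)) ≡ ∑ (λ k → d k * d k * d k) + ∑ (λ k → d k * d k * d k) + + 2 * X
      ∑g = begin
        ∑ (λ k → ∑ (g k))
          ≡⟨ ∑-cong (λ k → trans (∑-cong λ j → expand (d k) (d j) (e k j)) (trans (∑-linear (+ 2) (λ j → d k * d k * e k j + d j * d j * e k j) (λ j → d k * d j * e k j))
               (cong (λ z → z + + 2 * ∑ (λ j → d k * d j * e k j)) (∑-+ (λ j → d k * d k * e k j) (λ j → d j * d j * e k j))))) ⟩
        ∑ (λ k → (∑ (λ j → d k * d k * e k j) + ∑ (λ j → d j * d j * e k j)) + + 2 * ∑ (λ j → d k * d j * e k j))
          ≡⟨ trans (∑-linear (+ 2) (λ k → ∑ (λ j → d k * d k * e k j) + ∑ (λ j → d j * d j * e k j)) (λ k → ∑ (λ j → d k * d j * e k j)))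
               (cong (λ z → z + + 2 * X) (∑-+ (λ k → ∑ (λ j → d k * d k * e k j)) (λ k → ∑ (λ j → d j * d j * e k j)))) ⟩
        ∑ (λ k → ∑ (λ j → d k * d k * e k j)) + ∑ (λ k → ∑ (λ j → d j * d j * e k j)) + + 2 * X
          ≡⟨ cong₂ (λ y z → y + z + + 2 * X) (∑-edges-left (λ k → d k * d k)) (∑-edges-right (λ k → d k * d k)) ⟩
        ∑ (λ k → d k * d k * d k) + ∑ (λ k → d k * d k * d k) + + 2 * X ∎
        where
        expand : ∀ x y e → (x + y) * (x + y) * e ≡ (x * x * e + y * y * e) + + 2 * (x * y * e)
        expand = solve-∀
      ∑walks : ∑ (λ k → ∑ (walks k)) ≡ ∑ (λ k → d k * d k)
      ∑walks = begin
        ∑ (λ k → ∑ λ j → ∑ λ l → e k l * e l j)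
          ≡⟨ ∑-cong (λ k → trans (∑-swap (λ j l → e k l * e l j)) (∑-cong λ l → trans (∑-* (e k l) (e l)) (trans (cong (e k l *_) (sym (deg-∑ A l))) (*-comm (e k l) (d l))))) ⟩
        ∑ (λ k → ∑ λ l → d l * e k l)
          ≡⟨ ∑-edges-right d ⟩
        ∑ (λ k → d k * d k) ∎

  ∑-quartic : ∀ {m} c₀ c₁ c₂ c₃ c₄ (x : Fin m → ℤ) →
    ∑ (λ i → c₀ + c₁ * x i + c₂ * (x i * x i) + c₃ * (x i * x i * x i) + c₄ * (x i * x i * x i * x i)) ≡
    c₀ * + m + c₁ * ∑ x + c₂ * ∑ (λ i → x i * x i) + c₃ * ∑ (λ i → x i * x i * x i) + c₄ * ∑ (λ i → x i * x i * x i * x i)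
  ∑-quartic {m} c₀ c₁ c₂ c₃ c₄ x =
    trans (∑-linear c₄ (λ i → c₀ + c₁ * x i + c₂ * (x i * x i) + c₃ * (x i * x i * x i)) (λ i → x i * x i * x i * x i)) (cong (λ z → z + c₄ * ∑ (λ i → x i * x i * x i * x i))
    (trans (∑-linear c₃ (λ i → c₀ + c₁ * x i + c₂ * (x i * x i)) (λ i → x i * x i * x i)) (cong (λ z → z + c₃ * ∑ (λ i → x i * x i * x i))
    (trans (∑-linear c₂ (λ i → c₀ + c₁ * x i) (λ i → x i * x i)) (cong (λ z → z + c₂ * ∑ (λ i → x i * x i))
    (trans (∑-linear c₁ (λ _ → c₀) x) (cong (λ z → z + c₁ * ∑ x) (trans (∑-const m c₀) (*-comm (+ m) c₀)))))))))

-- The tree H(p,n,q): rooted structure, degrees and power sums.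

module DoubleBroom where

  open import Data.Bool using (Bool; true; false; if_then_else_; _∧_; _∨_)
  open import Data.Bool.Properties using (∨-comm; ∨-assoc; T-≡)
  open import Data.Fin as Fin using (Fin; zero; suc; _≟_; toℕ; fromℕ<)
  open import Data.Fin.Properties using (toℕ-fromℕ<; toℕ-injective; toℕ<n)
  open import Data.Integer using (ℤ; +_; -_; _+_; _*_; _-_)
  open import Data.Integer.Properties hiding (_≟_; _<?_; _≤?_)
  open import Data.Integer.Tactic.RingSolver using (solve-∀)
  open import Data.Nat as ℕ using (ℕ; zero; suc; pred; _<ᵇ_; _≡ᵇ_; _∸_; z≤n; s≤s; _<?_)
  import Data.Nat.Properties as ℕₚ
  open import Data.Product using (_×_; _,_)
  open import Data.Sum using (_⊎_; inj₁; inj₂)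
  open import Function using (_∘_)
  open import Function.Bundles using (Equivalence)
  open import Relation.Binary.PropositionalEquality hiding ([_])
  open import Relation.Nullary using (yes; no; contradiction)

  open import Defs using (IsSimple; laplacian; H; HEdgeℕ)
  open Series
  open CharPoly
  open Graph
  open ℤ-Det using (∑-cong; ∑-+; ∑-*; ∑-0; ∑-swap; ∑-neg; ∑-suc)

  <ᵇ-true : ∀ {m n} → m ℕ.< n → (m <ᵇ n) ≡ true
  <ᵇ-true m<n = Equivalence.to T-≡ (ℕₚ.<⇒<ᵇ m<n)

  <ᵇ-true⁻¹ : ∀ m n → (m <ᵇ n) ≡ true → m ℕ.< n
  <ᵇ-true⁻¹ m n e = ℕₚ.<ᵇ⇒< m n (Equivalence.from T-≡ e)

  <ᵇ-false : ∀ {m n} → n ℕ.≤ m → (m <ᵇ n) ≡ false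
  <ᵇ-false {m} {n} n≤m with m <ᵇ n in e
  ... | false = refl
  ... | true  = contradiction (<ᵇ-true⁻¹ m n e) (ℕₚ.≤⇒≯ n≤m)

  <ᵇ-false⁻¹ : ∀ m n → (m <ᵇ n) ≡ false → n ℕ.≤ m
  <ᵇ-false⁻¹ m n e = ℕₚ.≮⇒≥ λ m<n → contradiction (trans (sym (<ᵇ-true m<n)) e) λ ()

  ≡ᵇ-true : ∀ {m n} → m ≡ n → (m ≡ᵇ n) ≡ true
  ≡ᵇ-true {m} {n} e = Equivalence.to T-≡ (ℕₚ.≡⇒≡ᵇ m n e)

  ≡ᵇ-true⁻¹ : ∀ m n → (m ≡ᵇ n) ≡ true → m ≡ n
  ≡ᵇ-true⁻¹ m n e = ℕₚ.≡ᵇ⇒≡ m n (Equivalence.from T-≡ e)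

  ≡ᵇ-false : ∀ {m n} → m ≢ n → (m ≡ᵇ n) ≡ false
  ≡ᵇ-false {m} {n} m≢n with m ≡ᵇ n in e
  ... | false = refl
  ... | true  = contradiction (≡ᵇ-true⁻¹ m n e) m≢n

  ∧-true : ∀ {b c} → b ∧ c ≡ true → b ≡ true × c ≡ true
  ∧-true {true} {true} refl = refl , refl

  ∨-true : ∀ {b c} → b ∨ c ≡ true → b ≡ true ⊎ c ≡ true
  ∨-true {true}  _ = inj₁ refl
  ∨-true {false} e = inj₂ e

  ∨-trueˡ : ∀ {b} c → b ≡ true → b ∨ c ≡ true
  ∨-trueˡ c refl = refl

  ∨-trueʳ : ∀ b {c} → c ≡ true → b ∨ c ≡ true
  ∨-trueʳ true  refl = refl
  ∨-trueʳ false refl = refl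

  ∑< : ℕ → (ℕ → ℤ) → ℤ
  ∑< zero    f = + 0
  ∑< (suc n) f = f 0 + ∑< n (f ∘ suc)

  ∑-toℕ : ∀ n (f : ℕ → ℤ) → ∑ {n} (f ∘ toℕ) ≡ ∑< n f
  ∑-toℕ zero    f = ℤ-Det.∑-zero _
  ∑-toℕ (suc n) f = trans (∑-suc _) (cong (λ z → f 0 + z) (∑-toℕ n (f ∘ suc)))

  ∑<-cong : ∀ n {f g : ℕ → ℤ} → (∀ j → j ℕ.< n → f j ≡ g j) → ∑< n f ≡ ∑< n g
  ∑<-cong zero    h = refl
  ∑<-cong (suc n) h = cong₂ _+_ (h 0 (s≤s z≤n)) (∑<-cong n λ j j<n → h (suc j) (s≤s j<n))

  ∑<-const : ∀ n c → ∑< n (λ _ → c) ≡ + n * c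
  ∑<-const zero    c = refl
  ∑<-const (suc n) c = trans (cong (λ z → c + z) (∑<-const n c)) (sym (suc-* (+ n) c))

  ∑<-split : ∀ m n (f : ℕ → ℤ) → ∑< (m ℕ.+ n) f ≡ ∑< m f + ∑< n (λ j → f (m ℕ.+ j))
  ∑<-split zero    n f = sym (+-identityˡ _)
  ∑<-split (suc m) n f = trans (cong (λ z → f 0 + z) (∑<-split m n (f ∘ suc))) (sym (+-assoc (f 0) _ _))

  ∑<-last : ∀ n (f : ℕ → ℤ) → ∑< (suc n) f ≡ ∑< n f + f n
  ∑<-last zero    f = trans (+-identityʳ (f 0)) (sym (+-identityˡ (f 0)))
  ∑<-last (suc n) f = trans (cong (λ z → f 0 + z) (∑<-last n (f ∘ suc))) (sym (+-assoc (f 0) _ _))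

  ∑<-indicator : ∀ n i → ∑< n (λ j → ⟦ j ≡ᵇ i ⟧) ≡ ⟦ i <ᵇ n ⟧
  ∑<-indicator zero    i       = refl
  ∑<-indicator (suc n) zero    = cong (λ z → + 1 + z) (trans (∑<-cong n λ _ _ → refl) (trans (∑<-const n (+ 0)) (*-zeroʳ (+ n))))
  ∑<-indicator (suc n) (suc i) = trans (+-identityˡ _) (∑<-indicator n i)

  -- Rooted at label 0, one end of the path. For n ≥ 1 every other label then exceeds that of its
  -- parent, as the determinant argument behind `H-χ-at-1` demands.
  parentℕ : (p n : ℕ) → ℕ → ℕ
  parentℕ p n a = if a <ᵇ n then pred a else (if a <ᵇ n ℕ.+ p then 0 else n ∸ 1)

  parentℕ-path : ∀ p n {a} → a ℕ.< n → parentℕ p n a ≡ pred a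
  parentℕ-path p n a<n rewrite <ᵇ-true a<n = refl

  parentℕ-P : ∀ p n {a} → n ℕ.≤ a → a ℕ.< n ℕ.+ p → parentℕ p n a ≡ 0
  parentℕ-P p n n≤a a<n+p rewrite <ᵇ-false n≤a | <ᵇ-true a<n+p = refl

  parentℕ-Q : ∀ p n {a} → n ℕ.+ p ℕ.≤ a → parentℕ p n a ≡ n ∸ 1
  parentℕ-Q p n n+p≤a rewrite <ᵇ-false (ℕₚ.≤-trans (ℕₚ.m≤m+n n p) n+p≤a) | <ᵇ-false n+p≤a = refl

  parentℕ-< : ∀ p n a → parentℕ p (suc n) (suc a) ℕ.< suc a
  parentℕ-< p n a with suc a <? suc n
  ... | yes a<n rewrite parentℕ-path p (suc n) a<n = ℕₚ.≤-refl
  ... | no  a≮n with suc a <? suc n ℕ.+ p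
  ...   | yes a<n+p rewrite parentℕ-P p (suc n) (ℕₚ.≮⇒≥ a≮n) a<n+p = s≤s z≤n
  ...   | no  a≮n+p rewrite parentℕ-Q p (suc n) {suc a} (ℕₚ.≮⇒≥ a≮n+p) = ℕₚ.≮⇒≥ a≮n

  module _ (p n′ q : ℕ) where

    private
      n = suc n′
      N = n ℕ.+ p ℕ.+ q

      -- These four restate the local functions of `HEdgeℕ`, with which they agree by computation,
      -- so that the lemmas can refer to them.
      path : ℕ → ℕ → Bool
      path x y = (suc x <ᵇ n) ∧ (y ≡ᵇ suc x)
      inP : ℕ → Bool
      inP x = (x <ᵇ n ℕ.+ p) ∧ (if x <ᵇ n then false else true)
      inQ : ℕ → Bool
      inQ x = (x <ᵇ n ℕ.+ p ℕ.+ q) ∧ (if x <ᵇ n ℕ.+ p then false else true)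
      pend : ℕ → ℕ → Bool
      pend x y = (inP x ∧ (y ≡ᵇ 0)) ∨ (inQ x ∧ (y ≡ᵇ n ∸ 1))

      not-true : ∀ {b} → (if b then false else true) ≡ true → b ≡ false
      not-true {false} _ = refl

      path-sound : ∀ x y → path x y ≡ true → y ≢ 0 × parentℕ p n y ≡ x
      path-sound x y h with ∧-true {suc x <ᵇ n} h
      ... | lt , eq with ≡ᵇ-true⁻¹ y (suc x) eq
      ...   | refl = (λ ()) , parentℕ-path p n (<ᵇ-true⁻¹ (suc x) n lt)

      pend-sound : ∀ x y → pend x y ≡ true → x ≢ 0 × parentℕ p n x ≡ y
      pend-sound x y h with ∨-true {inP x ∧ (y ≡ᵇ 0)} h
      ... | inj₁ h₁ with ∧-true {inP x} h₁
      ...   | in-P , eq with ∧-true {x <ᵇ n ℕ.+ p} in-P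
      ...     | lt , ge = (λ { refl → contradiction ge λ () })
                        , trans (parentℕ-P p n (<ᵇ-false⁻¹ x n (not-true ge)) (<ᵇ-true⁻¹ x _ lt)) (sym (≡ᵇ-true⁻¹ y 0 eq))
      pend-sound x y h | inj₂ h₂ with ∧-true {inQ x} h₂
      ...   | in-Q , eq with ∧-true {x <ᵇ n ℕ.+ p ℕ.+ q} in-Q
      ...     | lt , ge = (λ { refl → contradiction ge λ () })
                        , trans (parentℕ-Q p n {x} (<ᵇ-false⁻¹ x _ (not-true ge))) (sym (≡ᵇ-true⁻¹ y (n ∸ 1) eq))

    HEdge-sound : ∀ a b → HEdgeℕ p n q a b ≡ true → (a ≢ 0 × parentℕ p n a ≡ b) ⊎ (b ≢ 0 × parentℕ p n b ≡ a)
    HEdge-sound a b h with ∨-true {path a b} h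
    ... | inj₁ h₁ = inj₂ (path-sound a b h₁)
    ... | inj₂ h₂ with ∨-true {path b a} h₂
    ...   | inj₁ h₃ = inj₁ (path-sound b a h₃)
    ...   | inj₂ h₄ with ∨-true {pend a b} h₄
    ...     | inj₁ h₅ = inj₁ (pend-sound a b h₅)
    ...     | inj₂ h₆ = inj₂ (pend-sound b a h₆)

    HEdge-parent : ∀ a → a ≢ 0 → a ℕ.< N → HEdgeℕ p n q a (parentℕ p n a) ≡ true
    HEdge-parent zero    a≢0 _ = contradiction refl a≢0
    HEdge-parent (suc a) _ a<N with suc a <? n
    ... | yes a<n rewrite parentℕ-path p n a<n = ∨-trueʳ (path (suc a) a) (∨-trueˡ _ (cong₂ _∧_ (<ᵇ-true a<n) (≡ᵇ-true {suc a} refl)))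
    ... | no  a≮n with suc a <? n ℕ.+ p
    ...   | yes a<n+p rewrite parentℕ-P p n (ℕₚ.≮⇒≥ a≮n) a<n+p =
            ∨-trueʳ (path (suc a) 0) (∨-trueʳ (path 0 (suc a)) (∨-trueˡ _ (∨-trueˡ _ (cong₂ _∧_
              (cong₂ _∧_ (<ᵇ-true a<n+p) (cong (if_then false else true) (<ᵇ-false (ℕₚ.≮⇒≥ a≮n)))) refl))))
    ...   | no  a≮n+p rewrite parentℕ-Q p n {suc a} (ℕₚ.≮⇒≥ a≮n+p) =
            ∨-trueʳ (path (suc a) n′) (∨-trueʳ (path n′ (suc a)) (∨-trueˡ _ (∨-trueʳ (inP (suc a) ∧ (n′ ≡ᵇ 0)) (cong₂ _∧_
              (cong₂ _∧_ (<ᵇ-true a<N) (cong (if_then false else true) (<ᵇ-false (ℕₚ.≮⇒≥ a≮n+p)))) (≡ᵇ-true {n′} refl)))))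

    HEdge-sym : ∀ a b → HEdgeℕ p n q a b ≡ HEdgeℕ p n q b a
    HEdge-sym a b = trans (sym (∨-assoc (path a b) (path b a) _)) (trans (cong₂ _∨_ (∨-comm (path a b) (path b a)) (∨-comm (pend a b) (pend b a)))
      (∨-assoc (path b a) (path a b) _))

    H-simple : IsSimple (H p n q)
    H-simple = (λ i j → HEdge-sym (toℕ i) (toℕ j)) , λ i → irr (toℕ i)
      where
      loop : ∀ a → a ≢ 0 → parentℕ p n a ≢ a
      loop zero    a≢0 _ = a≢0 refl
      loop (suc a) _   e = ℕₚ.<⇒≢ (parentℕ-< p n′ a) e
      irr : ∀ a → HEdgeℕ p n q a a ≡ false
      irr a with HEdgeℕ p n q a a in h
      ... | false = refl
      ... | true with HEdge-sound a a h
      ...   | inj₁ (a≢0 , e) = contradiction e (loop a a≢0)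
      ...   | inj₂ (a≢0 , e) = contradiction e (loop a a≢0)

    parentℕ-<N : ∀ a → a ℕ.< N → parentℕ p n a ℕ.< N
    parentℕ-<N zero    0<N = 0<N
    parentℕ-<N (suc a) a<N = ℕₚ.<-trans (parentℕ-< p n′ a) a<N

    parent : Fin N → Fin N
    parent i = fromℕ< (parentℕ-<N (toℕ i) (toℕ<n i))

    toℕ-parent : ∀ i → toℕ (parent i) ≡ parentℕ p n (toℕ i)
    toℕ-parent i = toℕ-fromℕ< _

    private
      nonzero : ∀ {i : Fin N} → i ≢ zero → toℕ i ≢ 0
      nonzero i≢0 e = i≢0 (toℕ-injective e)

    parent-< : ∀ {i : Fin N} → i ≢ zero → toℕ (parent i) ℕ.< toℕ i
    parent-< {zero}  i≢0 = contradiction refl i≢0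
    parent-< {suc i} _   = subst (ℕ._< suc (toℕ i)) (sym (toℕ-parent (suc i))) (parentℕ-< p n′ (toℕ i))

    H-tree : RootedTree (H p n q) zero
    H-tree = record
      { spanning = record
        { par = parent ; rk = toℕ ; rk-par = parent-<
        ; edge = λ {i} i≢0 → trans (cong (HEdgeℕ p n q (toℕ i)) (toℕ-parent i)) (HEdge-parent (toℕ i) (nonzero i≢0) (toℕ<n i)) }
      ; edge⁻¹ = λ {i} {j} → edge⁻¹ i j }
      where
      edge⁻¹ : ∀ i j → H p n q i j ≡ true → (i ≢ zero × parent i ≡ j) ⊎ (j ≢ zero × parent j ≡ i)
      edge⁻¹ i j h with HEdge-sound (toℕ i) (toℕ j) h
      ... | inj₁ (i≢0 , e) = inj₁ ((λ { refl → i≢0 refl }) , toℕ-injective (trans (toℕ-parent i) e))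
      ... | inj₂ (j≢0 , e) = inj₂ ((λ { refl → j≢0 refl }) , toℕ-injective (trans (toℕ-parent j) e))

    H-χ-at-1 : χ (laplacian (H p n q)) 1 ≢ + 0
    H-χ-at-1 = increasing-tree-χ-at-1 (H p n q) H-simple H-tree λ w → parent-< {suc w} λ ()

    -- degree minus one
    excessℕ : ℕ → ℤ
    excessℕ i = (⟦ i <ᵇ n′ ⟧ - ⟦ 0 ≡ᵇ i ⟧) + + p * ⟦ 0 ≡ᵇ i ⟧ + + q * ⟦ n′ ≡ᵇ i ⟧

    private
      arcℕ : ℕ → ℕ → ℤ
      arcℕ zero    i = + 0
      arcℕ (suc j) i = ⟦ parentℕ p n (suc j) ≡ᵇ i ⟧

      arc-toℕ : ∀ j i → arc (H p n q) zero parent j i ≡ arcℕ (toℕ j) (toℕ i)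
      arc-toℕ zero    i = refl
      arc-toℕ (suc j) i with parent (suc j) ≟ i
      ... | yes refl = cong ⟦_⟧ (sym (≡ᵇ-true (sym (toℕ-parent (suc j)))))
      ... | no  ≢i   = cong ⟦_⟧ (sym (≡ᵇ-false λ e → ≢i (toℕ-injective (trans (toℕ-parent (suc j)) e))))

      -- Every nonzero label is the child in exactly one arc, so a sum over the edges splits into
      -- the path, the pendants at 0 and the pendants at n′.
      ∑-children : (g : ℕ → ℕ → ℤ) → ∑< (n′ ℕ.+ p ℕ.+ q) (λ j → g (suc j) (parentℕ p n (suc j)))
        ≡ ∑< n′ (λ j → g (suc j) j) + ∑< p (λ l → g (n ℕ.+ l) 0) + ∑< q (λ l → g (n ℕ.+ p ℕ.+ l) n′)
      ∑-children g = trans (∑<-split (n′ ℕ.+ p) q _) (cong₂ _+_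
        (trans (∑<-split n′ p _) (cong₂ _+_
          (∑<-cong n′ λ j j<n′ → cong (g (suc j)) (parentℕ-path p n (s≤s j<n′)))
          (∑<-cong p λ l l<p → cong (g (n ℕ.+ l)) (parentℕ-P p n (ℕₚ.m≤m+n n l) (ℕₚ.+-monoʳ-< n l<p)))))
        (∑<-cong q λ l l<q → cong (g (n ℕ.+ p ℕ.+ l)) (parentℕ-Q p n {n ℕ.+ p ℕ.+ l} (ℕₚ.m≤m+n (n ℕ.+ p) l))))

    H-degree : ∀ i → deg (H p n q) i ≡ + 1 + excessℕ (toℕ i)
    H-degree i = begin
      deg (H p n q) i
        ≡⟨ deg-arcs (H p n q) H-simple H-tree i ⟩
      (+ 1 - δ zero i) + ∑ (λ j → arc (H p n q) zero parent j i)
        ≡⟨ cong₂ (λ y z → (+ 1 - y) + z) (root i) (trans (∑-cong λ j → arc-toℕ j i) (∑-toℕ N (λ j → arcℕ j (toℕ i)))) ⟩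
      (+ 1 - ⟦ 0 ≡ᵇ toℕ i ⟧) + (+ 0 + ∑< (n′ ℕ.+ p ℕ.+ q) (λ j → ⟦ parentℕ p n (suc j) ≡ᵇ toℕ i ⟧))
        ≡⟨ cong (λ z → (+ 1 - ⟦ 0 ≡ᵇ toℕ i ⟧) + (+ 0 + z)) (trans (∑-children (λ _ c → ⟦ c ≡ᵇ toℕ i ⟧))
             (cong₂ _+_ (cong₂ _+_ (∑<-indicator n′ (toℕ i)) (∑<-const p _)) (∑<-const q _))) ⟩
      (+ 1 - ⟦ 0 ≡ᵇ toℕ i ⟧) + (+ 0 + (⟦ toℕ i <ᵇ n′ ⟧ + + p * ⟦ 0 ≡ᵇ toℕ i ⟧ + + q * ⟦ n′ ≡ᵇ toℕ i ⟧))
        ≡⟨ regroup ⟦ 0 ≡ᵇ toℕ i ⟧ ⟦ toℕ i <ᵇ n′ ⟧ (+ p * ⟦ 0 ≡ᵇ toℕ i ⟧) (+ q * ⟦ n′ ≡ᵇ toℕ i ⟧) ⟩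
      + 1 + excessℕ (toℕ i) ∎
      where
      open ≡-Reasoning
      root : ∀ i → δ zero i ≡ ⟦ 0 ≡ᵇ toℕ i ⟧
      root zero    = refl
      root (suc i) = refl
      regroup : ∀ x y z w → (+ 1 - x) + (+ 0 + (y + z + w)) ≡ + 1 + ((y - x) + z + w)
      regroup = solve-∀

    excessℕ-pendant : ∀ {i} → n ℕ.≤ i → excessℕ i ≡ + 0
    excessℕ-pendant {suc i} (s≤s n′≤i) rewrite <ᵇ-false (ℕₚ.m≤n⇒m≤1+n n′≤i) | ≡ᵇ-false {n′} {suc i} (ℕₚ.<⇒≢ (s≤s n′≤i)) =
      cong₂ (λ y z → y + z) (cong (λ y → + 0 + y) (*-zeroʳ (+ p))) (*-zeroʳ (+ q))

    ∑-pendants : (g : ℤ → ℤ) → g (+ 0) ≡ + 0 → ∑ {N} (λ i → g (excessℕ (toℕ i))) ≡ ∑< n (g ∘ excessℕ)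
    ∑-pendants g g0 = begin
      ∑ {N} (λ i → g (excessℕ (toℕ i)))
        ≡⟨ ∑-toℕ N (g ∘ excessℕ) ⟩
      ∑< N (g ∘ excessℕ)
        ≡⟨ trans (∑<-split (n ℕ.+ p) q (g ∘ excessℕ)) (cong (λ z → z + ∑< q (λ l → g (excessℕ (n ℕ.+ p ℕ.+ l)))) (∑<-split n p (g ∘ excessℕ))) ⟩
      ∑< n (g ∘ excessℕ) + ∑< p (λ l → g (excessℕ (n ℕ.+ l))) + ∑< q (λ l → g (excessℕ (n ℕ.+ p ℕ.+ l)))
        ≡⟨ cong₂ (λ y z → ∑< n (g ∘ excessℕ) + y + z)
             (vanish p λ l → ℕₚ.m≤m+n n l) (vanish q λ l → ℕₚ.≤-trans (ℕₚ.m≤m+n n p) (ℕₚ.m≤m+n (n ℕ.+ p) l)) ⟩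
      ∑< n (g ∘ excessℕ) + + 0 + + 0
        ≡⟨ trans (+-identityʳ _) (+-identityʳ _) ⟩
      ∑< n (g ∘ excessℕ) ∎
      where
      open ≡-Reasoning
      vanish : ∀ k {f : ℕ → ℕ} → (∀ l → n ℕ.≤ f l) → ∑< k (λ l → g (excessℕ (f l))) ≡ + 0
      vanish k h = trans (∑<-cong k λ l _ → trans (cong g (excessℕ-pendant (h l))) g0) (trans (∑<-const k (+ 0)) (*-zeroʳ (+ k)))

    -- Pendant edges contribute 0, since a pendant has excess 0. The factor 2 counts both
    -- orientations of the path edges.
    ∑-edges : ∑ {N} (λ i → ∑ {N} λ j → excessℕ (toℕ i) * excessℕ (toℕ j) * a (H p n q) i j)
              ≡ + 2 * ∑< n′ (λ j → excessℕ (suc j) * excessℕ j)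
    ∑-edges = begin
      ∑ (λ i → ∑ λ j → x i * x j * a (H p n q) i j)
        ≡⟨ ∑-cong (λ i → trans (∑-cong λ j → trans (cong (x i * x j *_) (a-arcs (H p n q) H-simple H-tree i j)) (expand (x i) (x j) (e i j) (e j i)))
             (∑-+ (λ j → x i * (e i j * x j)) (λ j → x j * (e j i * x i)))) ⟩
      ∑ (λ i → ∑ (λ j → x i * (e i j * x j)) + ∑ (λ j → x j * (e j i * x i)))
        ≡⟨ trans (∑-+ (λ i → ∑ (λ j → x i * (e i j * x j))) (λ i → ∑ (λ j → x j * (e j i * x i))))
             (cong (λ z → Y + z) (∑-swap (λ i j → x j * (e j i * x i)))) ⟩
      Y + Y
        ≡⟨ cong (λ z → z + z) (begin
          Y
            ≡⟨ ∑-cong (λ i → trans (∑-* (x i) (λ j → e i j * x j)) (cong (x i *_) (row i))) ⟩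
          ∑ (λ i → x i * f (toℕ i))
            ≡⟨ ∑-toℕ N (λ i → excessℕ i * f i) ⟩
          excessℕ 0 * + 0 + ∑< (n′ ℕ.+ p ℕ.+ q) (λ j → excessℕ (suc j) * excessℕ (parentℕ p n (suc j)))
            ≡⟨ cong₂ _+_ (*-zeroʳ (excessℕ 0)) (∑-children (λ j c → excessℕ j * excessℕ c)) ⟩
          + 0 + (∑< n′ (λ j → excessℕ (suc j) * excessℕ j) + ∑< p (λ l → excessℕ (n ℕ.+ l) * excessℕ 0) + ∑< q (λ l → excessℕ (n ℕ.+ p ℕ.+ l) * excessℕ n′))
            ≡⟨ cong₂ (λ y z → + 0 + (∑< n′ (λ j → excessℕ (suc j) * excessℕ j) + y + z))
                 (vanish p 0 λ l → ℕₚ.m≤m+n n l) (vanish q n′ λ l → ℕₚ.≤-trans (ℕₚ.m≤m+n n p) (ℕₚ.m≤m+n (n ℕ.+ p) l)) ⟩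
          + 0 + (∑< n′ (λ j → excessℕ (suc j) * excessℕ j) + + 0 + + 0)
            ≡⟨ trans (+-identityˡ _) (trans (+-identityʳ _) (+-identityʳ _)) ⟩
          ∑< n′ (λ j → excessℕ (suc j) * excessℕ j) ∎) ⟩
      ∑< n′ (λ j → excessℕ (suc j) * excessℕ j) + ∑< n′ (λ j → excessℕ (suc j) * excessℕ j)
        ≡⟨ double (∑< n′ (λ j → excessℕ (suc j) * excessℕ j)) ⟩
      + 2 * ∑< n′ (λ j → excessℕ (suc j) * excessℕ j) ∎
      where
      open ≡-Reasoning
      x : Fin N → ℤ
      x i = excessℕ (toℕ i)
      e = arc (H p n q) zero parent
      Y = ∑ (λ i → ∑ λ j → x i * (e i j * x j))
      f : ℕ → ℤ
      f zero    = + 0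
      f (suc j) = excessℕ (parentℕ p n (suc j))
      double : ∀ y → y + y ≡ + 2 * y
      double = solve-∀
      expand : ∀ x y u v → x * y * (u + v) ≡ x * (u * y) + y * (v * x)
      expand = solve-∀
      row : ∀ i → ∑ (λ j → e i j * x j) ≡ f (toℕ i)
      row zero    = ∑-0 λ _ → refl
      row (suc i) = trans (∑-δ (parent (suc i)) x) (cong excessℕ (toℕ-parent (suc i)))
      vanish : ∀ k c {f : ℕ → ℕ} → (∀ l → n ℕ.≤ f l) → ∑< k (λ l → excessℕ (f l) * excessℕ c) ≡ + 0
      vanish k c h = trans (∑<-cong k λ l _ → cong (_* excessℕ c) (excessℕ-pendant (h l))) (trans (∑<-const k (+ 0)) (*-zeroʳ (+ k)))

  module _ (p k q : ℕ) where

    private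
      x = excessℕ p (suc k) q

    excess-first : x 0 ≡ + p
    excess-first = collect (+ p) (+ q)
      where
      collect : ∀ p q → (+ 1 - + 1) + p * + 1 + q * + 0 ≡ p
      collect = solve-∀

    excess-inner : ∀ {j} → j ℕ.< k → x (suc j) ≡ + 1
    excess-inner {j} j<k rewrite <ᵇ-true j<k | ≡ᵇ-false {k} {j} (ℕₚ.<⇒≢ j<k ∘ sym) = collect (+ p) (+ q)
      where
      collect : ∀ p q → (+ 1 - + 0) + p * + 0 + q * + 0 ≡ + 1
      collect = solve-∀

    excess-last : x (suc k) ≡ + q
    excess-last rewrite <ᵇ-false (ℕₚ.≤-refl {k}) | ≡ᵇ-true {k} refl = collect (+ p) (+ q)
      where
      collect : ∀ p q → (+ 0 - + 0) + p * + 0 + q * + 1 ≡ q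
      collect = solve-∀

    -- The path has k + 2 vertices here: excess p at one end, q at the other, and 1 at the k inner
    -- vertices.
    ∑-path : (g : ℤ → ℤ) → g (+ 0) ≡ + 0 →
      ∑ {suc (suc k) ℕ.+ p ℕ.+ q} (λ i → g (excessℕ p (suc k) q (toℕ i))) ≡ g (+ p) + (+ k * g (+ 1) + g (+ q))
    ∑-path g g0 = trans (∑-pendants p (suc k) q g g0) (cong₂ _+_ (cong g excess-first)
      (trans (∑<-last k (λ j → g (x (suc j)))) (cong₂ _+_ (trans (∑<-cong k λ j j<k → cong g (excess-inner j<k)) (∑<-const k _)) (cong g excess-last))))

  module _ (p k q : ℕ) where

    private
      x = excessℕ p (suc (suc k)) q

    -- With k + 3 path vertices the two ends are not adjacent, so no product pq appears: the k + 2
    -- path edges contribute p, k times 1, and q. This is one less than the sum of all excesses.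
    ∑-path-edges : ∑< (suc (suc k)) (λ j → x (suc j) * x j) ≡ + p + (+ k + + q)
    ∑-path-edges = cong₂ _+_ (trans (cong₂ _*_ (excess-inner p (suc k) q (s≤s z≤n)) (excess-first p (suc k) q)) (*-identityˡ (+ p)))
      (trans (∑<-last k (λ j → x (suc (suc j)) * x (suc j))) (cong₂ _+_
        (trans (∑<-cong k λ j j<k → cong₂ _*_ (excess-inner p (suc k) q (s≤s j<k)) (excess-inner p (suc k) q (ℕₚ.m<n⇒m<1+n j<k))) (trans (∑<-const k (+ 1)) (*-identityʳ (+ k))))
        (trans (cong₂ _*_ (excess-last p (suc k) q) (excess-inner p (suc k) q {k} ℕₚ.≤-refl)) (*-identityʳ (+ q)))))

-- Power sums of the excess, degree minus one, as spectral invariants of trees.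

module Moments where

  open import Data.Fin as Fin using (Fin)
  open import Data.Integer using (ℤ; +_; -_; _+_; _*_; _-_)
  open import Data.Integer.Properties hiding (_≟_)
  open import Algebra.Properties.AbelianGroup +-0-abelianGroup using () renaming (∙-cancelʳ to +-cancelʳ)
  open import Data.Integer.Tactic.RingSolver using (solve-∀)
  open import Data.Nat as ℕ using (ℕ; suc)
  import Data.Nat.Properties as ℕₚ
  open import Relation.Binary.PropositionalEquality

  open import Defs using (Adj; IsSimple; laplacian)
  open Series
  open CharPoly
  open Graph
  open Traces
  open ℤ-Det using (∑-cong; ∑-+; ∑-*)

  M₂ M₃ M₄ : ∀ {m} → (Fin m → ℤ) → ℤ
  M₂ x = ∑ λ i → x i * x i
  M₃ x = ∑ λ i → x i * x i * x i
  M₄ x = ∑ λ i → x i * x i * x i * x i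

  -- Summed over ordered pairs, hence twice the sum over edges.
  edge-moment : ∀ {m} → Adj m → (Fin m → ℤ) → ℤ
  edge-moment A x = ∑ λ i → ∑ λ j → x i * x j * a A i j

  module _ {m} (A : Adj m) (simple : IsSimple A) {r : Fin m} (T : RootedTree A r)
           (x : Fin m → ℤ) (deg-x : ∀ i → deg A i ≡ + 1 + x i) where

    private
      L = laplacian A
      d = deg A

    ∑-excess : ∑ x ≡ + m - + 2
    ∑-excess = begin
      ∑ x                                 ≡⟨ ∑-cong (λ i → trans (drop (x i)) (cong (λ z → z - + 1) (sym (deg-x i)))) ⟩
      ∑ (λ i → d i - + 1)                 ≡⟨ ∑-- d (λ _ → + 1) ⟩
      ∑ d - ∑ {m} (λ _ → + 1)             ≡⟨ cong₂ _-_ (trans (∑-cong (deg-∑ A)) (tree-edge-total A simple T)) (∑-const m (+ 1)) ⟩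
      + 2 * (+ m - + 1) - + m * + 1       ≡⟨ collect (+ m) ⟩
      + m - + 2                           ∎
      where
      open ≡-Reasoning
      drop : ∀ x → x ≡ + 1 + x - + 1
      drop = solve-∀
      collect : ∀ m → + 2 * (m - + 1) - m * + 1 ≡ m - + 2
      collect = solve-∀

    -- The new moment stands alone and the bracket contains only lower moments and the order, so the
    -- bracket cancels when two cospectral trees are compared. The next two traces have the same
    -- form.
    trace-2-excess : power-trace L 2 ≡ M₂ x + (+ 3 * ∑ x + + 2 * + m)
    trace-2-excess = trans (trace-2 A simple T) (trans (∑-cong λ i → trans (cong (λ z → z * z + z) (deg-x i)) (expand (x i)))
      (trans (∑-quartic (+ 2) (+ 3) (+ 1) (+ 0) (+ 0) x) (collect (+ m) (∑ x) (M₂ x) (M₃ x) (M₄ x))))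
      where
      expand : ∀ x → (+ 1 + x) * (+ 1 + x) + (+ 1 + x) ≡
        + 2 + + 3 * x + + 1 * (x * x) + + 0 * (x * x * x) + + 0 * (x * x * x * x)
      expand = solve-∀
      collect : ∀ m s t u v → + 2 * m + + 3 * s + + 1 * t + + 0 * u + + 0 * v ≡ t + (+ 3 * s + + 2 * m)
      collect = solve-∀

    trace-3-excess : power-trace L 3 ≡ M₃ x + (+ 6 * M₂ x + + 9 * ∑ x + + 4 * + m)
    trace-3-excess = trans (trace-3 A simple T) (trans (∑-cong λ i → trans (cong (λ z → z * z * z + + 3 * (z * z)) (deg-x i)) (expand (x i)))
      (trans (∑-quartic (+ 4) (+ 9) (+ 6) (+ 1) (+ 0) x) (collect (+ m) (∑ x) (M₂ x) (M₃ x) (M₄ x))))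
      where
      expand : ∀ x → (+ 1 + x) * (+ 1 + x) * (+ 1 + x) + + 3 * ((+ 1 + x) * (+ 1 + x)) ≡
        + 4 + + 9 * x + + 6 * (x * x) + + 1 * (x * x * x) + + 0 * (x * x * x * x)
      expand = solve-∀
      collect : ∀ m s t u v → + 4 * m + + 9 * s + + 6 * t + + 1 * u + + 0 * v ≡ u + (+ 6 * t + + 9 * s + + 4 * m)
      collect = solve-∀

    private
      X-excess : ∑ (λ k → ∑ λ j → d k * d j * a A k j) ≡ edge-moment A x + ∑ (λ i → + 2 * (x i * d i) + d i)
      X-excess = begin
        ∑ (λ k → ∑ λ j → d k * d j * a A k j)
          ≡⟨ ∑-cong (λ k → trans (∑-cong λ j → trans (cong₂ (λ y z → y * z * a A k j) (deg-x k) (deg-x j)) (expand (x k) (x j) (a A k j)))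
               (trans (∑-+ (λ j → x k * x j * a A k j + x k * a A k j) (λ j → x j * a A k j + + 1 * a A k j))
                 (cong₂ _+_ (∑-+ (λ j → x k * x j * a A k j) (λ j → x k * a A k j)) (∑-+ (λ j → x j * a A k j) (λ j → + 1 * a A k j))))) ⟩
        ∑ (λ k → (∑ (λ j → x k * x j * a A k j) + ∑ (λ j → x k * a A k j)) + (∑ (λ j → x j * a A k j) + ∑ (λ j → + 1 * a A k j)))
          ≡⟨ trans (∑-+ (λ k → ∑ (λ j → x k * x j * a A k j) + ∑ (λ j → x k * a A k j)) (λ k → ∑ (λ j → x j * a A k j) + ∑ (λ j → + 1 * a A k j)))
               (cong₂ _+_ (∑-+ (λ k → ∑ (λ j → x k * x j * a A k j)) (λ k → ∑ (λ j → x k * a A k j)))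
                          (∑-+ (λ k → ∑ (λ j → x j * a A k j)) (λ k → ∑ (λ j → + 1 * a A k j)))) ⟩
        (edge-moment A x + ∑ (λ k → ∑ (λ j → x k * a A k j))) + (∑ (λ k → ∑ (λ j → x j * a A k j)) + ∑ (λ k → ∑ (λ j → + 1 * a A k j)))
          ≡⟨ cong₂ _+_ (cong (λ z → edge-moment A x + z) (∑-edges-left A simple T x)) (cong₂ _+_ (∑-edges-right A simple T x) (∑-edges-left A simple T (λ _ → + 1))) ⟩
        (edge-moment A x + ∑ (λ k → x k * d k)) + (∑ (λ k → x k * d k) + ∑ (λ k → + 1 * d k))
          ≡⟨ +-assoc (edge-moment A x) _ _ ⟩
        edge-moment A x + (∑ (λ k → x k * d k) + (∑ (λ k → x k * d k) + ∑ (λ k → + 1 * d k)))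
          ≡⟨ cong (λ z → edge-moment A x + z) (sym (trans (∑-cong λ k → split (x k * d k) (d k)) (trans (∑-+ (λ k → x k * d k) (λ k → x k * d k + + 1 * d k))
               (cong (λ z → ∑ (λ k → x k * d k) + z) (∑-+ (λ k → x k * d k) (λ k → + 1 * d k)))))) ⟩
        edge-moment A x + ∑ (λ i → + 2 * (x i * d i) + d i) ∎
        where
        open ≡-Reasoning
        split : ∀ y z → + 2 * y + z ≡ y + (y + + 1 * z)
        split = solve-∀
        expand : ∀ x y e → (+ 1 + x) * (+ 1 + y) * e ≡ (x * y * e + x * e) + (y * e + + 1 * e)
        expand = solve-∀

    trace-4-excess : power-trace L 4 ≡ (M₄ x + + 2 * edge-moment A x) + (+ 8 * M₃ x + + 24 * M₂ x + + 25 * ∑ x + + 8 * + m)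
    trace-4-excess = begin
      power-trace L 4
        ≡⟨ trace-4 A simple T ⟩
      ∑ f + + 2 * ∑ (λ k → ∑ λ j → d k * d j * a A k j)
        ≡⟨ cong (λ z → ∑ f + + 2 * z) X-excess ⟩
      ∑ f + + 2 * (edge-moment A x + ∑ (λ i → + 2 * (x i * d i) + d i))
        ≡⟨ regroup (∑ f) (edge-moment A x) (∑ (λ i → + 2 * (x i * d i) + d i)) ⟩
      (∑ f + + 2 * ∑ (λ i → + 2 * (x i * d i) + d i)) + + 2 * edge-moment A x
        ≡⟨ cong (λ z → z + + 2 * edge-moment A x) (sym (∑-linear (+ 2) f (λ i → + 2 * (x i * d i) + d i))) ⟩
      ∑ (λ i → f i + + 2 * (+ 2 * (x i * d i) + d i)) + + 2 * edge-moment A x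
        ≡⟨ cong (λ z → z + + 2 * edge-moment A x) (trans (∑-cong λ i →
             trans (cong (λ z → (z * z * z * z + + 4 * (z * z * z) + + 2 * (z * z) - z) + + 2 * (+ 2 * (x i * z) + z)) (deg-x i)) (expand (x i)))
             (∑-quartic (+ 8) (+ 25) (+ 24) (+ 8) (+ 1) x)) ⟩
      (+ 8 * + m + + 25 * ∑ x + + 24 * M₂ x + + 8 * M₃ x + + 1 * M₄ x) + + 2 * edge-moment A x
        ≡⟨ collect (+ m) (∑ x) (M₂ x) (M₃ x) (M₄ x) (edge-moment A x) ⟩
      (M₄ x + + 2 * edge-moment A x) + (+ 8 * M₃ x + + 24 * M₂ x + + 25 * ∑ x + + 8 * + m) ∎
      where
      open ≡-Reasoning
      f : Fin m → ℤ
      f k = d k * d k * d k * d k + + 4 * (d k * d k * d k) + + 2 * (d k * d k) - d k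
      regroup : ∀ f u s → f + + 2 * (u + s) ≡ (f + + 2 * s) + + 2 * u
      regroup = solve-∀
      expand : ∀ x → ((+ 1 + x) * (+ 1 + x) * (+ 1 + x) * (+ 1 + x) + + 4 * ((+ 1 + x) * (+ 1 + x) * (+ 1 + x)) + + 2 * ((+ 1 + x) * (+ 1 + x)) - (+ 1 + x))
          + + 2 * (+ 2 * (x * (+ 1 + x)) + (+ 1 + x)) ≡
        + 8 + + 25 * x + + 24 * (x * x) + + 8 * (x * x * x) + + 1 * (x * x * x * x)
      expand = solve-∀
      collect : ∀ m s t u v w → (+ 8 * m + + 25 * s + + 24 * t + + 8 * u + + 1 * v) + + 2 * w ≡ (v + + 2 * w) + (+ 8 * u + + 24 * t + + 25 * s + + 8 * m)
      collect = solve-∀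

  module _ {n} {A B : Adj (suc n)} (A-simple : IsSimple A) (B-simple : IsSimple B)
           {r s : Fin (suc n)} (S : RootedTree A r) (T : RootedTree B s)
           (x y : Fin (suc n) → ℤ) (deg-x : ∀ i → deg A i ≡ + 1 + x i) (deg-y : ∀ i → deg B i ≡ + 1 + y i)
           (cospectral : χ (laplacian A) ≗ χ (laplacian B)) where

    private
      m = + suc n
      traces = cospectral-traces (laplacian A) (laplacian B) cospectral

      M₁≡ : ∑ x ≡ ∑ y
      M₁≡ = trans (∑-excess A A-simple S x deg-x) (sym (∑-excess B B-simple T y deg-y))

      cancel : ∀ {a b c d} → a + c ≡ b + d → c ≡ d → a ≡ b
      cancel {a} {b} {c} e refl = +-cancelʳ c a b e

    -- The bound on `n`, here and below, is the range in which Newton's identities are available on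
    -- n + 1 vertices.
    cospectral-M₂ : 2 ℕ.≤ n → M₂ x ≡ M₂ y
    cospectral-M₂ h = cancel (trans (sym (trace-2-excess A A-simple S x deg-x)) (trans (traces 2 h) (trace-2-excess B B-simple T y deg-y)))
      (cong (λ z → + 3 * z + + 2 * m) M₁≡)

    cospectral-M₃ : 3 ℕ.≤ n → M₃ x ≡ M₃ y
    cospectral-M₃ h = cancel (trans (sym (trace-3-excess A A-simple S x deg-x)) (trans (traces 3 h) (trace-3-excess B B-simple T y deg-y)))
      (cong₂ (λ y z → + 6 * y + + 9 * z + + 4 * m) (cospectral-M₂ (ℕₚ.≤-trans (ℕₚ.n≤1+n 2) h)) M₁≡)

    cospectral-M₄ : 4 ℕ.≤ n → M₄ x + + 2 * edge-moment A x ≡ M₄ y + + 2 * edge-moment B y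
    cospectral-M₄ h = cancel (trans (sym (trace-4-excess A A-simple S x deg-x)) (trans (traces 4 h) (trace-4-excess B B-simple T y deg-y)))
      (cong₂ (λ t z → t + + 25 * z + + 8 * m) (cong₂ (λ t z → + 8 * t + + 24 * z) (cospectral-M₃ (ℕₚ.≤-trans (ℕₚ.n≤1+n 3) h))
        (cospectral-M₂ (ℕₚ.≤-trans (ℕₚ.m≤n+m 2 2) h))) M₁≡)

-- Majorization: some vertex has excess at least p.

module DegreeSequence where

  open import Data.Fin as Fin using (Fin; zero; suc; punchIn)
  open import Data.Fin.Properties using (any?)
  open import Data.Integer using (ℤ; +_; -_; _+_; _*_; _-_; +≤+; +<+)
  import Data.Integer as ℤ
  open import Data.Integer.Properties hiding (_≟_; _≤?_)
  open import Data.Integer.Tactic.RingSolver using (solve-∀)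
  open import Data.Nat as ℕ using (ℕ; zero; suc; z≤n; s≤s; _≤?_)
  import Data.Nat.Properties as ℕₚ
  open import Data.Product using (∃; _×_; _,_)
  open import Data.Sum using (_⊎_; inj₁; inj₂)
  open import Data.Empty using (⊥)
  open import Function using (_∘_)
  open import Relation.Binary.PropositionalEquality
  open import Relation.Nullary using (yes; no; contradiction)

  open Series
  open CharPoly
  open Graph
  open Traces using (∑-quartic)
  open Moments
  open ℤ-Det using (∑-cong; ∑-+; ∑-*; ∑-0; ∑-neg; ∑-remove)

  0≤ : ∀ n → + 0 ℤ.≤ + n
  0≤ n = +≤+ z≤n

  0≤+ : ∀ {i j} → + 0 ℤ.≤ i → + 0 ℤ.≤ j → + 0 ℤ.≤ i + j
  0≤+ = +-mono-≤

  0≤* : ∀ {i j} → + 0 ℤ.≤ i → + 0 ℤ.≤ j → + 0 ℤ.≤ i * j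
  0≤* {+ a} {+ b} _ _ = subst (+ 0 ℤ.≤_) (pos-* a b) (0≤ (a ℕ.* b))

  0<* : ∀ {i j} → + 0 ℤ.< i → + 0 ℤ.< j → + 0 ℤ.< i * j
  0<* {+ suc a} {+ suc b} _ _ = +<+ (s≤s z≤n)
  0<* {+ zero} (+<+ ()) _
  0<* {+ suc a} {+ zero} _ (+<+ ())

  0<suc : ∀ n → + 0 ℤ.< + suc n
  0<suc n = +<+ (s≤s z≤n)

  0<+ : ∀ {i j} → + 0 ℤ.≤ i → + 0 ℤ.< j → + 0 ℤ.< i + j
  0<+ = +-mono-≤-<

  -- Vanishes at the excesses 0 and 1 of the pendants and of the inner path vertices, so in H(p,n,q)
  -- its sum sees only the two ends and not the length.
  f₂ : ℤ → ℤ
  f₂ x = x * (x - + 1)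

  f₂-nonneg : ∀ n → + 0 ℤ.≤ f₂ (+ n)
  f₂-nonneg zero    = ≤-refl
  f₂-nonneg (suc n) = 0≤* (0≤ (suc n)) (0≤ n)

  argmax : ∀ {n} (x : Fin (suc n) → ℕ) → ∃ λ i → ∀ j → x j ℕ.≤ x i
  argmax {zero}  x = zero , λ { zero → ℕₚ.≤-refl }
  argmax {suc n} x with argmax (x ∘ suc)
  ... | i , h with x zero ≤? x (suc i)
  ...   | yes le = suc i , λ { zero → le ; (suc j) → h j }
  ...   | no  nl = zero , λ { zero → ℕₚ.≤-refl ; (suc j) → ℕₚ.≤-trans (h j) (ℕₚ.≰⇒≥ nl) }

  bounded-or-max : ∀ {n} (x : Fin n → ℕ) q → (∀ j → x j ℕ.≤ q) ⊎ ∃ λ i → q ℕ.< x i × (∀ j → x j ℕ.≤ x i)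
  bounded-or-max {zero}  x q = inj₁ λ ()
  bounded-or-max {suc n} x q with argmax x
  ... | i , h with x i ≤? q
  ...   | yes le = inj₁ λ j → ℕₚ.≤-trans (h j) le
  ...   | no  nl = inj₂ (i , ℕₚ.≰⇒> nl , h)

  weighted-≤ : ∀ {n} (x : Fin n → ℕ) c → (∀ j → x j ℕ.≤ c) → ∑ (λ i → f₂ (+ x i) * (+ x i - + c)) ℤ.≤ + 0
  weighted-≤ x c h = subst (ℤ._≤ + 0) (neg-involutive _) (neg-mono-≤ (subst (+ 0 ℤ.≤_) (∑-neg _)
    (∑-nonneg (λ i → - (f₂ (+ x i) * (+ x i - + c))) λ i → subst (+ 0 ℤ.≤_) (flip (f₂ (+ x i)) (+ x i) (+ c)) (0≤* (f₂-nonneg (x i)) (i≤j⇒0≤j-i (+≤+ (h i)))))))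
    where
    flip : ∀ f x c → f * (c - x) ≡ - (f * (x - c))
    flip = solve-∀

  module _ {n} (x : Fin (suc n) → ℕ) (p q k : ℕ) where

    private
      X : Fin (suc n) → ℤ
      X i = + x i
      P = + p
      Q = + q

    module _ (M₁≡ : ∑ X ≡ P + (+ k + Q))
             (M₂≡ : M₂ X ≡ P * P + (+ k + Q * Q))
             (M₃≡ : M₃ X ≡ P * P * P + (+ k + Q * Q * Q)) where

      ∑-f₂ : ∑ (λ i → f₂ (X i)) ≡ f₂ P + f₂ Q
      ∑-f₂ = trans (∑-cong λ i → expand (X i)) (trans (∑-quartic (+ 0) (- + 1) (+ 1) (+ 0) (+ 0) X)
        (trans (cong₂ (λ s t → + 0 * + suc n + - + 1 * s + + 1 * t + + 0 * M₃ X + + 0 * M₄ X) M₁≡ M₂≡) (collect (+ suc n) P Q (+ k) (M₃ X) (M₄ X))))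
        where
        expand : ∀ x → x * (x - + 1) ≡ + 0 + - + 1 * x + + 1 * (x * x) + + 0 * (x * x * x) + + 0 * (x * x * x * x)
        expand = solve-∀
        collect : ∀ m p q k u v → + 0 * m + - + 1 * (p + (k + q)) + + 1 * (p * p + (k + q * q)) + + 0 * u + + 0 * v
                                  ≡ p * (p - + 1) + q * (q - + 1)
        collect = solve-∀

      -- The threshold `c` is free: each case below chooses it so that most terms on the left are
      -- nonpositive.
      ∑-f₂-linear : ∀ c → ∑ (λ i → f₂ (X i) * (X i - c)) ≡ f₂ P * (P - c) + f₂ Q * (Q - c)
      ∑-f₂-linear c = trans (∑-cong λ i → expand (X i) c) (trans (∑-quartic (+ 0) c (- (+ 1 + c)) (+ 1) (+ 0) X)
        (trans (cong₂ (λ s t → + 0 * + suc n + c * s + - (+ 1 + c) * t + + 1 * M₃ X + + 0 * M₄ X) M₁≡ M₂≡)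
        (trans (cong (λ u → + 0 * + suc n + c * (P + (+ k + Q)) + - (+ 1 + c) * (P * P + (+ k + Q * Q)) + + 1 * u + + 0 * M₄ X) M₃≡)
          (collect (+ suc n) P Q (+ k) c (M₄ X)))))
        where
        expand : ∀ x c → x * (x - + 1) * (x - c) ≡ + 0 + c * x + - (+ 1 + c) * (x * x) + + 1 * (x * x * x) + + 0 * (x * x * x * x)
        expand = solve-∀
        collect : ∀ m p q k c v → + 0 * m + c * (p + (k + q)) + - (+ 1 + c) * (p * p + (k + q * q)) + + 1 * (p * p * p + (k + q * q * q)) + + 0 * v
                                  ≡ p * (p - + 1) * (p - c) + q * (q - + 1) * (q - c)
        collect = solve-∀

      private
        -- All vertices but `i` lie at or below the threshold, so their terms can only lower the
        -- sum.
        gap : ∀ c i → (∀ j → x (punchIn i j) ℕ.≤ c) → f₂ P * (P - + c) + f₂ Q * (Q - + c) ℤ.≤ f₂ (X i) * (X i - + c)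
        gap c i h = subst (ℤ._≤ f₂ (X i) * (X i - + c)) (trans (sym (∑-remove i (λ j → f₂ (X j) * (X j - + c)))) (∑-f₂-linear (+ c)))
          (subst (f₂ (X i) * (X i - + c) + ∑ (λ j → f₂ (X (punchIn i j)) * (X (punchIn i j) - + c)) ℤ.≤_) (+-identityʳ _) (+-monoʳ-≤ (f₂ (X i) * (X i - + c)) (weighted-≤ (x ∘ punchIn i) c h)))

        absurd : ∀ {i} → + 0 ℤ.< i → i ℤ.≤ + 0 → ⊥
        absurd 0<i i≤0 = <-irrefl refl (<-≤-trans 0<i i≤0)

      private
        -- Threshold p - 1: every term is nonpositive, whereas the sum is 2p(p - 1).
        equal-case : ∀ p′ → p ≡ suc (suc p′) → q ≡ p → (∀ i → x i ℕ.< p) → ⊥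
        equal-case p′ refl refl h = absurd
          (subst (+ 0 ℤ.<_) (expand (+ p′)) (0<* (0<suc 1) (0<* (0<suc (suc p′)) (0<suc p′))))
          (subst (ℤ._≤ + 0) (∑-f₂-linear (+ suc p′)) (weighted-≤ x (suc p′) λ i → ℕₚ.≤-pred (h i)))
          where
          expand : ∀ p → + 2 * ((+ 2 + p) * (+ 1 + p)) ≡
            (+ 2 + p) * (+ 2 + p - + 1) * (+ 2 + p - (+ 1 + p)) + (+ 2 + p) * (+ 2 + p - + 1) * (+ 2 + p - (+ 1 + p))
          expand = solve-∀

        -- Threshold q: the value of y(y-1)(y-q) at p is at most that at y = x_i < p, which is
        -- impossible, since that cubic is nonpositive at naturals up to q and strictly increasing
        -- from there on.
        small-case : q ℕ.< p → 2 ℕ.≤ p → ∀ i → x i ℕ.< p → (∀ j → x (punchIn i j) ℕ.≤ q) → ⊥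
        small-case q<p 2≤p i a<p h with x i ≤? q
        ... | yes a≤q = absurd (0<* (0<* (ℤ.+<+ (ℕₚ.≤-trans (s≤s z≤n) 2≤p)) (i<j⇒0<j-i (ℤ.+<+ 2≤p))) (i<j⇒0<j-i (ℤ.+<+ q<p)))
                (≤-trans (≤-reflexive (drop (f₂ P) P Q (f₂ Q))) (≤-trans (gap q i h) nonpos))
          where
          i<j⇒0<j-i : ∀ {i j} → i ℤ.< j → + 0 ℤ.< j - i
          i<j⇒0<j-i {i} {j} i<j = subst (ℤ._< j - i) (+-inverseʳ i) (+-monoˡ-< (- i) i<j)
          drop : ∀ f p q g → f * (p - q) ≡ f * (p - q) + g * (q - q)
          drop = solve-∀
          flip : ∀ f x c → - (f * (c - x)) ≡ f * (x - c)
          flip = solve-∀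
          nonpos : f₂ (X i) * (X i - Q) ℤ.≤ + 0
          nonpos = subst (ℤ._≤ + 0) (flip (f₂ (X i)) (X i) Q) (neg-mono-≤ (0≤* (f₂-nonneg (x i)) (i≤j⇒0≤j-i (+≤+ a≤q))))
        ... | no  a≰q with ℕₚ.m≤n⇒∃[o]m+o≡n (ℕₚ.≰⇒> a≰q) | ℕₚ.m≤n⇒∃[o]m+o≡n a<p | gap q i h
        ...   | t , ea | u , ep | g = contradict ea ep g
          where
          contradict : ∀ {a} → suc q ℕ.+ t ≡ a → suc a ℕ.+ u ≡ p → f₂ P * (P - Q) + f₂ Q * (Q - Q) ℤ.≤ f₂ (+ a) * (+ a - Q) → ⊥
          contradict refl refl g = absurd
            (0<+ {+ suc u * (+ suc (q ℕ.+ t) * + (q ℕ.+ t) + + suc (q ℕ.+ t) * + suc t + + (q ℕ.+ t) * + suc t) + + suc u * + suc u * (+ suc (q ℕ.+ t) + + (q ℕ.+ t) + + suc t)}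
              (0≤+ (0≤* (0≤ (suc u)) (0≤+ (0≤+ (0≤* (0≤ (suc (q ℕ.+ t))) (0≤ (q ℕ.+ t))) (0≤* (0≤ (suc (q ℕ.+ t))) (0≤ (suc t)))) (0≤* (0≤ (q ℕ.+ t)) (0≤ (suc t)))))
                   (0≤* (0≤* (0≤ (suc u)) (0≤ (suc u))) (0≤ (suc (q ℕ.+ t) ℕ.+ (q ℕ.+ t) ℕ.+ suc t))))
              (0<* (0<* (0<suc u) (0<suc u)) (0<suc u)))
            (subst (ℤ._≤ + 0) (expand Q (+ t) (+ u)) (i≤j⇒i-j≤0 g))
            where
            -- With A = a, B = a - 1, C = a - q and v = p - a this is the expansion of
            -- (A+v)(B+v)(C+v) - ABC.
            expand : ∀ q t u → let A = + 1 + (q + t) ; B = q + t ; C = + 1 + t ; v = + 1 + u ; p = + 1 + (+ 1 + q + t) + u ; a = + 1 + q + t in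
              p * (p - + 1) * (p - q) + q * (q - + 1) * (q - q) - a * (a - + 1) * (a - q) ≡ (v * (A * B + A * C + B * C) + v * v * (A + B + C)) + v * v * v
            expand = solve-∀

        -- Here a = x_i and the largest remaining value b satisfy q < b ≤ a < p. The threshold is b,
        -- and `two` adds the inequality for the second moment, f₂(a) + f₂(b) ≤ f₂(p) + f₂(q).
        large-case : 1 ℕ.≤ q → ∀ i j → q ℕ.< x (punchIn i j) → (∀ l → x (punchIn i l) ℕ.≤ x (punchIn i j)) →
          x (punchIn i j) ℕ.≤ x i → x i ℕ.< p → ⊥
        large-case 1≤q i j q<b h b≤a a<p
          with ℕₚ.m≤n⇒∃[o]m+o≡n 1≤q | ℕₚ.m≤n⇒∃[o]m+o≡n q<b | ℕₚ.m≤n⇒∃[o]m+o≡n b≤a | ℕₚ.m≤n⇒∃[o]m+o≡n a<p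
        ... | q′ , eq | s , eb | t , ea | u , ep = contradict eq eb ea ep (gap (x (punchIn i j)) i h) two
          where
          two : f₂ (X i) + f₂ (X (punchIn i j)) ℤ.≤ f₂ P + f₂ Q
          two = subst (f₂ (X i) + f₂ (X (punchIn i j)) ℤ.≤_) (trans (sym (∑-remove i (f₂ ∘ X))) ∑-f₂)
            (+-monoʳ-≤ (f₂ (X i)) (∑-term-≤ (f₂ ∘ X ∘ punchIn i) (λ l → f₂-nonneg (x (punchIn i l))) j))
          contradict : ∀ {a b} → 1 ℕ.+ q′ ≡ q → suc q ℕ.+ s ≡ b → b ℕ.+ t ≡ a → suc a ℕ.+ u ≡ p →
            f₂ P * (P - + b) + f₂ Q * (Q - + b) ℤ.≤ f₂ (+ a) * (+ a - + b) → f₂ (+ a) + f₂ (+ b) ℤ.≤ f₂ P + f₂ Q → ⊥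
          contradict {a} {b} refl refl refl refl g two = absurd
            (0<+ {P * (f₂ P + f₂ Q - (f₂ (+ a) + f₂ (+ b))) + (P * (+ suc u * + u) + + 2 * (+ suc u * (P + + (q ℕ.+ s ℕ.+ t)) * + t)) + + suc s * (P * + s)}
              (0≤+ (0≤+ (0≤* (0≤ p) (i≤j⇒0≤j-i two)) (0≤+ (0≤* (0≤ p) (0≤* (0≤ (suc u)) (0≤ u))) (0≤* (0≤ 2) (0≤* (0≤* (0≤ (suc u)) (0≤ (p ℕ.+ (q ℕ.+ s ℕ.+ t)))) (0≤ t)))))
                   (0≤* (0≤ (suc s)) (0≤* (0≤ p) (0≤ s))))
              (0<* (0<suc s) (0<* (0<* (0<suc 1) (0<suc q′)) (0<suc (suc (suc (s ℕ.+ t ℕ.+ u)))))))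
            (subst (ℤ._≤ + 0) (expand (+ q′) (+ s) (+ t) (+ u)) (subst (+ 2 * (f₂ P * (P - + b) + f₂ Q * (Q - + b) - f₂ (+ a) * (+ a - + b)) ℤ.≤_) refl
              (*-monoˡ-≤-nonNeg (+ 2) (i≤j⇒i-j≤0 g))))
            where
            -- With Δ ≥ 0 the slack of `two` and v = p - a, twice the slack of `gap` is pΔ + pv(v-1)
            -- + 2v(p+a-1)(a-b) + (b-q)p(b-q-1) + 2q(b-q)(p-q+1). The last term is positive because
            -- q ≥ 1. Doubling clears the denominators.
            expand : ∀ q′ s t u → let q = + 1 + q′ ; b = + 1 + q + s ; a = b + t ; p = + 1 + a + u in
              + 2 * (p * (p - + 1) * (p - b) + q * (q - + 1) * (q - b) - a * (a - + 1) * (a - b)) ≡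
              (p * (p * (p - + 1) + q * (q - + 1) - (a * (a - + 1) + b * (b - + 1))) + (p * ((+ 1 + u) * u) + + 2 * ((+ 1 + u) * (p + (q + s + t)) * t)) + (+ 1 + s) * (p * s))
                + (+ 1 + s) * (+ 2 * (+ 1 + q′) * (+ 3 + (s + t + u)))
            expand = solve-∀

      -- Karamata: if all x i < p then (p , q , 0 , …) majorizes x in the scale f₂, and the third moment of x is too small.
      some-x≥p : 1 ℕ.≤ q → q ℕ.≤ p → 2 ℕ.≤ p → ∃ λ i → p ℕ.≤ x i
      some-x≥p 1≤q q≤p 2≤p with any? (λ i → p ≤? x i)
      ... | yes found = found
      ... | no  none with ℕₚ.m≤n⇒m<n∨m≡n q≤p
      ...   | inj₂ q≡p = contradiction (λ i → ℕₚ.≰⇒> λ p≤ → none (i , p≤)) (equal-case (p ℕ.∸ 2) (sym (ℕₚ.m+[n∸m]≡n 2≤p)) q≡p)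
      ...   | inj₁ q<p with argmax x
      ...     | i , max with bounded-or-max (x ∘ punchIn i) q
      ...       | inj₁ h = contradiction h (small-case q<p 2≤p i (ℕₚ.≰⇒> λ p≤ → none (i , p≤)))
      ...       | inj₂ (j , q<b , h) = contradiction (ℕₚ.≰⇒> λ p≤ → none (i , p≤)) (large-case 1≤q i j q<b h (max (punchIn i j)))

-- From non-leaves forming a path to an isomorphism with a double broom.

module Isomorphism where

  open import Data.Bool using (Bool; true; false)
  open import Data.Bool.Properties using () renaming (_≟_ to _≟ᵇ_)
  open import Data.Fin as Fin using (Fin; zero; suc; punchIn; punchOut; _≟_; toℕ; fromℕ<)
  open import Data.Fin.Properties using (any?; toℕ-fromℕ<; fromℕ<-toℕ; toℕ<n; toℕ-injective; punchIn-punchOut; punchOut-injective; suc-injective)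
  open import Data.Integer using (ℤ; +_; -_; _+_; _*_; _-_; +≤+)
  import Data.Integer as ℤ
  open import Data.Integer.Properties hiding (_≟_; _≤?_; _<?_)
  open import Data.Nat as ℕ using (ℕ; zero; suc; z≤n; s≤s; _<?_; _∸_)
  open import Data.Nat.Induction using (<-rec)
  import Data.Nat.Properties as ℕₚ
  open import Data.Product using (Σ; ∃; ∃₂; _×_; _,_; proj₁; proj₂)
  open import Data.Sum using (inj₁; inj₂)
  open import Function using (_∘_)
  open import Function.Bundles using (mk↔ₛ′)
  open import Relation.Binary.Definitions using (tri<; tri≈; tri>)
  open import Relation.Binary.PropositionalEquality
  open import Relation.Nullary using (Dec; does; yes; no; contradiction; _×-dec_; ¬?)
  open import Relation.Nullary.Decidable using (dec-true; dec-false)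

  open import Defs using (Adj; IsSimple; Isomorphic; H; HEdgeℕ; countFin)
  open Series
  open CharPoly
  open Graph
  open DoubleBroom
  open DegreeSequence
  open ℤ-Det using (∑-cong; ∑-+; ∑-*; ∑-0; ∑-remove)

  ≡-from-⇔ : ∀ {b c : Bool} → (b ≡ true → c ≡ true) → (c ≡ true → b ≡ true) → b ≡ c
  ≡-from-⇔ {true}  {c}     f g = sym (f refl)
  ≡-from-⇔ {false} {false} f g = refl
  ≡-from-⇔ {false} {true}  f g = g refl

  module _ {m} {A : Adj m} (simple : IsSimple A) {r : Fin m} (T : RootedTree A r) (p n′ q : ℕ) where

    open RootedTree T

    private
      n = suc n′
      N = n ℕ.+ p ℕ.+ q

    -- In both trees the edges are exactly the child-parent pairs, so a bijective labelling that
    -- respects root and parents is an isomorphism. `F` is total on ℕ; only the labels below `N`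
    -- matter.
    tree-isomorphism : (F : ℕ → Fin m) → F 0 ≡ r →
      (∀ i → i ≢ 0 → i ℕ.< N → par (F i) ≡ F (parentℕ p n i)) →
      (∀ i j → i ℕ.< N → j ℕ.< N → F i ≡ F j → i ≡ j) →
      (∀ v → ∃ λ i → i ℕ.< N × F i ≡ v) → Isomorphic A (H p n q)
    tree-isomorphism F F0 commute inj surj = mk↔ₛ′ to (F ∘ toℕ) to-from from-to , λ v w → ≡-from-⇔ (preserve v w) (reflect v w)
      where
      index : Fin m → ℕ
      index v = proj₁ (surj v)
      index< : ∀ v → index v ℕ.< N
      index< v = proj₁ (proj₂ (surj v))
      F-index : ∀ v → F (index v) ≡ v
      F-index v = proj₂ (proj₂ (surj v))
      to : Fin m → Fin N
      to v = fromℕ< (index< v)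
      toℕ-to : ∀ v → toℕ (to v) ≡ index v
      toℕ-to v = toℕ-fromℕ< (index< v)
      to-from : ∀ i → to (F (toℕ i)) ≡ i
      to-from i = toℕ-injective (trans (toℕ-to _) (inj _ _ (index< _) (toℕ<n i) (F-index _)))
      from-to : ∀ v → F (toℕ (to v)) ≡ v
      from-to v = trans (cong F (toℕ-to v)) (F-index v)
      0<N : 0 ℕ.< N
      0<N = s≤s z≤n
      up : ∀ v w → v ≢ r → par v ≡ w → index v ≢ 0 × parentℕ p n (index v) ≡ index w
      up v w v≢r e = nonzero , inj _ _ (parentℕ-<N p n′ q (index v) (index< v)) (index< w)
          (trans (sym (commute (index v) nonzero (index< v))) (trans (cong par (F-index v)) (trans e (sym (F-index w)))))
        where
        nonzero : index v ≢ 0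
        nonzero h = v≢r (trans (sym (F-index v)) (trans (cong F h) F0))
      down : ∀ v w → index v ≢ 0 → parentℕ p n (index v) ≡ index w → v ≢ r × par v ≡ w
      down v w nz e = (λ h → nz (inj _ _ (index< v) 0<N (trans (F-index v) (trans h (sym F0)))))
        , trans (cong par (sym (F-index v))) (trans (commute (index v) nz (index< v)) (trans (cong F e) (F-index w)))
      preserve : ∀ v w → A v w ≡ true → HEdgeℕ p n q (toℕ (to v)) (toℕ (to w)) ≡ true
      preserve v w h rewrite toℕ-to v | toℕ-to w with edge⁻¹ h
      ... | inj₁ (v≢r , e) = let (nz , e′) = up v w v≢r e in subst (λ z → HEdgeℕ p n q (index v) z ≡ true) e′ (HEdge-parent p n′ q (index v) nz (index< v))
      ... | inj₂ (w≢r , e) = let (nz , e′) = up w v w≢r e in trans (HEdge-sym p n′ q (index v) (index w))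
                               (subst (λ z → HEdgeℕ p n q (index w) z ≡ true) e′ (HEdge-parent p n′ q (index w) nz (index< w)))
      reflect : ∀ v w → HEdgeℕ p n q (toℕ (to v)) (toℕ (to w)) ≡ true → A v w ≡ true
      reflect v w h rewrite toℕ-to v | toℕ-to w with HEdge-sound p n′ q (index v) (index w) h
      ... | inj₁ (nz , e) = let (v≢r , e′) = down v w nz e in subst (λ z → A v z ≡ true) e′ (edge v≢r)
      ... | inj₂ (nz , e) = let (w≢r , e′) = down w v nz e in trans (proj₁ simple v w) (subst (λ z → A w z ≡ true) e′ (edge w≢r))

  enumerate : ∀ m (P : Fin m → Bool) → Σ (Fin (countFin m P) → Fin m) λ e →
    (∀ i → P (e i) ≡ true) × (∀ i j → e i ≡ e j → i ≡ j) × (∀ v → P v ≡ true → ∃ λ i → e i ≡ v)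
  enumerate zero    P = (λ ()) , (λ ()) , (λ ()) , λ ()
  enumerate (suc m) P with P zero in P0 | enumerate m (P ∘ suc)
  ... | false | e , s , inj , surj = suc ∘ e , s , (λ i j h → inj i j (suc-injective h))
              , λ { zero h → contradiction (trans (sym P0) h) λ () ; (suc v) h → proj₁ (surj v h) , cong suc (proj₂ (surj v h)) }
  ... | true  | e , s , inj , surj = e′ , s′ , inj′ , surj′
    where
    e′ : Fin (suc (countFin m (P ∘ suc))) → Fin (suc m)
    e′ zero    = zero
    e′ (suc i) = suc (e i)
    s′ : ∀ i → P (e′ i) ≡ true
    s′ zero    = P0
    s′ (suc i) = s i
    inj′ : ∀ i j → e′ i ≡ e′ j → i ≡ j
    inj′ zero    zero    h = refl
    inj′ (suc i) (suc j) h = cong suc (inj i j (suc-injective h))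
    surj′ : ∀ v → P v ≡ true → ∃ λ i → e′ i ≡ v
    surj′ zero    h = zero , refl
    surj′ (suc v) h = suc (proj₁ (surj v h)) , cong suc (proj₂ (surj v h))

  -- A total sequence of vertices instead of a map from `Fin`, so that labels of H can be shifted by
  -- plain arithmetic. From the count on, the values are arbitrary.
  record Enumeration {m} (P : Fin m → Bool) : Set where
    field
      e    : ℕ → Fin m
      hits : ∀ l → l ℕ.< countFin m P → P (e l) ≡ true
      inj  : ∀ k l → k ℕ.< countFin m P → l ℕ.< countFin m P → e k ≡ e l → k ≡ l
      surj : ∀ v → P v ≡ true → ∃ λ l → l ℕ.< countFin m P × e l ≡ v

  enumeration : ∀ {m} → Fin m → (P : Fin m → Bool) → Enumeration P
  enumeration {m} d P = record
    { e = e′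
    ; hits = λ l l<c → subst (λ z → P z ≡ true) (sym (e′-< l<c)) (s (fromℕ< l<c))
    ; inj = λ k l k<c l<c h → trans (sym (toℕ-fromℕ< k<c)) (trans (cong toℕ (i (fromℕ< k<c) (fromℕ< l<c) (trans (sym (e′-< k<c)) (trans h (e′-< l<c))))) (toℕ-fromℕ< l<c))
    ; surj = λ v h → toℕ (proj₁ (j v h)) , toℕ<n _ , trans (e′-< (toℕ<n (proj₁ (j v h)))) (trans (cong e (fromℕ<-toℕ (proj₁ (j v h)) _)) (proj₂ (j v h))) }
    where
    E = enumerate m P
    e = proj₁ E
    s = proj₁ (proj₂ E)
    i = proj₁ (proj₂ (proj₂ E))
    j = proj₂ (proj₂ (proj₂ E))
    e′ : ℕ → Fin m
    e′ l with l <? countFin m P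
    ... | yes l<c = e (fromℕ< l<c)
    ... | no  _   = d
    e′-< : ∀ {l} (l<c : l ℕ.< countFin m P) → e′ l ≡ e (fromℕ< l<c)
    e′-< {l} l<c with l <? countFin m P
    ... | yes l<c′ = cong (λ z → e (fromℕ< z)) (ℕₚ.<-irrelevant l<c′ l<c)
    ... | no  l≮c  = contradiction l<c l≮c

  ∑-two : ∀ {n} (f : Fin n → ℤ) → (∀ i → + 0 ℤ.≤ f i) → ∀ {s t} → s ≢ t → f s + f t ℤ.≤ ∑ f
  ∑-two {suc n} f h {s} {t} s≢t = subst (f s + f t ℤ.≤_) (sym (∑-remove s f)) (+-monoʳ-≤ (f s)
    (subst (λ z → f z ℤ.≤ ∑ (f ∘ punchIn s)) (punchIn-punchOut s≢t) (∑-term-≤ (f ∘ punchIn s) (h ∘ punchIn s) (punchOut s≢t))))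

  ∑-three : ∀ {n} (f : Fin n → ℤ) → (∀ i → + 0 ℤ.≤ f i) → ∀ {s t u} → s ≢ t → s ≢ u → t ≢ u → f s + (f t + f u) ℤ.≤ ∑ f
  ∑-three {suc n} f h {s} {t} {u} s≢t s≢u t≢u = subst (f s + (f t + f u) ℤ.≤_) (sym (∑-remove s f)) (+-monoʳ-≤ (f s)
    (subst₂ (λ y z → f y + f z ℤ.≤ ∑ (f ∘ punchIn s)) (punchIn-punchOut s≢t) (punchIn-punchOut s≢u)
      (∑-two (f ∘ punchIn s) (h ∘ punchIn s) {punchOut s≢t} {punchOut s≢u} λ e → t≢u (punchOut-injective s≢t s≢u e))))

  module _ {m} {A : Adj m} (simple : IsSimple A) (x : Fin m → ℕ) (deg-x : ∀ i → deg A i ≡ + 1 + + x i) where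

    private
      1+x : ∀ v → ∑ (a A v) ≡ + suc (x v)
      1+x v = trans (sym (deg-∑ A v)) (deg-x v)

      nonneg : ∀ v j → + 0 ℤ.≤ a A v j
      nonneg v j = ⟦⟧-nonneg (A v j)

    two-neighbours : ∀ {v s t} → A v s ≡ true → A v t ≡ true → s ≢ t → x v ≢ 0
    two-neighbours {v} {s} {t} Avs Avt s≢t e with subst₂ ℤ._≤_ (cong₂ (λ b c → ⟦ b ⟧ + ⟦ c ⟧) Avs Avt) (trans (1+x v) (cong (+_ ∘ suc) e)) (∑-two (a A v) (nonneg v) s≢t)
    ... | +≤+ (s≤s ())

    three-neighbours : ∀ {v s t u} → A v s ≡ true → A v t ≡ true → A v u ≡ true → s ≢ t → s ≢ u → t ≢ u → x v ≢ 1
    three-neighbours {v} {s} {t} {u} Avs Avt Avu s≢t s≢u t≢u e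
      with subst₂ ℤ._≤_ (cong₂ _+_ (cong ⟦_⟧ Avs) (cong₂ (λ b c → ⟦ b ⟧ + ⟦ c ⟧) Avt Avu)) (trans (1+x v) (cong (+_ ∘ suc) e)) (∑-three (a A v) (nonneg v) s≢t s≢u t≢u)
    ... | +≤+ (s≤s (s≤s ()))

    another-neighbour : ∀ {v s} → x v ≢ 0 → A v s ≡ true → ∃ λ t → A v t ≡ true × t ≢ s
    another-neighbour {v} {s} xv≢0 Avs with any? (λ t → (A v t ≟ᵇ true) ×-dec ¬? (t ≟ s))
    ... | yes found = found
    ... | no  none  = contradiction (ℕₚ.suc-injective (+-injective (trans (sym (1+x v)) (trans (∑-cong only) (∑-δ s (λ _ → + 1)))))) xv≢0
      where
      only : ∀ t → a A v t ≡ δ s t * + 1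
      only t with s ≟ t
      ... | yes refl = cong ⟦_⟧ Avs
      ... | no  s≢t with A v t in Avt
      ...   | false = refl
      ...   | true  = contradiction (t , Avt , s≢t ∘ sym) none

    module _ {r : Fin m} (T : RootedTree A r) where

      open RootedTree T

      edge-down : ∀ {v} → v ≢ r → A (par v) v ≡ true
      edge-down {v} v≢r = trans (proj₁ simple (par v) v) (edge v≢r)

      parent-nonleaf : ∀ {v} → v ≢ r → par v ≢ r → x (par v) ≢ 0
      parent-nonleaf {v} v≢r u≢r = two-neighbours (edge-down v≢r) (edge u≢r)
        λ e → ℕₚ.<-asym (rk-par v≢r) (subst (λ z → rk z ℕ.< rk (par v)) (sym e) (rk-par u≢r))

      -- Climb from `v` towards the root: a vertex other than the root that has a child also has its
      -- own parent as neighbour, so it is again a non-leaf.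
      nonleaf-child-of-root : ∀ v → v ≢ r → x v ≢ 0 → ∃ λ c → c ≢ r × par c ≡ r × x c ≢ 0
      nonleaf-child-of-root v = climb (rk v) v refl
        where
        climb : ∀ k v → rk v ≡ k → v ≢ r → x v ≢ 0 → ∃ λ c → c ≢ r × par c ≡ r × x c ≢ 0
        climb = <-rec _ λ { k rec v refl v≢r nl → step k rec v refl v≢r nl }
          where
          step : ∀ k → (∀ {j} → j ℕ.< k → ∀ v → rk v ≡ j → v ≢ r → x v ≢ 0 → ∃ λ c → c ≢ r × par c ≡ r × x c ≢ 0) →
            ∀ v → rk v ≡ k → v ≢ r → x v ≢ 0 → ∃ λ c → c ≢ r × par c ≡ r × x c ≢ 0
          step k rec v refl v≢r nl with par v ≟ r
          ... | yes e  = v , v≢r , e , nl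
          ... | no  ne = rec (rk-par v≢r) (par v) refl ne (parent-nonleaf v≢r ne)

      -- A descending path of non-leaves from `v` that cannot branch: before the last vertex the
      -- next one is the only child, and below the last vertex there are only leaves. `w` matters up
      -- to `ℓ`, so the chain has ℓ + 1 vertices.
      record Chain (v : Fin m) : Set where
        field
          ℓ       : ℕ
          w       : ℕ → Fin m
          start   : w 0 ≡ v
          nonroot : ∀ k → k ℕ.≤ ℓ → w k ≢ r
          nonleaf : ∀ k → k ℕ.≤ ℓ → x (w k) ≢ 0
          step    : ∀ k → k ℕ.< ℓ → par (w (suc k)) ≡ w k
          only    : ∀ k → k ℕ.< ℓ → ∀ t → t ≢ r → par t ≡ w k → t ≡ w (suc k)
          end     : ∀ t → t ≢ r → par t ≡ w ℓ → x t ≡ 0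

      -- `thin` says that a vertex with two non-leaf neighbours is an inner path vertex: not the
      -- root, and of degree 2. It gives the root a single non-leaf child and prevents branching
      -- further down.
      module Broom
        (root-nonleaf : x r ≢ 0)
        (thin : ∀ v s t → A v s ≡ true → A v t ≡ true → s ≢ t → x s ≢ 0 → x t ≢ 0 → v ≢ r × x v ≡ 1) where

        nonleaf-parent : ∀ {v} → v ≢ r → x (par v) ≢ 0
        nonleaf-parent {v} v≢r with par v ≟ r
        ... | yes e  = subst (λ z → x z ≢ 0) (sym e) root-nonleaf
        ... | no  ne = parent-nonleaf v≢r ne

        chain : ∀ v → v ≢ r → x v ≢ 0 → Chain v
        -- Ranks grow along the descent and never exceed `B`. Each step spends one unit of fuel, so
        -- rank plus fuel stays above `B` and the fuel cannot run out.
        chain v v≢r nl = go (suc B) v v≢r nl (ℕₚ.≤-trans (s≤s (ℕₚ.≤-reflexive refl)) (ℕₚ.m≤n+m (suc B) (rk v)))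
          where
          height : ∃ λ B → ∀ u → rk u ℕ.≤ B
          height = bound m rk
            where
            bound : ∀ m (f : Fin m → ℕ) → ∃ λ B → ∀ u → f u ℕ.≤ B
            bound zero    f = 0 , λ ()
            bound (suc m) f = let (i , h) = argmax f in f i , h
          B = proj₁ height
          go : ∀ fuel v → v ≢ r → x v ≢ 0 → B ℕ.< rk v ℕ.+ fuel → Chain v
          go zero       v v≢r nl lt = contradiction (proj₂ height v) (ℕₚ.<⇒≱ (subst (B ℕ.<_) (ℕₚ.+-identityʳ (rk v)) lt))
          go (suc fuel) v v≢r nl lt with any? (λ t → ¬? (t ≟ r) ×-dec (par t ≟ v) ×-dec ¬? (x t ℕ.≟ 0))
          ... | no none = record
                { ℓ = 0 ; w = λ _ → v ; start = refl ; nonroot = λ _ _ → v≢r ; nonleaf = λ _ _ → nl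
                ; step = λ _ () ; only = λ _ () ; end = end }
            where
            end : ∀ t → t ≢ r → par t ≡ v → x t ≡ 0
            end t t≢r e with x t ℕ.≟ 0
            ... | yes z  = z
            ... | no  nz = contradiction (t , t≢r , e , nz) none
          ... | yes (t , t≢r , refl , nt) = extend (go fuel t t≢r nt (ℕₚ.≤-trans lt (subst (ℕ._≤ rk t ℕ.+ fuel) (sym (ℕₚ.+-suc (rk v) fuel)) (ℕₚ.+-monoˡ-≤ fuel (rk-par t≢r)))))
            where
            v≢parent : par v ≢ t
            v≢parent e = ℕₚ.<-asym (rk-par t≢r) (subst (λ z → rk z ℕ.< rk v) e (rk-par v≢r))
            -- The parent of `v` and `t` are two non-leaf neighbours, so `v` has degree 2 and no
            -- room for a further child.
            xv≡1 : x v ≡ 1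
            xv≡1 = proj₂ (thin v (par v) t (edge v≢r) (edge-down t≢r) v≢parent (nonleaf-parent v≢r) nt)
            only-child : ∀ s → s ≢ r → par s ≡ v → s ≡ t
            only-child s s≢r e with s ≟ t
            ... | yes s≡t = s≡t
            ... | no  s≢t = contradiction xv≡1 (three-neighbours (edge v≢r) (edge-down t≢r) (subst (λ z → A z s ≡ true) e (edge-down s≢r))
                    v≢parent (λ e′ → ℕₚ.<-asym (rk-par v≢r) (subst₂ (λ y z → rk y ℕ.< rk z) e (sym e′) (rk-par s≢r))) (s≢t ∘ sym))
            extend : Chain t → Chain v
            extend C = record
              { ℓ = suc C.ℓ ; w = w ; start = refl
              ; nonroot = λ { zero _ → v≢r ; (suc k) (s≤s h) → C.nonroot k h }
              ; nonleaf = λ { zero _ → nl ; (suc k) (s≤s h) → C.nonleaf k h }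
              ; step = λ { zero _ → cong par C.start ; (suc k) (s≤s h) → C.step k h }
              ; only = λ { zero _ s s≢r e → trans (only-child s s≢r e) (sym C.start) ; (suc k) (s≤s h) → C.only k h }
              ; end = C.end }
              where
              module C = Chain C
              w : ℕ → Fin m
              w zero    = v
              w (suc k) = C.w k

        -- The path consists of the root and the ℓ + 1 vertices of the chain below its non-leaf
        -- child. The leaf children of the root and the children of the last chain vertex are the
        -- two bunches of pendants.
        broom : (∃ λ v → v ≢ r × x v ≢ 0) → ∃₂ λ ℓ q → 1 ℕ.≤ q × Isomorphic A (H (x r) (suc (suc ℓ)) q)
        broom (v₀ , v₀≢r , v₀-nonleaf) = let (c , c≢r , c-child , c-nonleaf) = nonleaf-child-of-root v₀ v₀≢r v₀-nonleaf
                                         in along c c≢r c-child c-nonleaf (chain c c≢r c-nonleaf)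
          where
          along : ∀ c → c ≢ r → par c ≡ r → x c ≢ 0 → Chain c → ∃₂ λ ℓ q → 1 ℕ.≤ q × Isomorphic A (H (x r) (suc (suc ℓ)) q)
          along c c≢r c-child c-nonleaf C = ℓ , q , 1≤q , subst (λ z → Isomorphic A (H z (suc (suc ℓ)) q)) count-P
            (tree-isomorphism simple T p (suc ℓ) q F refl commute injective surjective)
            where
            open Chain C
            b = w ℓ
            b≢r = nonroot ℓ ℕₚ.≤-refl
            P-leaf? : ∀ t → Dec (t ≢ r × par t ≡ r × x t ≡ 0)
            P-leaf? t = ¬? (t ≟ r) ×-dec (par t ≟ r) ×-dec (x t ℕ.≟ 0)
            -- Being a leaf is not demanded here: `end` supplies it for every child of `b`. The
            -- root, in contrast, also has the non-leaf child `c`.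
            Q-leaf? : ∀ t → Dec (t ≢ r × par t ≡ b)
            Q-leaf? t = ¬? (t ≟ r) ×-dec (par t ≟ b)
            sound : ∀ {X : Set} (X? : Dec X) → does X? ≡ true → X
            sound (yes x) _ = x
            p = countFin m (does ∘ P-leaf?)
            q = countFin m (does ∘ Q-leaf?)
            module P = Enumeration (enumeration r (does ∘ P-leaf?))
            module Q = Enumeration (enumeration r (does ∘ Q-leaf?))
            n = suc (suc ℓ)
            N = n ℕ.+ p ℕ.+ q

            unique-child : ∀ t → t ≢ r → par t ≡ r → x t ≢ 0 → t ≡ c
            unique-child t t≢r e nt with t ≟ c
            ... | yes t≡c = t≡c
            ... | no  t≢c = contradiction refl (proj₁ (thin r t c (subst (λ z → A z t ≡ true) e (edge-down t≢r)) (subst (λ z → A z c ≡ true) c-child (edge-down c≢r)) t≢c nt c-nonleaf))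

            -- All x r + 1 neighbours of the root are children: `c`, and otherwise leaves.
            count-P : p ≡ x r
            count-P = ℕₚ.suc-injective (+-injective (begin
              + 1 + + p                                                   ≡⟨ cong (λ z → + 1 + z) (count-∑ m (does ∘ P-leaf?)) ⟩
              + 1 + ∑ (λ j → ⟦ does (P-leaf? j) ⟧)                        ≡⟨ cong (λ z → z + ∑ (λ j → ⟦ does (P-leaf? j) ⟧)) (sym (∑-δ c (λ _ → + 1))) ⟩
              ∑ (λ j → δ c j * + 1) + ∑ (λ j → ⟦ does (P-leaf? j) ⟧)      ≡⟨ ∑-+ (λ j → δ c j * + 1) (λ j → ⟦ does (P-leaf? j) ⟧) ⟨
              ∑ (λ j → δ c j * + 1 + ⟦ does (P-leaf? j) ⟧)                ≡⟨ ∑-cong term ⟩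
              ∑ (λ j → arc A r par j r)                                   ≡⟨ +-identityˡ _ ⟨
              + 0 + ∑ (λ j → arc A r par j r)                             ≡⟨ cong (λ z → (+ 1 - z) + ∑ (λ j → arc A r par j r)) (sym (δ-refl r)) ⟩
              (+ 1 - δ r r) + ∑ (λ j → arc A r par j r)                   ≡⟨ deg-arcs A simple T r ⟨
              deg A r                                                     ≡⟨ deg-x r ⟩
              + 1 + + x r                                                 ∎))
              where
              open ≡-Reasoning
              term : ∀ j → δ c j * + 1 + ⟦ does (P-leaf? j) ⟧ ≡ arc A r par j r
              term j with arc-cases A r par j r
              ... | inj₂ (not-child , h) rewrite h | dec-false (P-leaf? j) (λ { (n₁ , n₂ , _) → not-child (n₁ , n₂) }) =
                      trans (+-identityʳ (δ c j * + 1)) (trans (*-identityʳ (δ c j)) (δ-≢ {i = c} {j} λ { refl → not-child (c≢r , c-child) }))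
              ... | inj₁ (j≢r , e , h) with x j ℕ.≟ 0
              ...   | yes z rewrite h | dec-true (P-leaf? j) (j≢r , e , z) = cong (λ y → y * + 1 + + 1) (δ-≢ {i = c} {j} λ { refl → c-nonleaf z })
              ...   | no nz rewrite h | dec-false (P-leaf? j) (λ { (_ , _ , z) → nz z }) | unique-child j j≢r e nz = cong (λ y → y * + 1 + + 0) (δ-refl c)

            -- The last chain vertex is a non-leaf, so it has a neighbour besides its parent.
            1≤q : 1 ℕ.≤ q
            1≤q with another-neighbour (nonleaf ℓ ℕₚ.≤-refl) (edge b≢r)
            ... | t , Abt , t≢ with edge⁻¹ Abt
            ...   | inj₁ (_ , e) = contradiction (sym e) t≢
            ...   | inj₂ (t≢r , e) = ℕₚ.≤-trans (s≤s z≤n) (proj₁ (proj₂ (Q.surj t (dec-true (Q-leaf? t) (t≢r , e)))))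

            W : ℕ → Fin m
            W zero    = r
            W (suc k) = w k

            F : ℕ → Fin m
            F i with i <? n
            ... | yes _ = W i
            ... | no  _ with i <? n ℕ.+ p
            ...   | yes _ = P.e (i ∸ n)
            ...   | no  _ = Q.e (i ∸ (n ℕ.+ p))

            F-W : ∀ {i} → i ℕ.< n → F i ≡ W i
            F-W {i} h with i <? n
            ... | yes _ = refl
            ... | no ¬h = contradiction h ¬h

            F-P : ∀ {l} → l ℕ.< p → F (n ℕ.+ l) ≡ P.e l
            F-P {l} h with n ℕ.+ l <? n
            ... | yes k = contradiction k (ℕₚ.m+n≮m n l)
            ... | no  _ with n ℕ.+ l <? n ℕ.+ p
            ...   | yes _ = cong P.e (ℕₚ.m+n∸m≡n n l)
            ...   | no ¬h = contradiction (ℕₚ.+-monoʳ-< n h) ¬h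

            F-Q : ∀ {l} → l ℕ.< q → F (n ℕ.+ p ℕ.+ l) ≡ Q.e l
            F-Q {l} h with n ℕ.+ p ℕ.+ l <? n
            ... | yes k = contradiction (ℕₚ.≤-<-trans (ℕₚ.m≤m+n n p) (ℕₚ.≤-<-trans (ℕₚ.m≤m+n (n ℕ.+ p) l) k)) (ℕₚ.n≮n n)
            ... | no  _ with n ℕ.+ p ℕ.+ l <? n ℕ.+ p
            ...   | yes k = contradiction k (ℕₚ.m+n≮m (n ℕ.+ p) l)
            ...   | no  _ = cong Q.e (ℕₚ.m+n∸m≡n (n ℕ.+ p) l)

            data View : ℕ → Set where
              on-path : ∀ {i} → i ℕ.< n → View i
              in-P    : ∀ {l} → l ℕ.< p → View (n ℕ.+ l)
              in-Q    : ∀ {l} → l ℕ.< q → View (n ℕ.+ p ℕ.+ l)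

            view : ∀ i → i ℕ.< N → View i
            view i i<N with i <? n
            ... | yes h = on-path h
            ... | no ¬h with i <? n ℕ.+ p
            ...   | yes h = let (l , e) = ℕₚ.m≤n⇒∃[o]m+o≡n (ℕₚ.≮⇒≥ ¬h) in
                    subst View e (in-P (ℕₚ.+-cancelˡ-< n l p (subst (ℕ._< n ℕ.+ p) (sym e) h)))
            ...   | no ¬k = let (l , e) = ℕₚ.m≤n⇒∃[o]m+o≡n (ℕₚ.≮⇒≥ ¬k) in
                    subst View e (in-Q (ℕₚ.+-cancelˡ-< (n ℕ.+ p) l q (subst (ℕ._< N) (sym e) i<N)))

            P-props : ∀ {l} → l ℕ.< p → P.e l ≢ r × par (P.e l) ≡ r × x (P.e l) ≡ 0
            P-props {l} h = sound (P-leaf? (P.e l)) (P.hits l h)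

            Q-props : ∀ {l} → l ℕ.< q → Q.e l ≢ r × par (Q.e l) ≡ b
            Q-props {l} h = sound (Q-leaf? (Q.e l)) (Q.hits l h)

            Q-leaf : ∀ {l} → l ℕ.< q → x (Q.e l) ≡ 0
            Q-leaf h = end _ (proj₁ (Q-props h)) (proj₂ (Q-props h))

            W-nonleaf : ∀ {i} → i ℕ.< n → x (W i) ≢ 0
            W-nonleaf {zero}  _             = root-nonleaf
            W-nonleaf {suc k} (s≤s (s≤s h)) = nonleaf k h

            W-step : ∀ {k} → suc k ℕ.< n → W (suc k) ≢ r × par (W (suc k)) ≡ W k
            W-step {zero}  h             = nonroot 0 z≤n , trans (cong par start) c-child
            W-step {suc k} (s≤s (s≤s h)) = nonroot (suc k) h , step k h

            W-rank : ∀ {i j} → i ℕ.< j → j ℕ.< n → rk (W i) ℕ.< rk (W j)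
            W-rank {i} {suc j} (s≤s i≤j) j<n with ℕₚ.m≤n⇒m<n∨m≡n i≤j | W-step j<n
            ... | inj₂ refl | nr , e = subst (λ z → rk z ℕ.< rk (W (suc i))) e (rk-par nr)
            ... | inj₁ i<j  | nr , e = ℕₚ.<-trans (W-rank i<j (ℕₚ.<-trans (ℕₚ.n<1+n j) j<n)) (subst (λ z → rk z ℕ.< rk (W (suc j))) e (rk-par nr))

            W-injective : ∀ {i j} → i ℕ.< n → j ℕ.< n → W i ≡ W j → i ≡ j
            W-injective {i} {j} i<n j<n e with ℕₚ.<-cmp i j
            ... | tri< i<j _ _ = contradiction (cong rk e) (ℕₚ.<⇒≢ (W-rank i<j j<n))
            ... | tri≈ _ i≡j _ = i≡j
            ... | tri> _ _ j<i = contradiction (cong rk (sym e)) (ℕₚ.<⇒≢ (W-rank j<i i<n))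

            commute : ∀ i → i ≢ 0 → i ℕ.< N → par (F i) ≡ F (parentℕ p n i)
            commute i i≢0 i<N with view i i<N
            commute zero    i≢0 i<N | on-path h = contradiction refl i≢0
            commute (suc k) i≢0 i<N | on-path h rewrite parentℕ-path p n h | F-W h | F-W (ℕₚ.<-trans (ℕₚ.n<1+n k) h) = proj₂ (W-step h)
            ... | in-P {l} h rewrite parentℕ-P p n (ℕₚ.m≤m+n n l) (ℕₚ.+-monoʳ-< n h) | F-P h = proj₁ (proj₂ (P-props h))
            ... | in-Q {l} h rewrite parentℕ-Q p n {n ℕ.+ p ℕ.+ l} (ℕₚ.m≤m+n (n ℕ.+ p) l) | F-Q h | F-W (ℕₚ.n<1+n (suc ℓ)) = proj₂ (Q-props h)

            leaf-nonleaf : ∀ {u v} → x u ≡ 0 → x v ≢ 0 → u ≢ v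
            leaf-nonleaf z nz refl = nz z

            injective : ∀ i j → i ℕ.< N → j ℕ.< N → F i ≡ F j → i ≡ j
            injective i j i<N j<N e with view i i<N | view j j<N
            ... | on-path h | on-path k = W-injective h k (trans (sym (F-W h)) (trans e (F-W k)))
            ... | on-path h | in-P k = contradiction (trans (sym (F-P k)) (trans (sym e) (F-W h))) (leaf-nonleaf (proj₂ (proj₂ (P-props k))) (W-nonleaf h))
            ... | on-path h | in-Q k = contradiction (trans (sym (F-Q k)) (trans (sym e) (F-W h))) (leaf-nonleaf (Q-leaf k) (W-nonleaf h))
            ... | in-P h | on-path k = contradiction (trans (sym (F-P h)) (trans e (F-W k))) (leaf-nonleaf (proj₂ (proj₂ (P-props h))) (W-nonleaf k))
            ... | in-Q h | on-path k = contradiction (trans (sym (F-Q h)) (trans e (F-W k))) (leaf-nonleaf (Q-leaf h) (W-nonleaf k))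
            ... | in-P h | in-P k = cong (n ℕ.+_) (P.inj _ _ h k (trans (sym (F-P h)) (trans e (F-P k))))
            ... | in-Q h | in-Q k = cong (n ℕ.+ p ℕ.+_) (Q.inj _ _ h k (trans (sym (F-Q h)) (trans e (F-Q k))))
            ... | in-P h | in-Q k = contradiction (trans (sym (proj₂ (Q-props k))) (trans (cong par (trans (sym (F-Q k)) (trans (sym e) (F-P h)))) (proj₁ (proj₂ (P-props h))))) b≢r
            ... | in-Q h | in-P k = contradiction (trans (sym (proj₂ (Q-props h))) (trans (cong par (trans (sym (F-Q h)) (trans e (F-P k)))) (proj₁ (proj₂ (P-props k))))) b≢r

            n≤N : n ℕ.≤ N
            n≤N = ℕₚ.≤-trans (ℕₚ.m≤m+n n p) (ℕₚ.m≤m+n (n ℕ.+ p) q)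

            surjective : ∀ v → ∃ λ i → i ℕ.< N × F i ≡ v
            surjective v = reach (rk v) v refl
              where
              path-point : ∀ {k} → k ℕ.< n → ∀ {v} → W k ≡ v → ∃ λ i → i ℕ.< N × F i ≡ v
              path-point {k} h e = k , ℕₚ.≤-trans h n≤N , trans (F-W h) e
              -- The label of the parent decides. Below the root `v` is `c` or a pendant of the
              -- first bunch, below a chain vertex it is the next one or, at the end, a pendant of
              -- the second bunch; labels of pendants are leaves and cannot be parents.
              child : ∀ v → v ≢ r → ∀ i → i ℕ.< N → F i ≡ par v → ∃ λ i → i ℕ.< N × F i ≡ v
              child v v≢r i i<N e with view i i<N
              child v v≢r zero i<N e | on-path h with x v ℕ.≟ 0
              ... | yes z = let (l , l<p , el) = P.surj v (dec-true (P-leaf? v) (v≢r , sym e , z)) in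
                    n ℕ.+ l , ℕₚ.<-≤-trans (ℕₚ.+-monoʳ-< n l<p) (ℕₚ.m≤m+n (n ℕ.+ p) q) , trans (F-P l<p) el
              ... | no nz = path-point (s≤s (s≤s z≤n)) (trans start (sym (unique-child v v≢r (sym e) nz)))
              child v v≢r (suc k) i<N e | on-path h@(s≤s (s≤s k≤ℓ)) with ℕₚ.m≤n⇒m<n∨m≡n k≤ℓ
              ... | inj₁ k<ℓ  = path-point (s≤s (s≤s k<ℓ)) (sym (only k k<ℓ v v≢r (sym (trans (sym (F-W h)) e))))
              ... | inj₂ refl = let (l , l<q , el) = Q.surj v (dec-true (Q-leaf? v) (v≢r , sym (trans (sym (F-W h)) e))) in
                    n ℕ.+ p ℕ.+ l , ℕₚ.+-monoʳ-< (n ℕ.+ p) l<q , trans (F-Q l<q) el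
              child v v≢r i i<N e | in-P h = contradiction (trans (cong x (trans (sym e) (F-P h))) (proj₂ (proj₂ (P-props h)))) (nonleaf-parent v≢r)
              child v v≢r i i<N e | in-Q h = contradiction (trans (cong x (trans (sym e) (F-Q h))) (Q-leaf h)) (nonleaf-parent v≢r)
              reach : ∀ k v → rk v ≡ k → ∃ λ i → i ℕ.< N × F i ≡ v
              reach = <-rec _ step′
                where
                step′ : ∀ k → (∀ {j} → j ℕ.< k → ∀ v → rk v ≡ j → ∃ λ i → i ℕ.< N × F i ≡ v) → ∀ v → rk v ≡ k → ∃ λ i → i ℕ.< N × F i ≡ v
                step′ k rec v refl with v ≟ r
                ... | yes refl = path-point (s≤s z≤n) refl
                ... | no  v≢r  = let (i , i<N , e) = rec (rk-par v≢r) (par v) refl in child v v≢r i i<N e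

-- Trees with the moments of H(p,n,q), where n = k + 2 and p ≥ q.

module Reconstruction where

  open import Data.Bool using (true)
  open import Data.Fin as Fin using (Fin; zero; suc; punchIn; punchOut; _≟_; toℕ)
  open import Data.Fin.Properties using (any?; punchIn-punchOut; punchInᵢ≢i)
  open import Data.Fin.Permutation using (↔⇒≡)
  open import Data.Integer using (ℤ; +_; -_; _+_; _*_; _-_; +≤+; +<+)
  import Data.Integer as ℤ
  open import Data.Integer.Properties hiding (_≟_; _≤?_; _<?_)
  open import Algebra.Properties.AbelianGroup +-0-abelianGroup using () renaming (∙-cancelˡ to +-cancelˡ)
  open import Data.Integer.Tactic.RingSolver using (solve-∀)
  open import Data.Nat as ℕ using (ℕ; zero; suc; z≤n; s≤s; _≤?_)
  import Data.Nat.Properties as ℕₚ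
  open import Data.Product using (∃; ∃₂; _×_; _,_; proj₁; proj₂)
  open import Data.Sum using (_⊎_; inj₁; inj₂)
  open import Data.Empty using (⊥; ⊥-elim)
  open import Function using (_∘_)
  open import Function.Bundles using (Inverse)
  open import Relation.Binary.Definitions using (tri<; tri≈; tri>)
  open import Relation.Binary.PropositionalEquality
  open import Relation.Nullary using (yes; no; contradiction; _×-dec_; ¬?)

  open import Defs using (Adj; IsSimple; Isomorphic; H)
  open Series
  open CharPoly
  open Graph
  open Traces
  open DoubleBroom
  open Moments
  open DegreeSequence
  open Isomorphism
  open ℤ-Det using (∑-cong; ∑-+; ∑-*; ∑-0; ∑-swap; ∑-remove)

  isomorphic-degree : ∀ {m k} {A : Adj m} {B : Adj k} (f : Isomorphic A B) → ∀ i → deg A i ≡ deg B (Inverse.to (proj₁ f) i)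
  isomorphic-degree {A = A} {B} (f , pres) i = trans (deg-∑ A i) (trans (∑-cong λ j → cong ⟦_⟧ (pres i j))
    (trans (sym (ℤ-Det.∑-permute (a B (Inverse.to f i)) f)) (sym (deg-∑ B (Inverse.to f i)))))

  f₂-strict : ∀ {p q} → p ℕ.< q → f₂ (+ suc p) ≢ f₂ (+ suc q)
  f₂-strict {p} {suc q} (s≤s p≤q) e = ℕₚ.<⇒≢ (ℕₚ.*-mono-< (s≤s (s≤s p≤q)) (s≤s p≤q))
    (+-injective (trans (pos-* (suc p) p) (trans e (sym (pos-* (suc (suc q)) (suc q))))))

  f₂-injective : ∀ {p q} → 1 ℕ.≤ p → 1 ℕ.≤ q → f₂ (+ p) ≡ f₂ (+ q) → p ≡ q
  f₂-injective {suc p} {suc q} _ _ e with ℕₚ.<-cmp p q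
  ... | tri< p<q _ _ = contradiction e (f₂-strict p<q)
  ... | tri≈ _ p≡q _ = cong suc p≡q
  ... | tri> _ _ q<p = contradiction (sym e) (f₂-strict q<p)

  quartic-expand : ∀ x q → x * (x - + 1) * ((x - q) * (x - q)) ≡
    + 0 + - (q * q) * x + (+ 2 * q + q * q) * (x * x) + - (+ 1 + + 2 * q) * (x * x * x) + + 1 * (x * x * x * x)
  quartic-expand = solve-∀

  -- The weight x(x-1)(x-q)² kills the contributions of 1 and q to the moments. The edge term of
  -- H(p,n,q) is 4(p + k′ + q) = 4m₁ - 4, and this equals 2u up to 2e, so only e is left besides the
  -- value of the weight at p.
  quartic-eliminate : ∀ m m₁ m₂ m₃ m₄ u e p q k k′ → k ≡ + 1 + k′ → m₁ ≡ p + (k + q) → m₂ ≡ p * p + (k + q * q) →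
    m₃ ≡ p * p * p + (k + q * q * q) → m₄ + + 2 * u ≡ (p * p * p * p + (k + q * q * q * q)) + + 4 * (p + (k′ + q)) →
    u ≡ + 2 * m₁ - + 2 + e →
    (+ 0 * m + - (q * q) * m₁ + (+ 2 * q + q * q) * m₂ + - (+ 1 + + 2 * q) * m₃ + + 1 * m₄) + + 2 * e
      ≡ p * (p - + 1) * ((p - q) * (p - q))
  quartic-eliminate m _ _ _ m₄ _ e p q _ k refl refl refl refl h refl =
    trans (isolate m₁ (- (q * q) * m₁) ((+ 2 * q + q * q) * m₂) (- (+ 1 + + 2 * q) * m₃) m₄ m e)
      (trans (cong (λ z → (- (q * q) * m₁ + (+ 2 * q + q * q) * m₂ + - (+ 1 + + 2 * q) * m₃ + z) - (+ 4 * m₁ - + 4)) h) (collect p q k))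
    where
    m₁ = p + (+ 1 + k + q)
    m₂ = p * p + (+ 1 + k + q * q)
    m₃ = p * p * p + (+ 1 + k + q * q * q)
    isolate : ∀ m₁ a b c d m e → (+ 0 * m + a + b + c + + 1 * d) + + 2 * e ≡ (a + b + c + (d + + 2 * (+ 2 * m₁ - + 2 + e))) - (+ 4 * m₁ - + 4)
    isolate = solve-∀
    collect : ∀ p q k → (- (q * q) * (p + (+ 1 + k + q)) + (+ 2 * q + q * q) * (p * p + (+ 1 + k + q * q)) + - (+ 1 + + 2 * q) * (p * p * p + (+ 1 + k + q * q * q))
        + ((p * p * p * p + (+ 1 + k + q * q * q * q)) + + 4 * (p + (k + q)))) - (+ 4 * (p + (+ 1 + k + q)) - + 4)
      ≡ p * (p - + 1) * ((p - q) * (p - q))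
    collect = solve-∀

  -- A rooted structure is assumed for every root, since the root of the broom is picked by its
  -- degree later on.
  module _ {N′} {A : Adj (suc N′)} (simple : IsSimple A) (trees : ∀ r → RootedTree A r)
           (x : Fin (suc N′) → ℕ) (deg-x : ∀ i → deg A i ≡ + 1 + + x i)
           (p q k : ℕ) (1≤q : 1 ℕ.≤ q) (q≤p : q ℕ.≤ p) (size : suc N′ ≡ suc (suc k) ℕ.+ p ℕ.+ q)
           (M₂≡ : M₂ (λ i → + x i) ≡ + p * + p + (+ k + + q * + q))
           (M₃≡ : M₃ (λ i → + x i) ≡ + p * + p * + p + (+ k + + q * + q * + q)) where

    private
      m = suc N′
      X : Fin m → ℤ
      X i = + x i
      P = + p
      Q = + q

      1≤p : 1 ℕ.≤ p
      1≤p = ℕₚ.≤-trans 1≤q q≤p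

      ∑X-m : ∑ X ≡ + m - + 2
      ∑X-m = ∑-excess A simple (trees zero) X deg-x

      M₁≡ : ∑ X ≡ P + (+ k + Q)
      M₁≡ = trans ∑X-m (trans (cong (λ z → + z - + 2) size) (collect P (+ k) Q))
        where
        collect : ∀ p k q → + 2 + k + p + q - + 2 ≡ p + (k + q)
        collect = solve-∀

      ∑f₂ : ∑ (λ i → f₂ (X i)) ≡ f₂ P + f₂ Q
      ∑f₂ = ∑-f₂ x p q k M₁≡ M₂≡ M₃≡

      X-nonneg : ∀ i → + 0 ℤ.≤ X i
      X-nonneg i = 0≤ (x i)

      f₂-zero : ∀ y → f₂ (+ y) ≡ + 0 → y ≢ 0 → y ≡ 1
      f₂-zero zero          _ nz = contradiction refl nz
      f₂-zero (suc zero)    _ _  = refl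
      f₂-zero (suc (suc y)) e _  = contradiction (sym e) (<⇒≢ (0<* (0<suc (suc y)) (0<suc y)))

    Thin : Fin m → Set
    Thin r = ∀ v s t → A v s ≡ true → A v t ≡ true → s ≢ t → x s ≢ 0 → x t ≢ 0 → v ≢ r × x v ≡ 1

    -- The sum of f₂ ignores the inner path vertices and hence determines q′, as f₂ is injective on
    -- positive numbers; the order then determines the length.
    parameters : ∀ ℓ q′ → 1 ℕ.≤ q′ → Isomorphic A (H p (suc (suc ℓ)) q′) → ℓ ≡ k × q′ ≡ q
    parameters ℓ q′ 1≤q′ iso = ℓ≡k , q′≡q
      where
      open ≡-Reasoning
      B = H p (suc (suc ℓ)) q′
      y : ℕ → ℤ
      y = excessℕ p (suc ℓ) q′
      same : ∀ i → X i ≡ y (toℕ (Inverse.to (proj₁ iso) i))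
      same i = +-cancelˡ (+ 1) (X i) (y (toℕ (Inverse.to (proj₁ iso) i))) (trans (sym (deg-x i)) (trans (isomorphic-degree {A = A} {B} iso i) (H-degree p (suc ℓ) q′ (Inverse.to (proj₁ iso) i))))
      f₂-sums : f₂ P + f₂ Q ≡ f₂ P + (+ ℓ * + 0 + f₂ (+ q′))
      f₂-sums = begin
        f₂ P + f₂ Q                                           ≡⟨ ∑f₂ ⟨
        ∑ (λ i → f₂ (X i))                                    ≡⟨ ∑-cong (λ i → cong f₂ (same i)) ⟩
        ∑ (λ i → f₂ (y (toℕ (Inverse.to (proj₁ iso) i))))     ≡⟨ ℤ-Det.∑-permute (λ j → f₂ (y (toℕ j))) (proj₁ iso) ⟨
        ∑ (λ j → f₂ (y (toℕ j)))                              ≡⟨ ∑-path p ℓ q′ f₂ refl ⟩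
        f₂ P + (+ ℓ * + 0 + f₂ (+ q′))                        ∎
      q′≡q : q′ ≡ q
      q′≡q = f₂-injective 1≤q′ 1≤q (sym (trans (drop (f₂ P) (f₂ Q)) (trans (cong (λ z → z - f₂ P) f₂-sums) (drop′ (f₂ P) (+ ℓ) (f₂ (+ q′))))))
        where
        drop : ∀ a b → b ≡ a + b - a
        drop = solve-∀
        drop′ : ∀ a l b → a + (l * + 0 + b) - a ≡ b
        drop′ = solve-∀
      ℓ≡k : ℓ ≡ k
      ℓ≡k = ℕₚ.+-cancelʳ-≡ p _ _ (ℕₚ.+-cancelʳ-≡ q _ _ (ℕₚ.suc-injective (ℕₚ.suc-injective
        (trans (cong (suc (suc ℓ) ℕ.+ p ℕ.+_) (sym q′≡q)) (trans (sym (↔⇒≡ (proj₁ iso))) size)))))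

    finish : ∀ r → x r ≡ p → Thin r → (∃ λ v → v ≢ r × x v ≢ 0) → Isomorphic A (H p (suc (suc k)) q)
    finish r xr thin other = conclude (Broom.broom simple x deg-x (trees r) (λ z → ℕₚ.<⇒≢ 1≤p (trans (sym z) xr)) thin other)
      where
      conclude : (∃₂ λ ℓ q′ → 1 ℕ.≤ q′ × Isomorphic A (H (x r) (suc (suc ℓ)) q′)) → Isomorphic A (H p (suc (suc k)) q)
      conclude (ℓ , q′ , 1≤q′ , iso) = subst₂ (λ y z → Isomorphic A (H p (suc (suc y)) z)) (proj₁ same) (proj₂ same) iso′
        where
        iso′ : Isomorphic A (H p (suc (suc ℓ)) q′)
        iso′ = subst (λ z → Isomorphic A (H z (suc (suc ℓ)) q′)) xr iso
        same = parameters ℓ q′ 1≤q′ iso′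

    private
      large : ∃ λ i → p ℕ.≤ x i
      large with 2 ≤? p
      ... | yes 2≤p = some-x≥p x p q k M₁≡ M₂≡ M₃≡ 1≤q q≤p 2≤p
      -- For p = 1 any non-leaf will do, and one exists because the excesses do not sum to 0.
      ... | no  2≰p with any? (λ i → p ≤? x i)
      ...   | yes found = found
      ...   | no  none  = contradiction (trans (sym (∑-0 {f = X} λ i → cong +_ (small i))) M₁≡) (<⇒≢ (+<+ (ℕₚ.≤-trans 1≤p (ℕₚ.m≤m+n p (k ℕ.+ q)))))
        where
        small : ∀ i → x i ≡ 0
        small i = ℕₚ.n<1⇒n≡0 (ℕₚ.<-≤-trans (ℕₚ.≰⇒> λ h → none (i , h)) (ℕₚ.≤-pred (ℕₚ.≰⇒> 2≰p)))

    private
      square-nonneg : ∀ z → + 0 ℤ.≤ z * z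
      square-nonneg (+ n)      = 0≤* (0≤ n) (0≤ n)
      square-nonneg ℤ.-[1+ n ] = +≤+ z≤n

      absurd : ∀ {i} → + 0 ℤ.< i → i ℤ.≤ + 0 → ⊥
      absurd 0<i i≤0 = <-irrefl refl (<-≤-trans 0<i i≤0)

    -- The weight y(y-q)² vanishes at 0 and q, the only excesses of H(p,2,q) apart from p. Its sum
    -- is therefore its value at p, and one vertex with x ≥ p uses it up completely.
    module Double (k≡0 : k ≡ 0) where

      private
        g : ℤ → ℤ
        g y = y * ((y - Q) * (y - Q))

        ∑g : ∑ (λ i → g (X i)) ≡ g P
        ∑g = trans (∑-cong λ i → expand (X i) Q) (trans (∑-quartic (+ 0) (Q * Q) (- (+ 2 * Q)) (+ 1) (+ 0) X)
          (trans (cong₂ (λ s t → + 0 * + m + Q * Q * s + - (+ 2 * Q) * t + + 1 * M₃ X + + 0 * M₄ X) M₁≡ M₂≡)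
          (trans (cong (λ u → + 0 * + m + Q * Q * (P + (+ k + Q)) + - (+ 2 * Q) * (P * P + (+ k + Q * Q)) + + 1 * u + + 0 * M₄ X) M₃≡)
          (trans (cong (λ z → + 0 * + m + Q * Q * (P + (z + Q)) + - (+ 2 * Q) * (P * P + (z + Q * Q)) + + 1 * (P * P * P + (z + Q * Q * Q)) + + 0 * M₄ X) (cong +_ k≡0))
            (collect (+ m) P Q (M₄ X))))))
          where
          expand : ∀ x q → x * ((x - q) * (x - q)) ≡ + 0 + q * q * x + - (+ 2 * q) * (x * x) + + 1 * (x * x * x) + + 0 * (x * x * x * x)
          expand = solve-∀
          collect : ∀ m p q v → + 0 * m + q * q * (p + (+ 0 + q)) + - (+ 2 * q) * (p * p + (+ 0 + q * q)) + + 1 * (p * p * p + (+ 0 + q * q * q)) + + 0 * v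
                                ≡ p * ((p - q) * (p - q))
          collect = solve-∀

        g-nonneg : ∀ y → + 0 ℤ.≤ g (+ y)
        g-nonneg y = 0≤* (0≤ y) (square-nonneg (+ y - Q))

        -- Strict growth of g from p = q + w on; the parametrization by w = p - q avoids
        -- subtraction.
        g-gap : ∀ t w → let C = + w ; T = + suc t ; R = Q + + w in + 0 ℤ.< g (R + T) - g R
        g-gap t w = subst (+ 0 ℤ.<_) (expand Q (+ w) (+ suc t))
          (0<+ (0≤* (0≤+ (0≤ q) (0≤ w)) (0≤+ (0≤* (0≤* (0≤ 2) (0≤ w)) (0≤ (suc t))) (0≤* (0≤ (suc t)) (0≤ (suc t)))))
               (0<* (0<suc t) (0<* (0<+ (0≤ w) (0<suc t)) (0<+ (0≤ w) (0<suc t)))))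
          where
          expand : ∀ q w t → (q + w) * (+ 2 * w * t + t * t) + t * ((w + t) * (w + t)) ≡
            (q + w + t) * ((q + w + t - q) * (q + w + t - q)) - (q + w) * ((q + w - q) * (q + w - q))
          expand = solve-∀

        i₀ = proj₁ large

        rest-≤ : g (X i₀) ℤ.≤ g P
        rest-≤ = subst (g (X i₀) ℤ.≤_) ∑g (∑-term-≤ (λ i → g (X i)) (λ i → g-nonneg (x i)) i₀)

        x-i₀ : x i₀ ≡ p
        x-i₀ with ℕₚ.m≤n⇒∃[o]m+o≡n (proj₂ large) | ℕₚ.m≤n⇒∃[o]m+o≡n q≤p
        ... | zero  , e | _ = trans (sym e) (ℕₚ.+-identityʳ p)
        ... | suc t , e | w , e′ = ⊥-elim (absurd (g-gap t w) (i≤j⇒i-j≤0 (subst₂ (λ y z → g (+ y) ℤ.≤ g (+ z)) (trans (sym e) (cong (ℕ._+ suc t) (sym e′))) (sym e′) rest-≤)))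

        others : ∀ j → j ≢ i₀ → x j ≢ 0 → x j ≡ q
        others j j≢i₀ nz = +-injective (i-j≡0⇒i≡j (X j) Q (square-0 (X j - Q) (product-0 g-0)))
          where
          g-rest : ∑ (λ l → g (X (punchIn i₀ l))) ℤ.≤ + 0
          g-rest = ≤-reflexive (trans (drop (g (X i₀)) _) (trans (cong (λ z → z - g (X i₀)) (trans (sym (∑-remove i₀ (λ i → g (X i)))) ∑g))
            (trans (cong (λ z → g P - g (+ z)) x-i₀) (+-inverseʳ (g P)))))
            where
            drop : ∀ a b → b ≡ a + b - a
            drop = solve-∀
          g-0 : g (X j) ≡ + 0
          g-0 = subst (λ z → g (X z) ≡ + 0) (punchIn-punchOut (j≢i₀ ∘ sym))
            (∑-vanish (λ l → g (X (punchIn i₀ l))) (λ l → g-nonneg (x (punchIn i₀ l))) g-rest (punchOut (j≢i₀ ∘ sym)))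
          product-0 : g (X j) ≡ + 0 → (X j - Q) * (X j - Q) ≡ + 0
          product-0 e with i*j≡0⇒i≡0∨j≡0 (X j) e
          ... | inj₁ z = contradiction (+-injective z) nz
          ... | inj₂ z = z
          square-0 : ∀ z → z * z ≡ + 0 → z ≡ + 0
          square-0 z e with i*j≡0⇒i≡0∨j≡0 z e
          ... | inj₁ h = h
          ... | inj₂ h = h

        no-two : ∀ s t → s ≢ t → s ≢ i₀ → t ≢ i₀ → x s ≢ 0 → x t ≢ 0 → ⊥
        no-two s t s≢t s≢ t≢ ns nt = absurd
          (subst (+ 0 ℤ.<_) (excess P Q) (+<+ 1≤q))
          (i≤j⇒i-j≤0 (subst₂ ℤ._≤_ (cong₂ _+_ (cong +_ x-i₀) (cong₂ _+_ (cong +_ (others s s≢ ns)) (cong +_ (others t t≢ nt))))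
            (trans M₁≡ (cong (λ z → P + (+ z + Q)) k≡0)) (∑-three X X-nonneg (s≢ ∘ sym) (t≢ ∘ sym) s≢t)))
          where
          excess : ∀ p q → q ≡ p + (q + q) - (p + (+ 0 + q))
          excess = solve-∀

        -- The premises are never met: a vertex with two non-leaf neighbours is a non-leaf itself,
        -- and of the three at least two differ from `i₀`. Both would have excess q, too much for
        -- the sum p + q.
        thin : Thin i₀
        thin v s t Avs Avt s≢t ns nt with v ≟ i₀ | s ≟ i₀ | t ≟ i₀
        ... | yes refl | _ | _ = ⊥-elim (no-two s t s≢t (irreflexive A simple (trees zero) Avs ∘ sym) (irreflexive A simple (trees zero) Avt ∘ sym) ns nt)
        ... | no v≢ | yes refl | _ = ⊥-elim (no-two v t (irreflexive A simple (trees zero) Avt) v≢ (s≢t ∘ sym) (two-neighbours simple x deg-x Avs Avt s≢t) nt)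
        ... | no v≢ | no s≢ | _ = ⊥-elim (no-two v s (irreflexive A simple (trees zero) Avs) v≢ s≢ (two-neighbours simple x deg-x Avs Avt s≢t) ns)

        other : ∃ λ v → v ≢ i₀ × x v ≢ 0
        other with any? (λ v → ¬? (v ≟ i₀) ×-dec ¬? (x v ℕ.≟ 0))
        ... | yes found = found
        ... | no  none  = ⊥-elim (absurd (+<+ 1≤q) (≤-reflexive (trans (excess P Q) (trans (cong (λ z → z - P) (sym total)) (+-inverseʳ P)))))
          where
          zeros : ∀ l → X (punchIn i₀ l) ≡ + 0
          zeros l with x (punchIn i₀ l) ℕ.≟ 0
          ... | yes z  = cong +_ z
          ... | no  nz = contradiction (punchIn i₀ l , punchInᵢ≢i i₀ l , nz) none
          total : P ≡ P + (+ 0 + Q)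
          total = trans (sym (trans (∑-remove i₀ X) (trans (cong₂ _+_ (cong +_ x-i₀) (∑-0 zeros)) (+-identityʳ P)))) (trans M₁≡ (cong (λ z → P + (+ z + Q)) k≡0))
          excess : ∀ p q → q ≡ p + (+ 0 + q) - p
          excess = solve-∀

      double-star : Isomorphic A (H p (suc (suc k)) q)
      double-star = finish i₀ x-i₀ thin other

    module Long (k′ : ℕ) (k≡ : k ≡ suc k′)
      (M₄≡ : M₄ X + + 2 * edge-moment A X ≡ (P * P * P * P + (+ k + Q * Q * Q * Q)) + + 4 * (P + (+ k′ + Q))) where

      private
        U = edge-moment A X

        other : ∀ r → ∃ λ v → v ≢ r × x v ≢ 0
        other r with any? (λ v → ¬? (v ≟ r) ×-dec ¬? (x v ℕ.≟ 0))
        ... | yes found = found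
        -- If `r` were the only non-leaf, its excess would be p + k + q, but f₂(p + k + q) exceeds
        -- f₂(p) + f₂(q).
        ... | no  none  = ⊥-elim (absurd positive (≤-reflexive (trans (cong (λ z → f₂ z - (f₂ P + f₂ Q)) (sym (trans Xr (cong (λ z → P + (+ z + Q)) k≡)))) (trans (cong (λ z → z - (f₂ P + f₂ Q)) f₂-Xr) (+-inverseʳ (f₂ P + f₂ Q))))))
          where
          zeros : ∀ l → x (punchIn r l) ≡ 0
          zeros l with x (punchIn r l) ℕ.≟ 0
          ... | yes z  = z
          ... | no  nz = contradiction (punchIn r l , punchInᵢ≢i r l , nz) none
          Xr : X r ≡ P + (+ k + Q)
          Xr = trans (sym (trans (∑-remove r X) (trans (cong (λ z → X r + z) (∑-0 λ l → cong +_ (zeros l))) (+-identityʳ (X r))))) M₁≡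
          f₂-Xr : f₂ (X r) ≡ f₂ P + f₂ Q
          f₂-Xr = trans (sym (trans (∑-remove r (f₂ ∘ X)) (trans (cong (λ z → f₂ (X r) + z) (∑-0 λ l → cong (f₂ ∘ +_) (zeros l))) (+-identityʳ (f₂ (X r)))))) ∑f₂
          positive : + 0 ℤ.< f₂ (P + (+ suc k′ + Q)) - (f₂ P + f₂ Q)
          positive = subst (+ 0 ℤ.<_) (expand P Q (+ k′))
            (0<+ (0≤* (0≤ (suc k′)) (0≤+ (0≤+ (0≤* (0≤ 2) (0≤ p)) (0≤* (0≤ 2) (0≤ q))) (0≤ k′)))
                 (0<* (0<suc 1) (0<* (+<+ 1≤p) (+<+ 1≤q))))
            where
            expand : ∀ p q k → (+ 1 + k) * (+ 2 * p + + 2 * q + k) + + 2 * (p * q) ≡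
              (p + (+ 1 + k + q)) * (p + (+ 1 + k + q) - + 1) - (p * (p - + 1) + q * (q - + 1))
            expand = solve-∀

        nonleaf-neighbour : ∀ r → ∃ λ c → A r c ≡ true × x c ≢ 0
        nonleaf-neighbour r = let (v , v≢r , nv) = other r
                                  (c , c≢r , e , nc) = nonleaf-child-of-root simple x deg-x (trees r) v v≢r nv
                              in c , subst (λ u → A u c ≡ true) e (edge-down simple x deg-x (trees r) c≢r) , nc

        sign : ℕ → ℤ
        sign zero    = + 0
        sign (suc _) = + 1

        sign-nonneg : ∀ y → + 0 ℤ.≤ sign y
        sign-nonneg zero    = 0≤ 0
        sign-nonneg (suc _) = 0≤ 1

        sign-≢0 : ∀ {y} → y ≢ 0 → sign y ≡ + 1
        sign-≢0 {zero}  nz = contradiction refl nz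
        sign-≢0 {suc _} nz = refl

        -- `z` marks the non-leaves, `Y` is the y of the overview, made 0 on leaves by truncated
        -- subtraction, and `inner` is its d′.
        z Y inner : Fin m → ℤ
        z i = sign (x i)
        Y i = + (x i ℕ.∸ 1)
        inner i = ∑ λ j → z j * a A i j

        X-split : ∀ i → X i ≡ z i + Y i
        X-split i = split (x i)
          where
          split : ∀ y → + y ≡ sign y + + (y ℕ.∸ 1)
          split zero    = refl
          split (suc y) = refl

        zX : ∀ i → z i * X i ≡ X i
        zX i = absorb (x i)
          where
          absorb : ∀ y → sign y * + y ≡ + y
          absorb zero    = refl
          absorb (suc y) = *-identityˡ (+ suc y)

        -- The tree is not a star: rooted at `i`, it has another non-leaf, hence a non-leaf child of
        -- the root.
        inner-≥1 : ∀ i → + 1 ℤ.≤ inner i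
        inner-≥1 i with nonleaf-neighbour i
        ... | c , Aic , nc = subst (ℤ._≤ inner i) (cong₂ _*_ (sign-≢0 nc) (cong ⟦_⟧ Aic))
                (∑-term-≤ (λ j → z j * a A i j) (λ j → 0≤* (sign-nonneg (x j)) (⟦⟧-nonneg (A i j))) c)

        -- A leaf has exactly one neighbour, and that is a non-leaf. The product form can be summed
        -- without a case distinction.
        inner-leaf : ∀ i → (+ 1 - z i) * (inner i - + 1) ≡ + 0
        inner-leaf i with x i in e
        ... | suc y = refl
        ... | zero  = trans (*-identityˡ _) (i≡j⇒i-j≡0 (≤-antisym (≤-trans below (≤-reflexive (trans (sym (deg-∑ A i)) (trans (deg-x i) (cong (λ y → + 1 + + y) e))))) (inner-≥1 i)))
          where
          term-≤ : ∀ y b → sign y * ⟦ b ⟧ ℤ.≤ ⟦ b ⟧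
          term-≤ zero    b = ⟦⟧-nonneg b
          term-≤ (suc y) b = ≤-reflexive (*-identityˡ ⟦ b ⟧)
          below : inner i ℤ.≤ ∑ (a A i)
          below = 0≤i-j⇒j≤i (subst (+ 0 ℤ.≤_) (∑-- (a A i) (λ j → z j * a A i j)) (∑-nonneg (λ j → a A i j - z j * a A i j) λ j → i≤j⇒0≤j-i (term-≤ (x j) (A i j))))

        ∑-inner : ∑ inner ≡ ∑ z + ∑ X
        ∑-inner = trans (∑-edges-right A simple (trees zero) z) (trans (∑-cong λ i → trans (cong (z i *_) (deg-x i)) (trans (distrib (z i) (X i)) (cong (λ y → z i + y) (zX i)))) (∑-+ z X))
          where
          distrib : ∀ z x → z * (+ 1 + x) ≡ z + z * x
          distrib = solve-∀

        -- The non-leaves induce a tree, whose degrees sum to twice its order minus 2. This is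
        -- derived by counting: `∑-inner` is the sum over all vertices, and each leaf accounts for
        -- exactly 1 of it.
        ∑-z-inner : ∑ (λ i → z i * inner i) ≡ + 2 * ∑ z - + 2
        ∑-z-inner = begin
          ∑ (λ i → z i * inner i)
            ≡⟨ ∑-cong (λ i → trans (rewrite₁ (z i) (inner i)) (trans (cong (λ y → (inner i - + 1) + z i - y) (inner-leaf i)) (+-identityʳ _))) ⟩
          ∑ (λ i → (inner i - + 1) + z i)
            ≡⟨ trans (∑-+ (λ i → inner i - + 1) z) (cong (λ y → y + ∑ z) (trans (∑-- inner (λ _ → + 1)) (cong₂ _-_ ∑-inner (∑-const m (+ 1))))) ⟩
          (∑ z + ∑ X - + m * + 1) + ∑ z
            ≡⟨ cong (λ y → (∑ z + y - + m * + 1) + ∑ z) ∑X-m ⟩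
          (∑ z + (+ m - + 2) - + m * + 1) + ∑ z
            ≡⟨ collect (∑ z) (+ m) ⟩
          + 2 * ∑ z - + 2 ∎
          where
          open ≡-Reasoning
          rewrite₁ : ∀ z d → z * d ≡ (d - + 1) + z - (+ 1 - z) * (d - + 1)
          rewrite₁ = solve-∀
          collect : ∀ z m → (z + (m - + 2) - m * + 1) + z ≡ + 2 * z - + 2
          collect = solve-∀

        -- The amount by which the edge moment exceeds the value 2(∑x - 1) attained by H(p,n,q);
        -- both summands are nonnegative.
        E : ℤ
        E = edge-moment A Y + + 2 * ∑ (λ i → Y i * (inner i - + 1))

        Y-inner-nonneg : ∀ i → + 0 ℤ.≤ Y i * (inner i - + 1)
        Y-inner-nonneg i = 0≤* (0≤ (x i ℕ.∸ 1)) (i≤j⇒0≤j-i (inner-≥1 i))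

        edge-moment-nonneg : + 0 ℤ.≤ edge-moment A Y
        edge-moment-nonneg = ∑-nonneg _ λ i → ∑-nonneg (λ j → Y i * Y j * a A i j) λ j →
          0≤* (0≤* (0≤ (x i ℕ.∸ 1)) (0≤ (x j ℕ.∸ 1))) (⟦⟧-nonneg (A i j))

        ∑∑-inner : (f : Fin m → ℤ) → ∑ (λ i → ∑ λ j → f i * z j * a A i j) ≡ ∑ (λ i → f i * inner i)
        ∑∑-inner f = ∑-cong λ i → trans (∑-cong λ j → *-assoc (f i) (z j) (a A i j)) (∑-* (f i) (λ j → z j * a A i j))

        ∑∑-inner′ : (f : Fin m → ℤ) → ∑ (λ i → ∑ λ j → z i * f j * a A i j) ≡ ∑ (λ i → f i * inner i)
        ∑∑-inner′ f = trans (∑-swap (λ i j → z i * f j * a A i j)) (trans (∑-cong λ j → ∑-cong λ i →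
          trans (cong (z i * f j *_) (a-sym A simple i j)) (cong (_* a A j i) (*-comm (z i) (f j)))) (∑∑-inner f))

        -- Splitting x into the indicator z of non-leaves and the excess Y.
        U-split : U ≡ + 2 * ∑ X - + 2 + E
        U-split = begin
          U
            ≡⟨ ∑-cong (λ i → trans (∑-cong λ j → trans (cong₂ (λ s t → s * t * a A i j) (X-split i) (X-split j)) (expand (z i) (Y i) (z j) (Y j) (a A i j)))
                 (trans (∑-+ (λ j → z i * z j * a A i j + z i * Y j * a A i j) (λ j → Y i * z j * a A i j + Y i * Y j * a A i j))
                   (cong₂ _+_ (∑-+ (λ j → z i * z j * a A i j) (λ j → z i * Y j * a A i j)) (∑-+ (λ j → Y i * z j * a A i j) (λ j → Y i * Y j * a A i j))))) ⟩
          ∑ (λ i → (∑ (λ j → z i * z j * a A i j) + ∑ (λ j → z i * Y j * a A i j)) + (∑ (λ j → Y i * z j * a A i j) + ∑ (λ j → Y i * Y j * a A i j)))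
            ≡⟨ trans (∑-+ (λ i → ∑ (λ j → z i * z j * a A i j) + ∑ (λ j → z i * Y j * a A i j)) (λ i → ∑ (λ j → Y i * z j * a A i j) + ∑ (λ j → Y i * Y j * a A i j)))
                 (cong₂ _+_ (∑-+ (λ i → ∑ (λ j → z i * z j * a A i j)) (λ i → ∑ (λ j → z i * Y j * a A i j)))
                            (∑-+ (λ i → ∑ (λ j → Y i * z j * a A i j)) (λ i → ∑ (λ j → Y i * Y j * a A i j)))) ⟩
          (∑ (λ i → ∑ (λ j → z i * z j * a A i j)) + ∑ (λ i → ∑ (λ j → z i * Y j * a A i j))) + (∑ (λ i → ∑ (λ j → Y i * z j * a A i j)) + edge-moment A Y)
            ≡⟨ cong₂ _+_ (cong₂ _+_ (trans (∑∑-inner z) ∑-z-inner) (∑∑-inner′ Y)) (cong (λ s → s + edge-moment A Y) (∑∑-inner Y)) ⟩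
          (+ 2 * ∑ z - + 2 + ∑ (λ i → Y i * inner i)) + (∑ (λ i → Y i * inner i) + edge-moment A Y)
            ≡⟨ cong (λ s → (+ 2 * ∑ z - + 2 + s) + (s + edge-moment A Y)) (trans (∑-cong λ i → shift (Y i) (inner i)) (∑-+ (λ i → Y i * (inner i - + 1)) Y)) ⟩
          (+ 2 * ∑ z - + 2 + (S + ∑ Y)) + ((S + ∑ Y) + edge-moment A Y)
            ≡⟨ collect (∑ z) S (∑ Y) (edge-moment A Y) ⟩
          + 2 * (∑ z + ∑ Y) - + 2 + E
            ≡⟨ cong (λ s → + 2 * s - + 2 + E) (sym (trans (∑-cong X-split) (∑-+ z Y))) ⟩
          + 2 * ∑ X - + 2 + E ∎
          where
          open ≡-Reasoning
          S = ∑ (λ i → Y i * (inner i - + 1))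
          expand : ∀ z y w v a → (z + y) * (w + v) * a ≡ (z * w * a + z * v * a) + (y * w * a + y * v * a)
          expand = solve-∀
          shift : ∀ y d → y * d ≡ y * (d - + 1) + y
          shift = solve-∀
          collect : ∀ z s y u → (+ 2 * z - + 2 + (s + y)) + ((s + y) + u) ≡ + 2 * (z + y) - + 2 + (u + + 2 * s)
          collect = solve-∀

        -- Zero at 0, 1 and q, nonnegative on ℕ, and of leading coefficient 1.
        F : ℤ → ℤ
        F y = f₂ y * ((y - Q) * (y - Q))

        F-nonneg : ∀ y → + 0 ℤ.≤ F (+ y)
        F-nonneg y = 0≤* (f₂-nonneg y) (square-nonneg (+ y - Q))

        F-sum : ∑ (λ i → F (X i)) + + 2 * E ≡ F P
        F-sum = trans (cong (λ s → s + + 2 * E) (trans (∑-cong λ i → quartic-expand (X i) Q)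
            (∑-quartic (+ 0) (- (Q * Q)) (+ 2 * Q + Q * Q) (- (+ 1 + + 2 * Q)) (+ 1) X)))
          (quartic-eliminate (+ m) (∑ X) (M₂ X) (M₃ X) (M₄ X) U E P Q (+ k) (+ k′) (cong +_ k≡) M₁≡ M₂≡ M₃≡ M₄≡ U-split)

        E-nonneg : + 0 ℤ.≤ E
        E-nonneg = 0≤+ edge-moment-nonneg (0≤* (0≤ 2) (∑-nonneg _ Y-inner-nonneg))

        i₀ = proj₁ large

        F-i₀ : F (X i₀) + + 2 * E ℤ.≤ F P
        F-i₀ = subst (F (X i₀) + + 2 * E ℤ.≤_) F-sum (+-monoˡ-≤ (+ 2 * E) (∑-term-≤ (F ∘ X) (λ i → F-nonneg (x i)) i₀))

        -- F grows strictly from p = q + w on: adding T ≥ 1 increases p(p-1) by (2p-1)T + T² and w²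
        -- by 2wT + T².
        F-gap : ∀ q′ w t → let q = + suc q′ ; p = q + + w ; T = + suc t in
          + 0 ℤ.< (p + T) * (p + T - + 1) * ((p + T - q) * (p + T - q)) - p * (p - + 1) * ((p - q) * (p - q))
        F-gap q′ w t = subst (+ 0 ℤ.<_) (expand (+ q′) (+ w) (+ suc t))
          (0<+ (0≤+ (0≤* (0≤* (0≤ (suc (q′ ℕ.+ w))) (0≤ (q′ ℕ.+ w))) (0≤+ (0≤* (0≤* (0≤ 2) (0≤ w)) (0≤ (suc t))) (0≤* (0≤ (suc t)) (0≤ (suc t)))))
                    (0≤* (0≤* (0≤ (suc (q′ ℕ.+ w) ℕ.+ (q′ ℕ.+ w))) (0≤ (suc t))) (square-nonneg (+ w + + suc t))))
               (0<* (0<* (0<suc t) (0<suc t)) (0<* (0<+ (0≤ w) (0<suc t)) (0<+ (0≤ w) (0<suc t)))))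
          where
          expand : ∀ q′ w t → let A = + 1 + (q′ + w) ; B = q′ + w ; q = + 1 + q′ ; p = q + w in
            (A * B * (+ 2 * w * t + t * t) + (A + B) * t * ((w + t) * (w + t))) + t * t * ((w + t) * (w + t)) ≡
            (p + t) * (p + t - + 1) * ((p + t - q) * (p + t - q)) - p * (p - + 1) * ((p - q) * (p - q))
          expand = solve-∀

        x-i₀ : x i₀ ≡ p
        x-i₀ with ℕₚ.m≤n⇒∃[o]m+o≡n (proj₂ large) | ℕₚ.m≤n⇒∃[o]m+o≡n q≤p | ℕₚ.m≤n⇒∃[o]m+o≡n 1≤q
        ... | zero  , e | _ | _ = trans (sym e) (ℕₚ.+-identityʳ p)
        ... | suc t , e | w , e′ | q′ , e″ = ⊥-elim (contradict e e′ e″ (≤-trans (subst (ℤ._≤ F (X i₀) + + 2 * E) (+-identityʳ (F (X i₀))) (+-monoʳ-≤ (F (X i₀)) (0≤* (0≤ 2) E-nonneg))) F-i₀))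
          where
          contradict : ∀ {p q y} → p ℕ.+ suc t ≡ y → q ℕ.+ w ≡ p → 1 ℕ.+ q′ ≡ q → f₂ (+ y) * ((+ y - + q) * (+ y - + q)) ℤ.≤ f₂ (+ p) * ((+ p - + q) * (+ p - + q)) → ⊥
          contradict refl refl refl h = absurd (F-gap q′ w t) (i≤j⇒i-j≤0 h)

        -- Once x = p at `i₀`, the inequality `F-i₀` reads F(p) + 2E ≤ F(p).
        E≤0 : E ℤ.≤ + 0
        E≤0 = *-cancelˡ-≤-pos E (+ 0) (+ 2) (subst (ℤ._≤ + 0) (drop (F P) (+ 2 * E)) (i≤j⇒i-j≤0 (subst (λ y → F (+ y) + + 2 * E ℤ.≤ F P) x-i₀ F-i₀)))
          where
          drop : ∀ f e → f + e - f ≡ e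
          drop = solve-∀

        Y-inner : ∀ i → Y i * (inner i - + 1) ≡ + 0
        Y-inner = ∑-vanish (λ i → Y i * (inner i - + 1)) Y-inner-nonneg (*-cancelˡ-≤-pos _ (+ 0) (+ 2)
          (≤-trans (subst (ℤ._≤ E) (+-identityˡ _) (+-monoˡ-≤ (+ 2 * ∑ (λ i → Y i * (inner i - + 1))) edge-moment-nonneg)) E≤0))

        -- Two non-leaf neighbours make `inner v` at least 2, so `Y-inner` forces Y v = 0; and `v`
        -- is a non-leaf.
        thin₀ : ∀ v s t → A v s ≡ true → A v t ≡ true → s ≢ t → x s ≢ 0 → x t ≢ 0 → x v ≡ 1
        thin₀ v s t Avs Avt s≢t ns nt = cases (i*j≡0⇒i≡0∨j≡0 (Y v) (Y-inner v))
          where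
          one : ∀ y → y ℕ.∸ 1 ≡ 0 → y ≢ 0 → y ≡ 1
          one zero       _ nz = contradiction refl nz
          one (suc zero) _ _  = refl
          two-inner : + 2 ℤ.≤ inner v
          two-inner = subst (ℤ._≤ inner v) (cong₂ _+_ (cong₂ _*_ (sign-≢0 ns) (cong ⟦_⟧ Avs)) (cong₂ _*_ (sign-≢0 nt) (cong ⟦_⟧ Avt)))
            (∑-two (λ j → z j * a A v j) (λ j → 0≤* (sign-nonneg (x j)) (⟦⟧-nonneg (A v j))) s≢t)
          cases : Y v ≡ + 0 ⊎ inner v - + 1 ≡ + 0 → x v ≡ 1
          cases (inj₁ h) = one (x v) (+-injective h) (two-neighbours simple x deg-x Avs Avt s≢t)
          cases (inj₂ h) = contradiction (subst (+ 2 ℤ.≤_) (i-j≡0⇒i≡j (inner v) (+ 1) h) two-inner) λ { (+≤+ (s≤s ())) }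

        leaf : ∃ λ v → x v ≡ 0
        leaf with any? (λ v → x v ℕ.≟ 0)
        ... | yes found = found
        ... | no  none  = ⊥-elim (absurd {+ 2} (0<suc 1) (subst (ℤ._≤ + 0) (collect (+ m)) (i≤j⇒i-j≤0 (subst₂ ℤ._≤_ (trans (∑-const m (+ 1)) (*-identityʳ (+ m))) ∑X-m below))))
          where
          collect : ∀ m → m - (m - + 2) ≡ + 2
          collect = solve-∀
          below : ∑ {m} (λ _ → + 1) ℤ.≤ ∑ X
          below = 0≤i-j⇒j≤i (subst (+ 0 ℤ.≤_) (∑-- X (λ _ → + 1)) (∑-nonneg (λ i → X i - + 1) λ i → i≤j⇒0≤j-i (+≤+ (ℕₚ.n≢0⇒n>0 λ e → none (i , e)))))

      long : Isomorphic A (H p (suc (suc k)) q)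
      long with 2 ≤? p
      ... | yes 2≤p = finish i₀ x-i₀ (λ v s t Avs Avt s≢t ns nt → let xv = thin₀ v s t Avs Avt s≢t ns nt in
                        (λ { refl → ℕₚ.<⇒≢ 2≤p (trans (sym xv) x-i₀) }) , xv) (other i₀)
      -- For p = q = 1 the target is a path, and `i₀` may lie in its middle. The root must be the
      -- neighbour of a leaf: it has degree 2 and one leaf neighbour, so only one non-leaf
      -- neighbour.
      ... | no  2≰p = finish c xc thin (other c)
        where
        p≡1 : p ≡ 1
        p≡1 = ℕₚ.≤-antisym (ℕₚ.≤-pred (ℕₚ.≰⇒> 2≰p)) 1≤p
        q≡1 : q ≡ 1
        q≡1 = ℕₚ.≤-antisym (subst (q ℕ.≤_) p≡1 q≤p) 1≤q
        l = proj₁ leaf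
        c = proj₁ (nonleaf-neighbour l)
        Alc = proj₁ (proj₂ (nonleaf-neighbour l))
        nc = proj₂ (proj₂ (nonleaf-neighbour l))
        xc₁ : x c ≡ 1
        xc₁ = f₂-zero (x c) (∑-vanish (f₂ ∘ X) (λ i → f₂-nonneg (x i)) (≤-reflexive (trans ∑f₂ (cong₂ (λ y z → f₂ (+ y) + f₂ (+ z)) p≡1 q≡1))) c) nc
        xc : x c ≡ p
        xc = trans xc₁ (sym p≡1)
        thin : Thin c
        thin v s t Avs Avt s≢t ns nt = (λ { refl → three-neighbours simple x deg-x (trans (proj₁ simple c l) Alc) Avs Avt
          (λ { refl → ns (proj₂ leaf) }) (λ { refl → nt (proj₂ leaf) }) s≢t xc₁ }) , thin₀ v s t Avs Avt s≢t ns nt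

-- Graphs cospectral with H(p,n,q): tree structure, moments and the case distinction on n.

module Cospectral where

  open import Data.Bool using (Bool; true; false; not)
  open import Data.Fin as Fin using (Fin; zero; suc; punchIn; punchOut; _≟_; toℕ)
  open import Data.Fin.Properties using (any?; punchIn-punchOut)
  open import Data.Integer using (ℤ; +_; -_; _+_; _*_; _-_; +<+)
  import Data.Integer as ℤ
  open import Data.Integer.Properties hiding (_≟_; _≤?_; _<?_)
  open import Data.Integer.Tactic.RingSolver using (solve-∀)
  open import Data.Nat as ℕ using (ℕ; zero; suc; z≤n; s≤s; _≤_)
  import Data.Nat.Properties as ℕₚ
  open import Data.Product using (∃; _×_; _,_; proj₁; proj₂)
  open import Data.Sum using (_⊎_; inj₁; inj₂)
  open import Function using (_∘_)
  open import Function.Bundles using (Inverse; mk↔ₛ′)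
  open import Relation.Binary.PropositionalEquality
  open import Relation.Nullary using (does; yes; no; contradiction; ¬?)
  open import Relation.Nullary.Decidable using (dec-false)

  open import Defs using (Adj; IsSimple; Isomorphic; LCospectral; laplacian; degree; countFin; H)
  open Series
  open CharPoly
  open Graph
  open Traces
  open DoubleBroom
  open Moments
  open DegreeSequence
  open Isomorphism
  open Reconstruction
  open ℤ-Det using (∑-cong; ∑-+; ∑-*; ∑-0; ∑-swap; ∑-remove)

  isomorphic-sym : ∀ {m k} {A : Adj m} {B : Adj k} → Isomorphic A B → Isomorphic B A
  isomorphic-sym {A = A} {B} (f , h) = mk↔ₛ′ from to strictlyInverseʳ strictlyInverseˡ
    , λ i j → trans (cong₂ B (sym (strictlyInverseˡ i)) (sym (strictlyInverseˡ j))) (sym (h (from i) (from j)))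
    where open Inverse f

  isomorphic-trans : ∀ {m k l} {A : Adj m} {B : Adj k} {C : Adj l} → Isomorphic A B → Isomorphic B C → Isomorphic A C
  isomorphic-trans {A = A} {B} {C} (f , h) (g , k) = mk↔ₛ′ (g.to ∘ f.to) (f.from ∘ g.from)
    (λ y → trans (cong g.to (f.strictlyInverseˡ (g.from y))) (g.strictlyInverseˡ y))
    (λ x → trans (cong f.from (g.strictlyInverseʳ (f.to x))) (f.strictlyInverseʳ x))
    , λ i j → trans (h i j) (k (f.to i) (f.to j))
    where
    module f = Inverse f
    module g = Inverse g

  module _ {M} {A : Adj (suc (suc M))} (simple : IsSimple A) (trees : ∀ r → RootedTree A r) where

    excess : Fin (suc (suc M)) → ℕ
    excess i = degree A i ℕ.∸ 1

    deg-excess : ∀ i → deg A i ≡ + 1 + + excess i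
    deg-excess i = cong +_ (sym (ℕₚ.m+[n∸m]≡n (positive i)))
      where
      has-neighbour : ∀ i j → A i j ≡ true → 1 ℕ.≤ degree A i
      has-neighbour i j Aij = drop‿+≤+ (subst₂ ℤ._≤_ (cong ⟦_⟧ Aij) (sym (deg-∑ A i)) (∑-term-≤ (a A i) (λ l → ⟦⟧-nonneg (A i l)) j))
      positive : ∀ i → 1 ℕ.≤ degree A i
      -- Rooting the tree at another vertex gives every vertex a parent, so truncated subtraction
      -- loses nothing; this takes two vertices.
      positive zero    = has-neighbour zero _ (RootedTree.edge (trees (suc zero)) λ ())
      positive (suc i) = has-neighbour (suc i) _ (RootedTree.edge (trees zero) λ ())

  module _ {n} {A B : Adj (suc n)} (A-simple : IsSimple A) (B-simple : IsSimple B) {s : Fin (suc n)} (T : RootedTree B s)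
           (χ≢0 : χ (laplacian B) 1 ≢ + 0) (1≤n : 1 ℕ.≤ n) (cospectral : χ (laplacian A) ≗ χ (laplacian B)) where

    opaque
      -- The coefficient of x makes the graph connected and the first trace is twice its number of
      -- edges, so a spanning tree contains all of them.
      cospectral-tree : ∀ r → RootedTree A r
      cospectral-tree r = spanning⇒tree A (connected⇒spanning A A-simple
          (χ-at-1≢0⇒connected A A-simple λ e → χ≢0 (trans (sym (cospectral 1)) e)) r) A-simple total
        where
        total : edge-total A ≡ + 2 * (+ suc n - + 1)
        total = trans (∑-cong λ i → sym (deg-∑ A i)) (trans (sym (trace-1 A A-simple))
          (trans (cospectral-traces (laplacian A) (laplacian B) cospectral 1 1≤n) (trans (trace-1 B B-simple)
          (trans (∑-cong (deg-∑ B)) (tree-edge-total B B-simple T)))))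

  module _ (p q : ℕ) (1≤p : 1 ℕ.≤ p) (1≤q : 1 ℕ.≤ q) where

    private
      P = + p
      Q = + q

    -- For n = 1 both bunches hang on one vertex, of excess S = p + q - 1. The moments ∑x = S and
    -- ∑x² = S² already characterize the star.
    module Star {A : Adj (suc (p ℕ.+ q))} (simple : IsSimple A) (cospectral : χ (laplacian A) ≗ χ (laplacian (H p 1 q)))
      (trees : ∀ r → RootedTree A r) where

      private
        N : ℕ
        N = suc (p ℕ.+ q)

        2≤p+q : 2 ℕ.≤ p ℕ.+ q
        2≤p+q = ℕₚ.+-mono-≤ 1≤p 1≤q

        shape : ∃ λ M → p ℕ.+ q ≡ suc M
        shape = p ℕ.+ q ℕ.∸ 1 , sym (ℕₚ.m+[n∸m]≡n (ℕₚ.≤-trans (s≤s z≤n) 2≤p+q))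

      star-from : (x : Fin N → ℕ) → (∀ i → deg A i ≡ + 1 + + x i) → Isomorphic A (H p 1 q)
      star-from x deg-x = let (c , nc) = nonleaf in centred c nc
        where
        X : Fin N → ℤ
        X i = + x i
        S = P + Q - + 1
        ∑X : ∑ X ≡ S
        ∑X = trans (∑-excess A simple (trees zero) X deg-x) (collect P Q)
          where
          collect : ∀ p q → + 1 + (p + q) - + 2 ≡ p + q - + 1
          collect = solve-∀
        M₂X : M₂ X ≡ S * S
        M₂X = trans (cospectral-M₂ simple (H-simple p 0 q) (trees zero) (H-tree p 0 q) X (excessℕ p 0 q ∘ toℕ) deg-x (H-degree p 0 q) cospectral 2≤p+q)
          (trans (∑-pendants p 0 q (λ y → y * y) refl) (collect P Q))
          where
          collect : ∀ p q → (+ 0 - + 1 + p * + 1 + q * + 1) * (+ 0 - + 1 + p * + 1 + q * + 1) + + 0 ≡ (p + q - + 1) * (p + q - + 1)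
          collect = solve-∀
        X≤S : ∀ i → X i ℤ.≤ S
        X≤S i = subst (X i ℤ.≤_) ∑X (∑-term-≤ X (λ j → 0≤ (x j)) i)
        -- Every x lies between 0 and S, and ∑x(S - x) = S·S - S² = 0, so each x is 0 or S.
        X[S-X] : ∀ i → X i * (S - X i) ≡ + 0
        X[S-X] = ∑-vanish (λ i → X i * (S - X i)) (λ i → 0≤* (0≤ (x i)) (i≤j⇒0≤j-i (X≤S i)))
          (≤-reflexive (trans (∑-cong λ i → expand S (X i)) (trans (∑-linear (- + 1) (λ i → S * X i) (λ i → X i * X i))
            (trans (cong₂ (λ y z → y + - + 1 * z) (trans (∑-* S X) (cong (S *_) ∑X)) M₂X) (cancel (S * S))))))
          where
          expand : ∀ s x → x * (s - x) ≡ s * x + - + 1 * (x * x)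
          expand = solve-∀
          cancel : ∀ y → y + - + 1 * y ≡ + 0
          cancel = solve-∀
        nonleaf : ∃ λ c → x c ≢ 0
        nonleaf with any? (λ c → ¬? (x c ℕ.≟ 0))
        ... | yes found = found
        ... | no  none  = contradiction (trans (sym (∑-0 {f = X} zeros)) ∑X) (<⇒≢ (subst (+ 0 ℤ.<_) refl (positive p q 1≤p 1≤q)))
          where
          zeros : ∀ i → X i ≡ + 0
          zeros i with x i ℕ.≟ 0
          ... | yes e  = cong +_ e
          ... | no  ne = contradiction (i , ne) none
          positive : ∀ p q → 1 ℕ.≤ p → 1 ℕ.≤ q → + 0 ℤ.< + p + + q - + 1
          positive (suc p) (suc q) _ _ = subst (λ y → + 0 ℤ.< + y) (sym (ℕₚ.+-suc p q)) (+<+ (s≤s z≤n))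
        centred : ∀ c → x c ≢ 0 → Isomorphic A (H p 1 q)
        centred c nc = tree-isomorphism simple T p 0 q F refl commute injective surjective
          where
          T = trees c
          open RootedTree T
          Xc : X c ≡ S
          Xc = cases (i*j≡0⇒i≡0∨j≡0 (X c) (X[S-X] c))
            where
            cases : X c ≡ + 0 ⊎ S - X c ≡ + 0 → X c ≡ S
            cases (inj₁ e) = contradiction (+-injective e) nc
            cases (inj₂ e) = sym (i-j≡0⇒i≡j S (X c) e)
          leaves : ∀ v → v ≢ c → x v ≡ 0
          leaves v v≢c = +-injective (subst (λ u → X u ≡ + 0) (punchIn-punchOut (v≢c ∘ sym))
            (∑-vanish (X ∘ punchIn c) (λ l → 0≤ (x (punchIn c l))) (≤-reflexive (trans (drop (X c) _) (trans (cong₂ _-_ (trans (sym (∑-remove c X)) ∑X) Xc) (+-inverseʳ S)))) (punchOut (v≢c ∘ sym))))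
            where
            drop : ∀ a b → b ≡ a + b - a
            drop = solve-∀
          par≡c : ∀ v → v ≢ c → par v ≡ c
          par≡c v v≢c with par v ≟ c
          ... | yes e = e
          ... | no ne = contradiction (leaves (par v) ne) (parent-nonleaf simple x deg-x T v≢c ne)
          isLeaf : Fin N → Bool
          isLeaf v = not (does (v ≟ c))
          module L = Enumeration (enumeration c isLeaf)
          count : countFin N isLeaf ≡ p ℕ.+ q
          count = +-injective (trans (count-∑ N isLeaf) (trans (∑-cong term) (trans (∑-- (λ _ → + 1) (λ v → δ c v * + 1))
              (trans (cong₂ _-_ (trans (∑-const N (+ 1)) (*-identityʳ (+ N))) (∑-δ c (λ _ → + 1))) refl))))
            where
            term : ∀ v → ⟦ isLeaf v ⟧ ≡ + 1 - δ c v * + 1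
            term v with v ≟ c
            ... | yes refl = cong (λ y → + 1 - y * + 1) (sym (δ-refl c))
            ... | no  v≢c  = cong (λ y → + 1 - y * + 1) (sym (δ-≢ {i = c} {v} (v≢c ∘ sym)))
          isLeaf⁻¹ : ∀ v → isLeaf v ≡ true → v ≢ c
          isLeaf⁻¹ v h with v ≟ c
          ... | no v≢c = v≢c
          F : ℕ → Fin N
          F zero    = c
          F (suc l) = L.e l
          below : ∀ {l} → suc l ℕ.< N → l ℕ.< countFin N isLeaf
          below {l} (s≤s h) = subst (l ℕ.<_) (sym count) h
          F≢c : ∀ {l} → suc l ℕ.< N → F (suc l) ≢ c
          F≢c h = isLeaf⁻¹ _ (L.hits _ (below h))
          commute : ∀ i → i ≢ 0 → i ℕ.< N → par (F i) ≡ F (parentℕ p 1 i)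
          commute zero    i≢0 _ = contradiction refl i≢0
          commute (suc l) _   h = trans (par≡c _ (F≢c h)) (cong F (sym (root l)))
            where
            root : ∀ l → parentℕ p 1 (suc l) ≡ 0
            root l with suc l ℕ.<ᵇ suc p
            ... | true  = refl
            ... | false = refl
          injective : ∀ i j → i ℕ.< N → j ℕ.< N → F i ≡ F j → i ≡ j
          injective zero    zero    _ _ _ = refl
          injective zero    (suc j) _ h e = contradiction (sym e) (F≢c h)
          injective (suc i) zero    h _ e = contradiction e (F≢c h)
          injective (suc i) (suc j) h k e = cong suc (L.inj i j (below h) (below k) e)
          surjective : ∀ v → ∃ λ i → i ℕ.< N × F i ≡ v
          surjective v with v ≟ c
          ... | yes refl = 0 , s≤s z≤n , refl
          ... | no  v≢c  = let (l , l<c , e) = L.surj v (cong not (dec-false (v ≟ c) v≢c)) in suc l , s≤s (subst (l ℕ.<_) count l<c) , e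

      star : Isomorphic A (H p 1 q)
      star = star-from (λ i → degree A i ℕ.∸ 1) λ i → positive (proj₁ shape) (proj₂ shape) trees i
        where
        positive : ∀ M → p ℕ.+ q ≡ suc M → (∀ r → RootedTree A r) → ∀ i → deg A i ≡ + 1 + + (degree A i ℕ.∸ 1)
        positive M e = lemma e A simple
          where
          lemma : ∀ {K M} → K ≡ suc M → (A : Adj (suc K)) → IsSimple A → (∀ r → RootedTree A r) → ∀ i → deg A i ≡ + 1 + + (degree A i ℕ.∸ 1)
          lemma refl A simple trees = deg-excess simple trees

    module Broomlike (k : ℕ) {A : Adj (suc (suc k) ℕ.+ p ℕ.+ q)} (simple : IsSimple A)
      (cospectral : χ (laplacian A) ≗ χ (laplacian (H p (suc (suc k)) q))) (trees : ∀ r → RootedTree A r) where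

      private
        -- The right side is the order minus one, the bound in Newton's identities: j = 0 allows the
        -- third moment, and j = 1, which takes k ≥ 1, the fourth.
        size-≤ : ∀ j → suc (suc j) ℕ.≤ suc (suc k) → suc (suc (suc j)) ℕ.≤ suc k ℕ.+ p ℕ.+ q
        size-≤ j h = subst (ℕ._≤ suc k ℕ.+ p ℕ.+ q) (trans (ℕₚ.+-comm (suc j ℕ.+ 1) 1) (cong suc (ℕₚ.+-comm (suc j) 1))) (ℕₚ.+-mono-≤ (ℕₚ.+-mono-≤ (ℕₚ.≤-pred h) 1≤p) 1≤q)

        x : Fin (suc (suc k) ℕ.+ p ℕ.+ q) → ℕ
        x = excess simple trees

        X y : Fin (suc (suc k) ℕ.+ p ℕ.+ q) → ℤ
        X i = + x i
        y i = excessℕ p (suc k) q (toℕ i)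

        deg-x : ∀ i → deg A i ≡ + 1 + X i
        deg-x = deg-excess simple trees

        moment₂ : M₂ X ≡ P * P + (+ k + Q * Q)
        moment₂ = trans (cospectral-M₂ simple (H-simple p (suc k) q) (trees zero) (H-tree p (suc k) q) X y deg-x (H-degree p (suc k) q) cospectral
            (ℕₚ.≤-trans (ℕₚ.n≤1+n 2) (size-≤ 0 (s≤s (s≤s z≤n)))))
          (trans (∑-path p k q (λ y → y * y) refl) (cong (λ z → P * P + (z + Q * Q)) (*-identityʳ (+ k))))

        moment₃ : M₃ X ≡ P * P * P + (+ k + Q * Q * Q)
        moment₃ = trans (cospectral-M₃ simple (H-simple p (suc k) q) (trees zero) (H-tree p (suc k) q) X y deg-x (H-degree p (suc k) q) cospectral
            (size-≤ 0 (s≤s (s≤s z≤n))))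
          (trans (∑-path p k q (λ y → y * y * y) refl) (cong (λ z → P * P * P + (z + Q * Q * Q)) (*-identityʳ (+ k))))

        moment₄ : ∀ k′ → k ≡ suc k′ → M₄ X + + 2 * edge-moment A X ≡ (P * P * P * P + (+ k + Q * Q * Q * Q)) + + 4 * (P + (+ k′ + Q))
        moment₄ k′ e = trans (cospectral-M₄ simple (H-simple p (suc k) q) (trees zero) (H-tree p (suc k) q) X y deg-x (H-degree p (suc k) q) cospectral
            (size-≤ 1 (subst (λ z → 3 ℕ.≤ suc (suc z)) (sym e) (s≤s (s≤s (s≤s z≤n))))))
          (trans (cong₂ (λ s t → s + + 2 * t) (trans (∑-path p k q (λ y → y * y * y * y) refl) (cong (λ z → P * P * P * P + (z + Q * Q * Q * Q)) (*-identityʳ (+ k))))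
            (trans (∑-edges p (suc k) q) (cong (+ 2 *_) (edges k′ e))))
            (collect (P * P * P * P + (+ k + Q * Q * Q * Q)) (P + (+ k′ + Q))))
          where
          edges : ∀ k′ → k ≡ suc k′ → ∑< (suc k) (λ j → excessℕ p (suc k) q (suc j) * excessℕ p (suc k) q j) ≡ P + (+ k′ + Q)
          edges k′ refl = ∑-path-edges p k′ q
          collect : ∀ s t → s + + 2 * (+ 2 * t) ≡ s + + 4 * t
          collect = solve-∀

      sorted : q ℕ.≤ p → Isomorphic A (H p (suc (suc k)) q)
      sorted q≤p = by k refl
        where
        by : ∀ j → k ≡ j → Isomorphic A (H p (suc (suc k)) q)
        by zero     e = Double.double-star simple trees x deg-x p q k 1≤q q≤p refl moment₂ moment₃ e
        by (suc k′) e = Long.long simple trees x deg-x p q k 1≤q q≤p refl moment₂ moment₃ k′ e (moment₄ k′ e)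

      -- The moments are symmetric in p and q, so the reconstruction applies with the roles
      -- exchanged and yields the mirrored tree.
      swapped : p ℕ.≤ q → Isomorphic A (H q (suc (suc k)) p)
      swapped p≤q = by k refl
        where
        size : suc (suc k) ℕ.+ p ℕ.+ q ≡ suc (suc k) ℕ.+ q ℕ.+ p
        size = trans (ℕₚ.+-assoc (suc (suc k)) p q) (trans (cong (suc (suc k) ℕ.+_) (ℕₚ.+-comm p q)) (sym (ℕₚ.+-assoc (suc (suc k)) q p)))
        exchange : ∀ a b c → a + (b + c) ≡ c + (b + a)
        exchange = solve-∀
        moment₂′ = trans moment₂ (exchange (P * P) (+ k) (Q * Q))
        moment₃′ = trans moment₃ (exchange (P * P * P) (+ k) (Q * Q * Q))
        by : ∀ j → k ≡ j → Isomorphic A (H q (suc (suc k)) p)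
        by zero     e = Double.double-star simple trees x deg-x q p k 1≤p p≤q size moment₂′ moment₃′ e
        by (suc k′) e = Long.long simple trees x deg-x q p k 1≤p p≤q size moment₂′ moment₃′ k′ e
          (trans (moment₄ k′ e) (cong₂ (λ s t → s + + 4 * t) (exchange (P * P * P * P) (+ k) (Q * Q * Q * Q)) (exchange P (+ k′) Q)))

-- Equal orders, the case n = 1, and the two orders of p and q.

open import Defs
open import Data.Nat using (ℕ; _≤_; _+_)
import Data.Nat.Properties as ℕₚ
open import Data.Nat using (zero; suc)
open import Data.Sum using (_⊎_; inj₁; inj₂)
open import Relation.Binary.PropositionalEquality using (_≡_; _≗_; refl; sym; trans)

open CharPoly
open Graph using (RootedTree)
open DoubleBroom
open Cospectral

theorem3p3 : (n p q : ℕ) → 1 ≤ n → 1 ≤ p → 1 ≤ q →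
    (m : ℕ) (G : Adj m) → IsSimple G →
    LCospectral G (H p n q) → Isomorphic G (H p n q)
theorem3p3 (suc n) p q 1≤n 1≤p 1≤q m G simple cospectral = go n m (χ-size _ _ χ≗) G simple χ≗
  where
  χ≗ : χ (laplacian G) ≗ χ (laplacian (H p (suc n) q))
  χ≗ k = trans (sym (lapCharPoly-χ G k)) (trans (cospectral k) (lapCharPoly-χ (H p (suc n) q) k))
  -- The order `m` is a variable here so that the equation of orders can be matched; afterwards G
  -- and H have the same vertex set.
  go : ∀ n m → m ≡ suc n + p + q → (G : Adj m) → IsSimple G → χ (laplacian G) ≗ χ (laplacian (H p (suc n) q)) → Isomorphic G (H p (suc n) q)
  go n _ refl G simple χ≗ = by-length n G simple χ≗ (cospectral-tree simple (H-simple p n q) (H-tree p n q) (H-χ-at-1 p n q) (large n) χ≗)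
    where
    large : ∀ n → 1 ≤ n + p + q
    large n = ℕₚ.≤-trans 1≤q (ℕₚ.m≤n+m q (n + p))
    by-length : ∀ n (G : Adj (suc n + p + q)) → IsSimple G → χ (laplacian G) ≗ χ (laplacian (H p (suc n) q)) →
      (∀ r → RootedTree G r) → Isomorphic G (H p (suc n) q)
    by-length zero    G simple χ≗ trees = Star.star p q 1≤p 1≤q simple χ≗ trees
    by-length (suc k) G simple χ≗ trees = cases (ℕₚ.≤-total q p)
      where
      module B = Broomlike p q 1≤p 1≤q k
      H-trees = cospectral-tree (H-simple p (suc k) q) (H-simple p (suc k) q) (H-tree p (suc k) q) (H-χ-at-1 p (suc k) q) (large (suc k)) (λ _ → refl)
      cases : q ≤ p ⊎ p ≤ q → Isomorphic G (H p (suc (suc k)) q)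
      cases (inj₁ q≤p) = B.sorted simple χ≗ trees q≤p
      -- That H(p,n,q) and H(q,n,p) are isomorphic is not shown by a relabelling: H(p,n,q) is
      -- cospectral with itself, so `swapped` applies to it as it does to G.
      cases (inj₂ p≤q) = isomorphic-trans {A = G} {H q (suc (suc k)) p} {H p (suc (suc k)) q} (B.swapped simple χ≗ trees p≤q)
        (isomorphic-sym {A = H p (suc (suc k)) q} {H q (suc (suc k)) p} (B.swapped (H-simple p (suc k) q) (λ _ → refl) H-trees p≤q))
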